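{- Let $G$ be a triangulation of a surface of Euler genus $g>0$ and let $T$ be a BFS spanning tree of $G$. Then $T$ can be vertex-partitioned into a collection $\mathcal{P}$ of vertex-disjoint vertical paths such that $G/\mathcal{P}$ has a rooted tree-decomposition with the following properties: (i) the root bag has size at most $\max\{6,32g-27\}$; (ii) the root bag has at most $6\cdot\max\{1,18g-21\}$ children; (iii) every bag other than the root bag has size at most $8$. Moreover, every subtree $\mathcal{T}'$ of the tree-decomposition rooted at a child of the root satisfies: the bags of $\mathcal{T}'$ contain at most six paths that are contained in the root bag; and if $Q_1,\ldots,Q_m$ are all the paths contained in bags of $\mathcal{T}'$ but not in the root bag, then the subgraph of $G$ induced by $V(Q_1)\cup\cdots\cup V(Q_m)$ has a connected component joined by an edge to each of the paths that are contained both in the root bag and in bags of $\mathcal{T}'$.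
   Context: A triangulation of a surface is a graph embedded in the surface such that every face is homeomorphic to an open disk and bounded by a triangle. A BFS spanning tree $T$ of a connected graph $G$ is a rooted spanning tree such that, for every vertex $v$, the path from the root to $v$ in $T$ is a shortest path in $G$; layers are the sets of vertices at a fixed distance from the root. A vertical path is a path contained in $T$ with no two vertices in the same layer (a subpath of a leaf-to-root path). For a collection $\mathcal{P}$ of vertex-disjoint paths covering $V(G)$, $G/\mathcal{P}$ is the graph whose vertices are the paths of $\mathcal{P}$, two being adjacent if some vertex of one is adjacent in $G$ to some vertex of the other. A rooted tree-decomposition of a graph $H$ is a rooted tree whose nodes (bags) are subsets of $V(H)$ such that every vertex lies in some bag, the bags containing any fixed vertex induce a connected subtree, and each edge has both endpoints in some bag. -}

module Defs where

open import Data.Nat using (ℕ; zero; suc; _+_; _*_; _∸_; _≤_; _<_; _⊔_)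
open import Data.Fin using (Fin)
open import Data.Fin.Subset using (Subset; _∈_; _∉_; ∣_∣)
open import Data.List using (List; []; _∷_; length)
open import Data.List.Membership.Propositional using () renaming (_∈_ to _∈ₗ_)
open import Data.Product using (Σ; ∃; ∃₂; _×_; _,_)
open import Data.Sum using (_⊎_)
open import Relation.Binary.PropositionalEquality using (_≡_; _≢_)
open import Function using (_∘_)

data Walk {A : Set} (R : A → A → Set) : A → A → ℕ → Set where
  nil  : ∀ {x} → Walk R x x 0
  cons : ∀ {x y z n} → R x y → Walk R y z n → Walk R x z (suc n)

data WalkIn {A : Set} (R : A → A → Set) (P : A → Set) : A → A → Set where
  here : ∀ {x} → P x → WalkIn R P x x
  step : ∀ {x y z} → P x → R x y → WalkIn R P y z → WalkIn R P x z

IsDistance : {A : Set} → (A → A → Set) → A → A → ℕ → Set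
IsDistance R a b d = Walk R a b d × (∀ k → Walk R a b k → d ≤ k)

-- reachability under the group generated by a list of involutions
data Gen {A : Set} (fs : List (A → A)) : A → A → Set where
  gen-refl : ∀ {x} → Gen fs x x
  gen-step : ∀ {f x y} → f ∈ₗ fs → Gen fs x y → Gen fs x (f y)

iter : {A : Set} → (A → A) → ℕ → A → A
iter f zero    x = x
iter f (suc n) x = f (iter f n x)

OrbitLabelling : {n k : ℕ} → List (Fin n → Fin n) → (Fin n → Fin k) → Set
OrbitLabelling {n} {k} fs lab =
  (∀ (j : Fin k) → ∃ λ x → lab x ≡ j) ×
  (∀ x y → (lab x ≡ lab y → Gen fs x y) × (Gen fs x y → lab x ≡ lab y))

AtMost : {n : ℕ} → ℕ → (Fin n → Set) → Set
AtMost {n} k P = ∃ λ (L : List (Fin n)) → length L ≤ k × (∀ x → P x → x ∈ₗ L)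

-- Triangulations of surfaces, via graph-encoded maps (flag systems).
-- A cellularly embedded graph on a (possibly non-orientable) surface is
-- encoded by its set of flags with three fixed-point-free involutions
-- τ₀ (change vertex), τ₁ (change edge), τ₂ (change face); vertices, edges,
-- faces are the orbits of ⟨τ₁,τ₂⟩, ⟨τ₀,τ₂⟩, ⟨τ₀,τ₁⟩.  The Euler genus is
-- 2 - V + E - F.  The graph G has vertex set Fin N.

record Triangulation (N g : ℕ) : Set where
  field
    flags : ℕ
    τ₀ τ₁ τ₂ : Fin flags → Fin flags
    inv₀ : ∀ x → τ₀ (τ₀ x) ≡ x
    inv₁ : ∀ x → τ₁ (τ₁ x) ≡ x
    inv₂ : ∀ x → τ₂ (τ₂ x) ≡ x
    fpf₀ : ∀ x → τ₀ x ≢ x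
    fpf₁ : ∀ x → τ₁ x ≢ x
    fpf₂ : ∀ x → τ₂ x ≢ x
    comm₀₂ : ∀ x → τ₀ (τ₂ x) ≡ τ₂ (τ₀ x)
    fpf₀₂ : ∀ x → τ₀ (τ₂ x) ≢ x
    connected : ∀ x y → Gen (τ₀ ∷ τ₁ ∷ τ₂ ∷ []) x y
    vertex : Fin flags → Fin N
    vertex-orbits : OrbitLabelling (τ₁ ∷ τ₂ ∷ []) vertex
    nE : ℕ
    edge : Fin flags → Fin nE
    edge-orbits : OrbitLabelling (τ₀ ∷ τ₂ ∷ []) edge
    nF : ℕ
    face : Fin flags → Fin nF
    face-orbits : OrbitLabelling (τ₀ ∷ τ₁ ∷ []) face
    -- every face is bounded by a walk of length 3 (face orbit has 6 flags)
    triangular : ∀ x → (iter (τ₁ ∘ τ₀) 3 x ≡ x) × ((τ₁ ∘ τ₀) x ≢ x)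
    no-loops : ∀ x → vertex (τ₀ x) ≢ vertex x
    no-multi : ∀ x y → vertex x ≡ vertex y → vertex (τ₀ x) ≡ vertex (τ₀ y) → edge x ≡ edge y
    euler : N + nF + g ≡ nE + 2

  Adj : Fin N → Fin N → Set
  Adj u w = ∃ λ x → vertex x ≡ u × vertex (τ₀ x) ≡ w

record BFSTree (N : ℕ) (Adj : Fin N → Fin N → Set) : Set where
  field
    root   : Fin N
    parent : Fin N → Fin N
    depth  : Fin N → ℕ
    depth-dist   : ∀ v → IsDistance Adj root v (depth v)
    parent-adj   : ∀ v → v ≢ root → Adj v (parent v)
    parent-depth : ∀ v → v ≢ root → suc (depth (parent v)) ≡ depth v

-- partition of V(G) into vertical paths of T: each path is
-- b, parent b, ..., parent^k b with k ≤ depth b (distinct layers)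
record VerticalPartition {N : ℕ} {Adj : Fin N → Fin N → Set} (T : BFSTree N Adj) : Set where
  open BFSTree T
  field
    p    : ℕ
    path : Fin N → Fin p
    vertical : ∀ (i : Fin p) → ∃₂ λ b k → k ≤ depth b ×
                 (∀ v → (path v ≡ i → ∃ λ j → j ≤ k × v ≡ iter parent j b) ×
                        ((∃ λ j → j ≤ k × v ≡ iter parent j b) → path v ≡ i))

QAdj : {N : ℕ} {Adj : Fin N → Fin N → Set} {T : BFSTree N Adj} →
       (P : VerticalPartition T) → Fin (VerticalPartition.p P) → Fin (VerticalPartition.p P) → Set
QAdj {Adj = Adj} P i j = i ≢ j × ∃₂ λ u w → path u ≡ i × path w ≡ j × Adj u w
  where open VerticalPartition P

TreeAdj : {m : ℕ} → Fin m → (Fin m → Fin m) → Fin m → Fin m → Set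
TreeAdj r par a b = (a ≢ r × par a ≡ b) ⊎ (b ≢ r × par b ≡ a)

record RootedTreeDecomposition (p : ℕ) (H : Fin p → Fin p → Set) : Set where
  field
    m       : ℕ
    troot   : Fin m
    tparent : Fin m → Fin m
    tdepth  : Fin m → ℕ
    troot-parent  : tparent troot ≡ troot
    tparent-depth : ∀ t → t ≢ troot → suc (tdepth (tparent t)) ≡ tdepth t
    bag : Fin m → Subset p
    covers : ∀ x → ∃ λ t → x ∈ bag t
    subtree-connected : ∀ x s t → x ∈ bag s → x ∈ bag t →
                        WalkIn (TreeAdj troot tparent) (λ u → x ∈ bag u) s t
    edge-covered : ∀ x y → H x y → ∃ λ t → x ∈ bag t × y ∈ bag t

  Child : Fin m → Set
  Child c = c ≢ troot × tparent c ≡ troot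

  Desc : Fin m → Fin m → Set
  Desc c t = ∃ λ j → iter tparent j t ≡ c

record Theorem13Properties {N g : ℕ} (Δ : Triangulation N g)
         (T : BFSTree N (Triangulation.Adj Δ)) (P : VerticalPartition T)
         (D : RootedTreeDecomposition (VerticalPartition.p P) (QAdj P)) : Set where
  open Triangulation Δ using (Adj)
  open VerticalPartition P
  open RootedTreeDecomposition D
  field
    root-bag-size : ∣ bag troot ∣ ≤ 6 ⊔ (32 * g ∸ 27)
    root-children : AtMost (6 * (1 ⊔ (18 * g ∸ 21))) Child
    other-bags : ∀ t → t ≢ troot → ∣ bag t ∣ ≤ 8
    shared-with-root : ∀ c → Child c →
      AtMost 6 (λ x → x ∈ bag troot × ∃ λ t → Desc c t × x ∈ bag t)
    component : ∀ c → Child c →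
      let InQ : Fin N → Set
          InQ v = path v ∉ bag troot × ∃ λ t → Desc c t × path v ∈ bag t
      in ∃ λ u₀ → InQ u₀ ×
           (∀ y → y ∈ bag troot → (∃ λ t → Desc c t × y ∈ bag t) →
              ∃₂ λ u w → WalkIn Adj InQ u₀ u × path w ≡ y × Adj u w)

{-# OPTIONS --safe #-}

-- Cut the surface along T and along the edges that lie neither in T nor in a spanning tree of the dual.
-- This leaves a triangulated polygon, i.e. a binary tree of triangles, whose sides are edges of T, each
-- occurring twice, and at most 2g sides coming from at most g other edges, by Euler's formula.
--
-- Paths are created one at a time: the path of a vertex z runs from z up T until it meets an earlier
-- path.  Label every vertex by the first path met on the way to the root.  A new path relabels just the
-- subtree below its top vertex; the boundary walk can only enter and leave this subtree through the two
-- occurrences of the edge above it.  So if the polygon is cut at z, each of the two arcs meeting at z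
-- gains one label change and nothing else moves.  The number of label changes around a piece bounds
-- the number of paths on its boundary.
--
-- Repeatedly cutting at a triangle that splits the label changes evenly leaves pieces with at most six
-- labels; the paths created so far form the root bag.  Each piece is cut along its chords with two
-- labelled ends into cells; the unlabelled vertices of a cell are connected and adjacent to every label
-- of the cell, and few cells carry maximal sets of labels: these are the children of the root.
-- Inside a cell one continues cutting at one vertex, or along one chord, at a time.
module Submission where

open import Defs
open import Algebra.Properties.CommutativeMonoid.Sum using ()
open import Data.Bool using (true; false)
open import Data.Empty using (⊥; ⊥-elim)
open import Data.Fin using (Fin; zero; suc; _≟_; toℕ)
import Data.Fin.Permutation as Perm
import Data.Fin.Properties as Finₚ
open import Data.Fin.Subset using (Subset; ⁅_⁆; ∣_∣; _∪_) renaming (_∈_ to _∈ˢ_; _∉_ to _∉ˢ_; ⊥ to ∅)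
open import Data.Fin.Subset.Properties using (∣⁅x⁆∣≡1; x∈p∪q⁻; x∈p∪q⁺; x∈⁅x⁆; x∈⁅y⁆⇒x≡y; ∣⊥∣≡0; ∉⊥)
open import Data.List using (List; []; _∷_; _++_; length; map; lookup; filter; allFin)
import Data.List.Membership.DecPropositional as DecMembership
open import Data.List.Membership.Propositional using (_∈_; _∉_)
open import Data.List.Membership.Propositional.Properties using (∈-++⁺ˡ; ∈-++⁺ʳ; ∈-++⁻; ∈-map⁺; ∈-map⁻; ∈-lookup; ∈-filter⁺; ∈-filter⁻; ∈-allFin)
open import Data.List.Properties using (length-++; length-map; ++-assoc)
open import Data.List.Relation.Binary.Subset.Propositional using (_⊆_)
open import Data.List.Relation.Unary.All as All using (All; []; _∷_)
open import Data.List.Relation.Unary.AllPairs using ([]; _∷_)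
open import Data.List.Relation.Unary.Any using (here; there; index)
open import Data.List.Relation.Unary.Any.Properties using (lookup-index)
open import Data.List.Relation.Unary.Unique.Propositional using (Unique)
import Data.List.Relation.Unary.Unique.Propositional.Properties as Uniqueₚ
open import Data.Nat using (ℕ; zero; suc; _+_; _∸_; _≤_; _<_; z≤n; s≤s; _≤?_; _*_; _⊓_; _⊔_)
open import Data.Nat.Properties hiding (_≟_)
open import Data.Nat.Solver using (module +-*-Solver)
open import Data.Product using (Σ; ∃; ∃₂; _×_; _,_; proj₁; proj₂)
open import Data.Sum using (_⊎_; inj₁; inj₂; [_,_]′)
open import Data.Unit using (⊤; tt)
open import Data.Vec.Base using ([]; _∷_)
open import Function using (_∘_)
open import Relation.Binary.PropositionalEquality using (_≡_; _≢_; refl; sym; trans; cong; cong₂; subst; module ≡-Reasoning)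
open import Relation.Nullary using (¬_; Dec; yes; no; contradiction)
open import Relation.Nullary.Decidable using (_×-dec_; _⊎-dec_; ¬?)

open Algebra.Properties.CommutativeMonoid.Sum +-0-commutativeMonoid using (sum; ∑-distrib-+; sum-permute; sum-cong-≗)

-- What is spent throughout is `count q`, the number of times a boundary walk runs along the edge
-- above `q`. Over all open regions together it is at most 2, as an edge has two sides. A new path
-- with top `q` must show on both arcs meeting at its bottom, so it exhausts this supply and every
-- other region keeps its labels; regions can therefore be treated in any order. The obstacle is a
-- subtree that swallows a whole arc. Such an arc has one label only, so cuts are made where the
-- lower arcs show a change. The constants: with `k = 2g − 1` the polygon starts with at most `3k`
-- changes, and each round trades at least four of them for three, so `3k − 5` rounds of three paths
-- reach five. Five changes mean six labels, and cutting along a chord adds two, whence eight.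
-- Cutting such a region at its apex fails when one side carries all five changes, as that side
-- would get six; then a chord next to a centroid triangle is used, sometimes leaving a region with
-- six changes that can be cut at its apex right away.

iter-suc : ∀ {A : Set} (f : A → A) n x → iter f n (f x) ≡ iter f (suc n) x
iter-suc f zero    x = refl
iter-suc f (suc n) x = cong f (iter-suc f n x)

module _ {A : Set} {R : A → A → Set} {P : A → Set} where
  walk-snoc : ∀ {x y z} → WalkIn R P x y → R y z → P z → WalkIn R P x z
  walk-snoc (here p)     r q = step p r (here q)
  walk-snoc (step p s w) r q = step p s (walk-snoc w r q)

  walk-map : ∀ {B : Set} {S : B → B → Set} {Q : B → Set} (f : A → B) →
             (∀ {x y} → R x y → S (f x) (f y)) → (∀ {x} → P x → Q (f x)) →
             ∀ {x y} → WalkIn R P x y → WalkIn S Q (f x) (f y)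
  walk-map f g h (here p)     = here (h p)
  walk-map f g h (step p r w) = step (h p) (g r) (walk-map f g h w)

-- Tree-decompositions grown node by node.

module Decomposition (V : Set) where

  -- The side condition of `grow` is local: an element of the new bag comes from the parent bag or
  -- has not occurred at all. It replaces the connectivity axiom, which `bag-walk` recovers from it.
  data TDec : ℕ → Set
  bag : ∀ {m} → TDec m → Fin m → List V

  data TDec where
    single : List V → TDec 1
    grow   : ∀ {m} (d : TDec m) (p : Fin m) (b : List V) →
             (∀ x → x ∈ b → x ∈ bag d p ⊎ (∀ t → x ∉ bag d t)) → TDec (suc m)

  bag (single b)     _       = b
  bag (grow d p b _) zero    = b
  bag (grow d p b _) (suc t) = bag d t

  private variable
    m : ℕ

  rt : TDec m → Fin m
  rt (single _)     = zero
  rt (grow d _ _ _) = suc (rt d)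

  par : TDec m → Fin m → Fin m
  par (single _)     _       = zero
  par (grow d p _ _) zero    = suc p
  par (grow d _ _ _) (suc t) = suc (par d t)

  dep : TDec m → Fin m → ℕ
  dep (single _)     _       = 0
  dep (grow d p _ _) zero    = suc (dep d p)
  dep (grow d _ _ _) (suc t) = dep d t

  par-rt : (d : TDec m) → par d (rt d) ≡ rt d
  par-rt (single _)     = refl
  par-rt (grow d _ _ _) = cong suc (par-rt d)

  par-dep : (d : TDec m) → ∀ t → t ≢ rt d → suc (dep d (par d t)) ≡ dep d t
  par-dep (single _)     zero    n = contradiction refl n
  par-dep (grow d _ _ _) zero    n = refl
  par-dep (grow d _ _ _) (suc t) n = par-dep d t (n ∘ cong suc)

  BagWalk : TDec m → V → Fin m → Fin m → Set
  BagWalk d x = WalkIn (TreeAdj (rt d) (par d)) (λ t → x ∈ bag d t)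

  private
    lift : ∀ {d : TDec m} {p b v x s t} → BagWalk d x s t → BagWalk (grow d p b v) x (suc s) (suc t)
    lift = walk-map suc
      (λ { (inj₁ (n , e)) → inj₁ (n ∘ Finₚ.suc-injective , cong suc e)
         ; (inj₂ (n , e)) → inj₂ (n ∘ Finₚ.suc-injective , cong suc e) })
      (λ p → p)

  bag-walk : (d : TDec m) → ∀ x s t → x ∈ bag d s → x ∈ bag d t → BagWalk d x s t
  bag-walk (single _)     x zero    zero    p q = here p
  bag-walk (grow d _ _ _) x zero    zero    p q = here p
  bag-walk (grow d _ _ _) x (suc s) (suc t) p q = lift (bag-walk d x s t p q)
  bag-walk (grow d j _ v) x zero    (suc t) p q with v x p
  ... | inj₁ r = step p (inj₁ ((λ ()) , refl)) (lift (bag-walk d x j t r q))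
  ... | inj₂ f = contradiction q (f t)
  bag-walk (grow d j _ v) x (suc s) zero    p q with v _ q
  ... | inj₁ r = walk-snoc (lift (bag-walk d x s j p r)) (inj₂ ((λ ()) , refl)) q
  ... | inj₂ f = contradiction p (f s)

  private
    climb : (d : TDec m) → ∀ {x} t → x ∈ bag d (rt d) → x ∈ bag d t → t ≢ rt d → x ∈ bag d (par d t)
    climb (single _)     zero    p q n = contradiction refl n
    climb (grow d _ _ _) (suc t) p q n = climb d t p q (n ∘ cong suc)
    climb (grow d _ _ v) zero    p q n with v _ q
    ... | inj₁ r = r
    ... | inj₂ f = contradiction p (f (rt d))

  Desc : TDec m → Fin m → Fin m → Set
  Desc d j t = ∃ λ k → iter (par d) k t ≡ j

  -- An element of the root bag is never new, so it can reach a later bag only through the parent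
  -- bag. It therefore persists on the whole way from `t` to the root, and this way passes `j`.
  -- Hence all that a subtree shares with the root can be read off from one bag.
  shared-in-child : (d : TDec m) → ∀ {x} {j t} → j ≢ rt d → x ∈ bag d (rt d) → Desc d j t →
                    x ∈ bag d t → x ∈ bag d j
  shared-in-child d {x} {j} {t} n p (k , e) = go k t e
    where
    stays : ∀ k → iter (par d) k (rt d) ≡ rt d
    stays zero    = refl
    stays (suc k) = trans (cong (par d) (stays k)) (par-rt d)
    go : ∀ k t → iter (par d) k t ≡ j → x ∈ bag d t → x ∈ bag d j
    go zero    t refl q = q
    go (suc k) t e    q with t ≟ rt d
    ... | yes refl = contradiction (trans (sym e) (stays (suc k))) n
    ... | no t≢    = go k (par d t) (trans (iter-suc (par d) k t) e) (climb d t p q t≢)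

  desc-lift : ∀ {d : TDec m} {p b v j t} → Desc d j t → Desc (grow d p b v) (suc j) (suc t)
  desc-lift {d = d} {p} {b} {v} {j} {t} (k , e) = k , trans (go k) (cong suc e)
    where
    go : ∀ k → iter (par (grow d p b v)) k (suc t) ≡ suc (iter (par d) k t)
    go zero    = refl
    go (suc k) = cong (par (grow d p b v)) (go k)

  desc-trans : ∀ {d : TDec m} {i j t} → Desc d i j → Desc d j t → Desc d i t
  desc-trans {d = d} {i} {j} {t} (k , e) (l , refl) = k + l , trans (go k) e
    where
    go : ∀ k → iter (par d) (k + l) t ≡ iter (par d) k (iter (par d) l t)
    go zero    = refl
    go (suc k) = cong (par d) (go k)

  Child : TDec m → Fin m → Set
  Child d c = c ≢ rt d × par d c ≡ rt d

  -- New nodes are numbered 0, so each later node shifts the embedding of d by one.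
  record _↪_ {m m′} (d : TDec m) (d′ : TDec m′) : Set where
    field
      emb      : Fin m → Fin m′
      emb-bag  : ∀ t → bag d′ (emb t) ≡ bag d t
      emb-rt   : emb (rt d) ≡ rt d′
      emb-desc : ∀ {j t} → Desc d j t → Desc d′ (emb j) (emb t)
      children : ∀ {c} → Child d′ c → ∃ λ c₀ → Child d c₀ × emb c₀ ≡ c

  open _↪_ public

  ↪-refl : {d : TDec m} → d ↪ d
  ↪-refl = record { emb = λ t → t ; emb-bag = λ _ → refl ; emb-rt = refl
                  ; emb-desc = λ p → p ; children = λ c → _ , c , refl }

  ↪-trans : ∀ {m₁ m₂ m₃} {d₁ : TDec m₁} {d₂ : TDec m₂} {d₃ : TDec m₃} → d₁ ↪ d₂ → d₂ ↪ d₃ → d₁ ↪ d₃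
  ↪-trans e f = record
    { emb = emb f ∘ emb e
    ; emb-bag = λ t → trans (emb-bag f (emb e t)) (emb-bag e t)
    ; emb-rt = trans (cong (emb f) (emb-rt e)) (emb-rt f)
    ; emb-desc = emb-desc f ∘ emb-desc e
    ; children = λ c → let c₁ , p , q = children f c
                           c₀ , r , s = children e p
                       in c₀ , r , trans (cong (emb f) s) q }

  -- Growth away from the root creates no child of the root, so the children are final as soon as
  -- the cells have been placed.
  ↪-grow : ∀ {d : TDec m} {p b v} → p ≢ rt d → d ↪ grow d p b v
  ↪-grow {d = d} {p} {b} {v} n = record
    { emb = suc ; emb-bag = λ _ → refl ; emb-rt = refl ; emb-desc = desc-lift {v = v} ; children = ch }
    where
    ch : ∀ {c} → Child (grow d p b v) c → ∃ λ c₀ → Child d c₀ × suc c₀ ≡ c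
    ch {zero}  (_ , e) = contradiction (Finₚ.suc-injective e) n
    ch {suc c} (q , e) = c , (q ∘ cong suc , Finₚ.suc-injective e) , refl

iter-+ : ∀ {A : Set} (f : A → A) m n x → iter f (m + n) x ≡ iter f m (iter f n x)
iter-+ f zero    n x = refl
iter-+ f (suc m) n x = cong f (iter-+ f m n x)

-- The ancestor order of the tree and the labelling by vertical paths.

module Ancestry {N : ℕ} {Adj : Fin N → Fin N → Set} (T : BFSTree N Adj) where
  open BFSTree T

  V : Set
  V = Fin N

  data Anc (a : V) : V → Set where
    self  : Anc a a
    above : ∀ {v} → v ≢ root → Anc a (parent v) → Anc a v

  anc-trans : ∀ {a b v} → Anc a b → Anc b v → Anc a v
  anc-trans p self        = p
  anc-trans p (above r q) = above r (anc-trans p q)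

  depth-root : depth root ≡ 0
  depth-root = n≤0⇒n≡0 (proj₂ (depth-dist root) 0 nil)

  depth-zero : ∀ {v} → depth v ≡ 0 → v ≡ root
  depth-zero {v} eq with v ≟ root
  ... | yes p = p
  ... | no ¬p = contradiction (trans (sym eq) (sym (parent-depth v ¬p))) 0≢1+n

  private
    anc?′ : ∀ n a v → depth v ≡ n → Dec (Anc a v)
    anc?′ n a v eq with v ≟ a
    ... | yes refl = yes self
    ... | no v≢a with v ≟ root
    ...   | yes r = no λ { self → v≢a refl ; (above ¬r _) → ¬r r }
    anc?′ zero a v eq | no v≢a | no ¬r = contradiction (depth-zero eq) ¬r
    anc?′ (suc n) a v eq | no v≢a | no ¬r
      with anc?′ n a (parent v) (suc-injective (trans (parent-depth v ¬r) eq))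
    ... | yes p = yes (above ¬r p)
    ... | no ¬p = no λ { self → v≢a refl ; (above _ p) → ¬p p }

  anc? : ∀ a v → Dec (Anc a v)
  anc? a v = anc?′ _ a v refl

  anc-depth : ∀ {a v} → Anc a v → depth a ≤ depth v
  anc-depth self = ≤-refl
  anc-depth {a} {v} (above r p) =
    ≤-trans (anc-depth p) (≤-trans (n≤1+n _) (≤-reflexive (parent-depth v r)))

  iter-anc : ∀ j z → j ≤ depth z → Anc (iter parent j z) z × depth (iter parent j z) + j ≡ depth z
  iter-anc zero z _ = self , +-identityʳ _
  iter-anc (suc j) z j<d with iter-anc j z (<⇒≤ j<d)
  ... | p , eq with iter parent j z ≟ root
  ...   | yes r = contradiction
            (≤-trans j<d (≤-reflexive (trans (sym eq) (cong (_+ j) (trans (cong depth r) depth-root))))) (<-irrefl refl)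
  ...   | no ¬r = anc-trans (above ¬r self) p ,
            trans (+-suc _ j) (trans (cong (_+ j) (parent-depth _ ¬r)) eq)

  anc-iter : ∀ {v z} → Anc v z → ∃ λ j → j ≤ depth z × v ≡ iter parent j z
  anc-iter self = 0 , z≤n , refl
  anc-iter {v} {z} (above r p) with anc-iter p
  ... | j , le , eq = suc j , ≤-trans (s≤s le) (≤-reflexive (parent-depth z r)) , trans eq (iter-suc parent j z)

  root-anc : ∀ v → Anc root v
  root-anc v = subst (λ a → Anc a v) (depth-zero (+-cancelʳ-≡ (depth v) _ 0 (proj₂ p))) (proj₁ p)
    where p = iter-anc (depth v) v ≤-refl

  -- A vertical path is needed both as an interval of the ancestor order, to compare it with
  -- subtrees, and as a list of iterates of `parent`, the form that `VerticalPartition` demands.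
  segment : ∀ k z → k ≤ depth z → ∀ v →
            (Anc (iter parent k z) v × Anc v z → ∃ λ j → j ≤ k × v ≡ iter parent j z) ×
            ((∃ λ j → j ≤ k × v ≡ iter parent j z) → Anc (iter parent k z) v × Anc v z)
  segment k z k≤d v = to , from
    where
    to : Anc (iter parent k z) v × Anc v z → ∃ λ j → j ≤ k × v ≡ iter parent j z
    to (p , q) with anc-iter q
    ... | j , j≤d , refl = j , +-cancelʳ-≤ (depth (iter parent k z)) j k
            (≤-trans (+-monoʳ-≤ j (anc-depth p))
              (≤-reflexive (trans (+-comm j _) (trans (proj₂ (iter-anc j z j≤d))
                (trans (sym (proj₂ (iter-anc k z k≤d))) (+-comm _ k)))))) , refl
    from : (∃ λ j → j ≤ k × v ≡ iter parent j z) → Anc (iter parent k z) v × Anc v z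
    from (j , j≤k , refl) =
      subst (λ a → Anc a (iter parent j z))
            (trans (sym (iter-+ parent (k ∸ j) j z)) (cong (λ i → iter parent i z) (m∸n+n≡m j≤k)))
            (proj₁ (iter-anc (k ∸ j) (iter parent j z) le)) ,
      proj₁ A
      where
      A = iter-anc j z (≤-trans j≤k k≤d)
      le : k ∸ j ≤ depth (iter parent j z)
      le = m≤n+o⇒m∸n≤o k j (≤-trans k≤d (≤-reflexive (trans (sym (proj₂ A)) (+-comm _ j))))

  -- A path is named by its bottom vertex: `Z` lists the names, `U` is the union of the paths and
  -- `c` the labelling. The field `class` has the shape of `vertical` in `VerticalPartition`, so a
  -- state in which `U` holds everywhere already is a partition.
  record State : Set₁ where
    field
      U      : V → Set
      U?     : ∀ v → Dec (U v)
      c      : V → V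
      Z      : List V
      U-root : U root
      U-up   : ∀ {v} → v ≢ root → U v → U (parent v)
      c-up   : ∀ {v} → ¬ U v → c v ≡ c (parent v)
      c∈Z    : ∀ v → c v ∈ Z
      unique : Unique Z
      class  : ∀ {z} → z ∈ Z → ∃ λ k → k ≤ depth z ×
                 (∀ v → (U v × c v ≡ z → ∃ λ j → j ≤ k × v ≡ iter parent j z) ×
                        ((∃ λ j → j ≤ k × v ≡ iter parent j z) → U v × c v ≡ z))

    U-anc : ∀ {a v} → Anc a v → U v → U a
    U-anc self        u = u
    U-anc (above r p) u = U-anc p (U-up r u)

    Z⊆U : ∀ {z} → z ∈ Z → U z
    Z⊆U {z} z∈ with class z∈
    ... | k , _ , f = proj₁ (proj₂ (f z) (0 , z≤n , refl))

    c-bottom : ∀ {z} → z ∈ Z → c z ≡ z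
    c-bottom {z} z∈ with class z∈
    ... | k , _ , f = proj₂ (proj₂ (f z) (0 , z≤n , refl))

    top-unlabelled : ∀ n z → depth z ≡ n → ¬ U z →
      ∃ λ k → suc k ≤ depth z × ¬ U (iter parent k z) × U (parent (iter parent k z))
    top-unlabelled n z eq ¬u with z ≟ root
    ... | yes refl = contradiction U-root ¬u
    top-unlabelled zero z eq ¬u | no ¬r = contradiction (depth-zero eq) ¬r
    top-unlabelled (suc n) z eq ¬u | no ¬r with U? (parent z)
    ... | yes u = 0 , ≤-trans (s≤s z≤n) (≤-reflexive (parent-depth z ¬r)) , ¬u , u
    ... | no ¬u′ with top-unlabelled n (parent z) (suc-injective (trans (parent-depth z ¬r) eq)) ¬u′
    ...   | k , le , p , q rewrite iter-suc parent k z =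
              suc k , ≤-trans (s≤s le) (≤-reflexive (parent-depth z ¬r)) , p , q

    -- `U` is closed under parents, so everything below `q` is unlabelled too and inherits its label
    -- through `q`.
    c-const : ∀ {q} → ¬ U q → ∀ {v} → Anc q v → c v ≡ c q
    c-const ¬u self        = refl
    c-const ¬u (above r p) = trans (c-up (λ u → ¬u (U-anc (above r p) u))) (c-const ¬u p)

  open State

  start : V → State
  start z = record
    { U = λ v → Anc v z
    ; U? = λ v → anc? v z
    ; c = λ _ → z
    ; Z = z ∷ []
    ; U-root = root-anc z
    ; U-up = λ r p → anc-trans (above r self) p
    ; c-up = λ _ → refl
    ; c∈Z = λ _ → here refl
    ; unique = [] ∷ []
    ; class = λ { (here refl) → depth z , ≤-refl , λ v →
        (λ p → proj₁ (segment (depth z) z ≤-refl v)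
                 (subst (λ a → Anc a v) (sym (top z)) (root-anc v) , proj₁ p)) ,
        (λ e → proj₂ (proj₂ (segment (depth z) z ≤-refl v) e) , refl) }
    }
    where
    top : ∀ z → iter parent (depth z) z ≡ root
    top z = depth-zero (+-cancelʳ-≡ (depth z) _ 0 (proj₂ (iter-anc (depth z) z ≤-refl)))

  -- The path itself runs only between `q` and `z`, yet all of `Anc q` is relabelled: no vertex
  -- there met an earlier path before leaving this subtree.
  record Fresh (st st′ : State) (z q : V) : Set where
    field
      q∉U  : ¬ U st q
      q⊑z  : Anc q z
      inX  : ∀ {v} → Anc q v → c st′ v ≡ z
      outX : ∀ {v} → ¬ Anc q v → c st′ v ≡ c st v
      Z≡   : Z st′ ≡ z ∷ Z st
      z∉Z  : z ∉ Z st
      U⊆   : ∀ {v} → U st v → U st′ v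
      U⊇   : ∀ {v} → U st′ v → U st v ⊎ Anc q v
      Uz   : U st′ z

  data Add (st : State) (z : V) : State → Set₁ where
    old   : U st z → Add st z st
    fresh : ∀ {st′} q → Fresh st st′ z q → Add st z st′

  add : ∀ st z → ∃ (Add st z)
  add st z with U? st z
  ... | yes u = st , old u
  ... | no ¬u with top-unlabelled st (depth z) z refl ¬u
  ...   | k , k<d , q∉ , pq∈ = st′ , fresh q fr
    where
    q : V
    q = iter parent k z
    k≤d : k ≤ depth z
    k≤d = <⇒≤ k<d
    seg = segment k z k≤d
    c′ : V → V
    c′ v with anc? q v
    ... | yes _ = z
    ... | no  _ = c st v
    c′-in : ∀ {v} → Anc q v → c′ v ≡ z
    c′-in {v} p with anc? q v
    ... | yes _ = refl
    ... | no ¬p = contradiction p ¬p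
    c′-out : ∀ {v} → ¬ Anc q v → c′ v ≡ c st v
    c′-out {v} ¬p with anc? q v
    ... | yes p = contradiction p ¬p
    ... | no _  = refl
    q⊑ : Anc q z
    q⊑ = proj₁ (iter-anc k z k≤d)
    U∩X : ∀ {v} → U st v → ¬ Anc q v
    U∩X u p = q∉ (U-anc st p u)
    z∉ : z ∉ Z st
    z∉ z∈ = ¬u (Z⊆U st z∈)
    U′ : V → Set
    U′ v = U st v ⊎ (Anc q v × Anc v z)
    up′ : ∀ {v} → v ≢ root → U′ v → U′ (parent v)
    up′ r (inj₁ u) = inj₁ (U-up st r u)
    up′ r (inj₂ (self , p)) = inj₁ pq∈
    up′ r (inj₂ (above _ a , p)) = inj₂ (a , anc-trans (above r self) p)
    cup′ : ∀ {v} → ¬ U′ v → c′ v ≡ c′ (parent v)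
    cup′ {v} ¬u′ with anc? q v
    ... | yes self = contradiction (inj₂ (self , q⊑)) ¬u′
    ... | yes (above r p) = sym (c′-in p)
    ... | no ¬p = trans (c-up st (λ u → ¬u′ (inj₁ u)))
          (sym (c′-out λ p → ¬p (above (λ { refl → ¬u′ (inj₁ (U-root st)) }) p)))
    c∈′ : ∀ v → c′ v ∈ z ∷ Z st
    c∈′ v with anc? q v
    ... | yes _ = here refl
    ... | no _  = there (c∈Z st v)
    class′ : ∀ {y} → y ∈ z ∷ Z st → ∃ λ k → k ≤ depth y ×
               (∀ v → (U′ v × c′ v ≡ y → ∃ λ j → j ≤ k × v ≡ iter parent j y) ×
                      ((∃ λ j → j ≤ k × v ≡ iter parent j y) → U′ v × c′ v ≡ y))
    class′ (here refl) = k , k≤d , λ v → to v , from v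
      where
      to : ∀ v → U′ v × c′ v ≡ z → ∃ λ j → j ≤ k × v ≡ iter parent j z
      to v (inj₂ p , _) = proj₁ (seg v) p
      to v (inj₁ u , eq) = contradiction
        (subst (_∈ Z st) (trans (sym (c′-out (U∩X u))) eq) (c∈Z st v)) z∉
      from : ∀ v → (∃ λ j → j ≤ k × v ≡ iter parent j z) → U′ v × c′ v ≡ z
      from v e with proj₂ (seg v) e
      ... | p = inj₂ p , c′-in (proj₁ p)
    class′ {y} (there y∈) with class st y∈
    ... | k₁ , le , f = k₁ , le , λ v → to v , from v
      where
      to : ∀ v → U′ v × c′ v ≡ y → ∃ λ j → j ≤ k₁ × v ≡ iter parent j y
      to v (inj₁ u , eq) = proj₁ (f v) (u , trans (sym (c′-out (U∩X u))) eq)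
      to v (inj₂ p , eq) = contradiction
        (subst (_∈ Z st) (trans (sym eq) (c′-in (proj₁ p))) y∈) z∉
      from : ∀ v → (∃ λ j → j ≤ k₁ × v ≡ iter parent j y) → U′ v × c′ v ≡ y
      from v e with proj₂ (f v) e
      ... | u , eq = inj₁ u , trans (c′-out (U∩X u)) eq
    st′ : State
    st′ = record
      { U = U′ ; U? = λ v → U? st v ⊎-dec (anc? q v ×-dec anc? v z) ; c = c′ ; Z = z ∷ Z st
      ; U-root = inj₁ (U-root st) ; U-up = up′ ; c-up = cup′ ; c∈Z = c∈′
      ; unique = All.tabulate (λ { x∈ refl → z∉ x∈ }) ∷ unique st
      ; class = class′ }
    fr : Fresh st st′ z q
    fr = record { q∉U = q∉ ; q⊑z = q⊑ ; inX = c′-in ; outX = c′-out ; Z≡ = refl ; z∉Z = z∉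
                ; U⊆ = inj₁ ; U⊇ = λ { (inj₁ u) → inj₁ u ; (inj₂ p) → inj₂ (proj₁ p) }
                ; Uz = inj₂ (q⊑ , self) }

  -- `U-back` keeps old and new paths apart: whoever finally lies on an old path did so from the
  -- beginning. In the end it shows that unlabelled vertices of a cell avoid the paths of the root
  -- bag.
  record Ext (st st′ : State) : Set where
    field
      U-mono : ∀ {v} → U st v → U st′ v
      c-stay : ∀ {v} → U st v → c st′ v ≡ c st v
      Z-mono : ∀ {z} → z ∈ Z st → z ∈ Z st′
      U-back : ∀ {v} → U st′ v → c st′ v ∈ Z st → U st v

  open Ext

  ext-refl : ∀ {st} → Ext st st
  ext-refl = record { U-mono = λ u → u ; c-stay = λ _ → refl ; Z-mono = λ z → z ; U-back = λ u _ → u }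

  ext-trans : ∀ {s₁ s₂ s₃} → Ext s₁ s₂ → Ext s₂ s₃ → Ext s₁ s₃
  ext-trans {s₁} {s₂} {s₃} e f = record
    { U-mono = λ u → U-mono f (U-mono e u)
    ; c-stay = λ u → trans (c-stay f (U-mono e u)) (c-stay e u)
    ; Z-mono = λ z → Z-mono f (Z-mono e z)
    ; U-back = λ u z → let u₂ = U-back f u (Z-mono e z) in
                       U-back e u₂ (subst (_∈ Z s₁) (c-stay f u₂) z) }

  add-ext : ∀ {st z st′} → Add st z st′ → Ext st st′
  add-ext (old _) = ext-refl
  add-ext {st} {z} {st′} (fresh q fr) = record
    { U-mono = U⊆
    ; c-stay = λ u → outX λ p → q∉U (U-anc st p u)
    ; Z-mono = λ y∈ → subst (_ ∈_) (sym Z≡) (there y∈)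
    ; U-back = back }
    where
    open Fresh fr
    back : ∀ {v} → U st′ v → c st′ v ∈ Z st → U st v
    back u m with U⊇ u
    ... | inj₁ p = p
    ... | inj₂ p = contradiction (subst (_∈ Z st) (inX p) m) z∉Z

  add-U : ∀ {st z st′} → Add st z st′ → U st′ z
  add-U (old u) = u
  add-U (fresh q fr) = Fresh.Uz fr

  add-c : ∀ {st z st′} → Add st z st′ → ∀ v → c st′ v ≡ c st v ⊎ c st′ v ≡ c st′ z
  add-c (old _) v = inj₁ refl
  add-c (fresh q fr) v with anc? q v
  ... | yes p = inj₂ (trans (Fresh.inX fr p) (sym (Fresh.inX fr (Fresh.q⊑z fr))))
  ... | no ¬p = inj₁ (Fresh.outX fr ¬p)

  add-fresh : ∀ {st z st′} → Add st z st′ → c st′ z ≡ c st z ⊎ c st′ z ∉ Z st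
  add-fresh (old _) = inj₁ refl
  add-fresh {st} (fresh q fr) = inj₂ (subst (_∉ Z st) (sym (Fresh.inX fr (Fresh.q⊑z fr))) (Fresh.z∉Z fr))

  add-length : ∀ {st z st′} → Add st z st′ → length (Z st′) ≤ suc (length (Z st))
  add-length (old _) = n≤1+n _
  add-length (fresh q fr) = ≤-reflexive (cong length (Fresh.Z≡ fr))

  -- Triangulated polygons and label changes along their boundaries.

  δ : V → V → ℕ
  δ a b with a ≟ b
  ... | yes _ = 0
  ... | no _  = 1

  ε : V → V → ℕ
  ε a b with a ≟ b
  ... | yes _ = 1
  ... | no _  = 0

  δ≤1 : ∀ a b → δ a b ≤ 1
  δ≤1 a b with a ≟ b
  ... | yes _ = z≤n
  ... | no _  = ≤-refl

  δ-refl : ∀ a → δ a a ≡ 0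
  δ-refl a with a ≟ a
  ... | yes _ = refl
  ... | no p  = contradiction refl p

  δ-tri : ∀ a b e → δ a e ≤ δ a b + δ b e
  δ-tri a b e with a ≟ e
  ... | yes _ = z≤n
  ... | no a≢e with a ≟ b
  ...   | no _ = s≤s z≤n
  ...   | yes refl with a ≟ e
  ...     | yes p = contradiction p a≢e
  ...     | no _ = ≤-refl

  δ-≢ : ∀ {a b} → a ≢ b → 1 ≤ δ a b
  δ-≢ {a} {b} p with a ≟ b
  ... | yes q = contradiction q p
  ... | no _ = ≤-refl

  -- A polygon is seen from its base edge `u w`: the boundary walk leads from `u` to `w`, and `node`
  -- is the triangle on the base. `up` and `down` are tree edges traversed in the two directions.
  -- `stop` is an edge outside the tree, or an edge with two labelled ends where something has been
  -- cut off.
  data Poly : V → V → Set where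
    up   : ∀ {v w} → v ≢ root → parent v ≡ w → Poly v w
    down : ∀ {v w} → v ≢ root → parent v ≡ w → Poly w v
    stop : ∀ {u w} → Adj u w → Poly u w
    node : ∀ {u z w} → Adj u w → Poly u z → Poly z w → Poly u w

  private variable
    u w z l h m : V

  -- Tree edges are named by their lower ends, so these are the traversals of the edge above `q`.
  count : V → Poly u w → ℕ
  count q (up {v} _ _)   = ε v q
  count q (down {v} _ _) = ε v q
  count q (stop _)       = 0
  count q (node _ L M)   = count q L + count q M

  ch : (V → V) → Poly u w → ℕ
  ch c (node _ L M) = ch c L + ch c M
  ch {u} {w} c (up _ _)   = δ (c u) (c w)
  ch {u} {w} c (down _ _) = δ (c u) (c w)
  ch {u} {w} c (stop _)   = δ (c u) (c w)

  -- While the first paths are being created, stop sides may still have unlabelled ends and changes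
  -- on them are out of control. They are left out here and paid for once, at the end, by
  -- `stopCount`.
  treeCh : (V → V) → Poly u w → ℕ
  treeCh c (node _ L M) = treeCh c L + treeCh c M
  treeCh c (stop _)     = 0
  treeCh c P            = ch c P

  stopCount : Poly u w → ℕ
  stopCount (node _ L M) = stopCount L + stopCount M
  stopCount (stop _)     = 1
  stopCount _            = 0

  size : Poly u w → ℕ
  size (node _ L M) = suc (size L + size M)
  size _            = 0

  Corner : Poly u w → V → Set
  Corner (node _ L M) v = Corner L v ⊎ Corner M v
  Corner {u} {w} (up _ _) v   = v ≡ u ⊎ v ≡ w
  Corner {u} {w} (down _ _) v = v ≡ u ⊎ v ≡ w
  Corner {u} {w} (stop _) v   = v ≡ u ⊎ v ≡ w

  Stops : (V → Set) → Poly u w → Set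
  Stops R (node _ L M)     = Stops R L × Stops R M
  Stops {u} {w} R (stop _) = R u × R w
  Stops R _                = ⊤

  data Tri : Poly u w → V → V → V → Set where
    top   : ∀ {a} {L : Poly u z} {M : Poly z w} → Tri (node a L M) u z w
    left  : ∀ {a} {L : Poly u z} {M : Poly z w} {x y t} → Tri L x y t → Tri (node a L M) x y t
    right : ∀ {a} {L : Poly u z} {M : Poly z w} {x y t} → Tri M x y t → Tri (node a L M) x y t

  stops-map : ∀ {R S : V → Set} (P : Poly u w) → (∀ {v} → R v → S v) → Stops R P → Stops S P
  stops-map (up _ _) f _ = tt
  stops-map (down _ _) f _ = tt
  stops-map (stop _) f (a , b) = f a , f b
  stops-map (node _ L M) f (a , b) = stops-map L f a , stops-map M f b

  corner-left : (P : Poly u w) → Corner P u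
  corner-left (up _ _) = inj₁ refl
  corner-left (down _ _) = inj₁ refl
  corner-left (stop _) = inj₁ refl
  corner-left (node _ L M) = inj₁ (corner-left L)

  corner-right : (P : Poly u w) → Corner P w
  corner-right (up _ _) = inj₂ refl
  corner-right (down _ _) = inj₂ refl
  corner-right (stop _) = inj₂ refl
  corner-right (node _ L M) = inj₂ (corner-right M)

  ch-ends : ∀ c (P : Poly u w) → δ (c u) (c w) ≤ ch c P
  ch-ends c (up _ _) = ≤-refl
  ch-ends c (down _ _) = ≤-refl
  ch-ends c (stop _) = ≤-refl
  ch-ends c (node _ L M) = ≤-trans (δ-tri _ _ _) (+-mono-≤ (ch-ends c L) (ch-ends c M))

  ch-cong : ∀ {c c′} (P : Poly u w) → (∀ v → Corner P v → c′ v ≡ c v) → ch c′ P ≡ ch c P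
  ch-cong (up _ _) f = cong₂ δ (f _ (inj₁ refl)) (f _ (inj₂ refl))
  ch-cong (down _ _) f = cong₂ δ (f _ (inj₁ refl)) (f _ (inj₂ refl))
  ch-cong (stop _) f = cong₂ δ (f _ (inj₁ refl)) (f _ (inj₂ refl))
  ch-cong (node _ L M) f = cong₂ _+_ (ch-cong L λ v p → f v (inj₁ p)) (ch-cong M λ v p → f v (inj₂ p))

  ch-const : ∀ {c a} (P : Poly u w) → (∀ v → Corner P v → c v ≡ a) → ch c P ≡ 0
  ch-const {a = a} (up _ _) f = trans (cong₂ δ (f _ (inj₁ refl)) (f _ (inj₂ refl))) (δ-refl a)
  ch-const {a = a} (down _ _) f = trans (cong₂ δ (f _ (inj₁ refl)) (f _ (inj₂ refl))) (δ-refl a)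
  ch-const {a = a} (stop _) f = trans (cong₂ δ (f _ (inj₁ refl)) (f _ (inj₂ refl))) (δ-refl a)
  ch-const (node _ L M) f = cong₂ _+_ (ch-const L λ v p → f v (inj₁ p)) (ch-const M λ v p → f v (inj₂ p))

  -- Only the label after each change is listed. Repetitions may remain, but the length is governed
  -- by the number of changes, and this is what bounds the bags.
  tail : (V → V) → Poly u w → List V
  tail c (node _ L M) = tail c L ++ tail c M
  tail {u} {w} c _ with c u ≟ c w
  ... | yes _ = []
  ... | no _  = c w ∷ []

  labels : (V → V) → Poly u w → List V
  labels {u} c P = c u ∷ tail c P

  labels-length : ∀ c (P : Poly u w) → length (labels c P) ≡ suc (ch c P)
  labels-length c P = cong suc (go P)
    where
    go : ∀ {u w} (P : Poly u w) → length (tail c P) ≡ ch c P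
    go {u} {w} (up _ _) with c u ≟ c w
    ... | yes _ = refl
    ... | no _ = refl
    go {u} {w} (down _ _) with c u ≟ c w
    ... | yes _ = refl
    ... | no _ = refl
    go {u} {w} (stop _) with c u ≟ c w
    ... | yes _ = refl
    ... | no _ = refl
    go (node _ L M) = trans (length-++ (tail c L)) (cong₂ _+_ (go L) (go M))

  labels-all : ∀ c (P : Poly u w) {v} → Corner P v → c v ∈ labels c P
  labels-all c (node _ L M) (inj₁ p) with labels-all c L p
  ... | here e  = here e
  ... | there q = there (∈-++⁺ˡ q)
  labels-all c (node a L M) (inj₂ p) with labels-all c M p
  ... | there q = there (∈-++⁺ʳ (tail c L) q)
  ... | here e with labels-all c L (corner-right L)
  ...   | here e′  = here (trans e e′)
  ...   | there q = subst (_∈ labels c (node a L M)) (sym e) (there (∈-++⁺ˡ q))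
  labels-all c (up _ _) (inj₁ refl) = here refl
  labels-all c (down _ _) (inj₁ refl) = here refl
  labels-all c (stop _) (inj₁ refl) = here refl
  labels-all {u} {w} c (up _ _) (inj₂ refl) with c u ≟ c w
  ... | yes e = here (sym e)
  ... | no _ = there (here refl)
  labels-all {u} {w} c (down _ _) (inj₂ refl) with c u ≟ c w
  ... | yes e = here (sym e)
  ... | no _ = there (here refl)
  labels-all {u} {w} c (stop _) (inj₂ refl) with c u ≟ c w
  ... | yes e = here (sym e)
  ... | no _ = there (here refl)

  labels-corner : ∀ c (P : Poly u w) {x} → x ∈ labels c P → ∃ λ v → Corner P v × x ≡ c v
  labels-corner c P (here e) = _ , corner-left P , e
  labels-corner c P (there q) = go P q
    where
    go : ∀ {u w} (P : Poly u w) {x} → x ∈ tail c P → ∃ λ v → Corner P v × x ≡ c v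
    go (node _ L M) q with ∈-++⁻ (tail c L) q
    ... | inj₁ p = let v , r , e = go L p in v , inj₁ r , e
    ... | inj₂ p = let v , r , e = go M p in v , inj₂ r , e
    go {u} {w} (up _ _) q with c u ≟ c w | q
    ... | no _ | here e = w , inj₂ refl , e
    go {u} {w} (down _ _) q with c u ≟ c w | q
    ... | no _ | here e = w , inj₂ refl , e
    go {u} {w} (stop _) q with c u ≟ c w | q
    ... | no _ | here e = w , inj₂ refl , e

  -- The subtree below q is separated from the rest of T by the single edge from q to its parent.
  module Below (q : V) where
    X : V → Set
    X = Anc q

    ε-≢ : ∀ {v} → v ≢ q → ε v q ≡ 0
    ε-≢ {v} p with v ≟ q
    ... | yes e = contradiction e p
    ... | no _ = refl

    X-parent : ∀ {v} → v ≢ root → X (parent v) → X v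
    X-parent r p = above r p

    X-child : ∀ {v} → v ≢ q → X v → X (parent v)
    X-child n self = contradiction refl n
    X-child n (above _ p) = p

    edge-out : ∀ {v} → X v → ¬ X (parent v) → 1 ≤ ε v q
    edge-out {v} p n with v ≟ q
    ... | yes _ = ≤-refl
    ... | no v≢q = contradiction (X-child v≢q p) n

    -- Stop sides have both ends outside the subtree, so the walk can get in only along a tree edge,
    -- and the sole tree edge leading in is the one above `q`.
    enter : (P : Poly u w) → Stops (λ v → ¬ X v) P → ¬ X u → X w → 1 ≤ count q P
    enter (up r refl) _ n p = contradiction (X-parent r p) n
    enter (down r refl) _ n p = edge-out p n
    enter (stop _) (_ , b) n p = contradiction p b
    enter (node {z = z} _ L M) (a , b) n p with anc? q z
    ... | yes x = ≤-trans (enter L a n x) (m≤m+n _ _)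
    ... | no x  = ≤-trans (enter M b x p) (m≤n+m _ (count q L))

    leave : (P : Poly u w) → Stops (λ v → ¬ X v) P → X u → ¬ X w → 1 ≤ count q P
    leave (up r refl) _ p n = edge-out p n
    leave (down r refl) _ p n = contradiction (X-parent r p) n
    leave (stop _) (a , _) p n = contradiction p a
    leave (node {z = z} _ L M) (a , b) p n with anc? q z
    ... | yes x = ≤-trans (leave M b x n) (m≤n+m _ (count q L))
    ... | no x  = ≤-trans (leave L a p x) (m≤m+n _ _)

    visit : (P : Poly u w) → Stops (λ v → ¬ X v) P → ¬ X u → ¬ X w → ∀ {v} → Corner P v → X v → 2 ≤ count q P
    visit (up _ _) _ n _ (inj₁ refl) p = contradiction p n
    visit (up _ _) _ _ n (inj₂ refl) p = contradiction p n
    visit (down _ _) _ n _ (inj₁ refl) p = contradiction p n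
    visit (down _ _) _ _ n (inj₂ refl) p = contradiction p n
    visit (stop _) _ n _ (inj₁ refl) p = contradiction p n
    visit (stop _) _ _ n (inj₂ refl) p = contradiction p n
    visit (node {z = z} _ L M) (a , b) n n′ cv p with anc? q z
    ... | yes x = +-mono-≤ (enter L a n x) (leave M b x n′)
    visit (node {z = z} _ L M) (a , b) n n′ (inj₁ cv) p | no x = ≤-trans (visit L a n x cv p) (m≤m+n _ _)
    visit (node {z = z} _ L M) (a , b) n n′ (inj₂ cv) p | no x = ≤-trans (visit M b x n′ cv p) (m≤n+m _ (count q L))

    stays : (P : Poly u w) → Stops (λ v → ¬ X v) P → count q P ≤ 0 → X u → ∀ {v} → Corner P v → X v
    stays (up _ _) _ _ x (inj₁ refl) = x
    stays (up {v} {w} r refl) _ e x (inj₂ refl) with anc? q w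
    ... | yes y = y
    ... | no y = contradiction (≤-trans (edge-out x y) e) λ ()
    stays (down _ _) _ _ x (inj₁ refl) = x
    stays (down r refl) _ _ x (inj₂ refl) = X-parent r x
    stays (stop _) (n , _) _ x _ = contradiction x n
    stays (node _ L M) (a , b) e x (inj₁ p) = stays L a (≤-trans (m≤m+n _ _) e) x p
    stays (node _ L M) (a , b) e x (inj₂ p) =
      stays M b (≤-trans (m≤n+m _ (count q L)) e) (stays L a (≤-trans (m≤m+n _ _) e) x (corner-right L)) p

    module _ {c c′ : V → V} {a} (f : ∀ {v} → X v → c′ v ≡ a) (g : ∀ {v} → ¬ X v → c′ v ≡ c v) where
      private
        edge : ∀ {v x y} → v ≢ root → (x ≡ v × y ≡ parent v) ⊎ (x ≡ parent v × y ≡ v) →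
               δ (c′ x) (c′ y) ≤ δ (c x) (c y) + ε v q
        edge {v} {x} {y} r xy with v ≟ q
        ... | yes _ = ≤-trans (δ≤1 _ _) (m≤n+m 1 _)
        ... | no v≢q with anc? q v
        ...   | yes p = ≤-trans (≤-reflexive (both xy)) z≤n
          where
          both : (x ≡ v × y ≡ parent v) ⊎ (x ≡ parent v × y ≡ v) → δ (c′ x) (c′ y) ≡ 0
          both (inj₁ (refl , refl)) = trans (cong₂ δ (f p) (f (X-child v≢q p))) (δ-refl a)
          both (inj₂ (refl , refl)) = trans (cong₂ δ (f (X-child v≢q p)) (f p)) (δ-refl a)
        ...   | no p = ≤-reflexive (trans (both xy) (sym (+-identityʳ _)))
          where
          p′ : ¬ X (parent v)
          p′ s = p (X-parent r s)
          both : (x ≡ v × y ≡ parent v) ⊎ (x ≡ parent v × y ≡ v) → δ (c′ x) (c′ y) ≡ δ (c x) (c y)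
          both (inj₁ (refl , refl)) = cong₂ δ (g p) (g p′)
          both (inj₂ (refl , refl)) = cong₂ δ (g p′) (g p)

        add-up : ∀ {x y x′ y′ n k} → x ≤ x′ + n → y ≤ y′ + k → x + y ≤ (x′ + y′) + (n + k)
        add-up {x′ = x′} {y′} {n} {k} p q = ≤-trans (+-mono-≤ p q) (≤-reflexive
          (solve 4 (λ a b e f → (a :+ b) :+ (e :+ f) := (a :+ e) :+ (b :+ f)) refl x′ n y′ k))
          where open +-*-Solver

      -- The ends of a tree edge other than the one above `q` are both in the subtree, where the new
      -- labelling is constant, or both outside, where nothing happens. A traversal of the edge
      -- above `q` costs at most one change.
      changes : (P : Poly u w) → Stops (λ v → ¬ X v) P → ch c′ P ≤ ch c P + count q P
      changes (up r refl) _ = edge r (inj₁ (refl , refl))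
      changes (down r refl) _ = edge r (inj₂ (refl , refl))
      changes (stop _) (a , b) = ≤-trans (≤-reflexive (cong₂ δ (g a) (g b))) (m≤m+n _ _)
      changes (node _ L M) (a , b) = add-up {x′ = ch c L} (changes L a) (changes M b)

      -- The same estimate without any assumption on stop sides, as these contribute nothing to
      -- `treeCh`.
      tree-changes : (P : Poly u w) → treeCh c′ P ≤ treeCh c P + count q P
      tree-changes (up r refl) = edge r (inj₁ (refl , refl))
      tree-changes (down r refl) = edge r (inj₂ (refl , refl))
      tree-changes (stop _) = z≤n
      tree-changes (node _ L M) = add-up {x′ = treeCh c L} (tree-changes L) (tree-changes M)

-- The supply of two is used up by the two arcs that have to be traversed, and the rest gets
-- nothing.
≤0-of : ∀ {a b r} → a + b + r ≤ 2 → 1 ≤ a → 1 ≤ b → a ≤ 1 × b ≤ 1 × r ≤ 0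
≤0-of {suc zero} {suc zero} {zero} _ _ _ = s≤s z≤n , s≤s z≤n , z≤n
≤0-of {suc zero} {suc zero} {suc r} (s≤s (s≤s ())) _ _
≤0-of {suc zero} {suc (suc b)} (s≤s (s≤s ())) _ _
≤0-of {suc (suc a)} {suc b} {r} h _ _
  with ≤-trans (s≤s (s≤s (≤-trans (m≤n+m (suc b) a) (m≤m+n _ r)))) h
... | s≤s (s≤s ())

-- The effect of new paths on the arcs of a polygon.

module Cutting {N : ℕ} {Adj : Fin N → Fin N → Set} (T : BFSTree N Adj)
               (Adj-sym : ∀ {u w} → Adj u w → Adj w u) where
  open BFSTree T
  open Ancestry T
  open State

  private variable
    u w z l h m : V

  base-adj : Poly u w → Adj u w
  base-adj (up r refl)   = parent-adj _ r
  base-adj (down r refl) = Adj-sym (parent-adj _ r)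
  base-adj (stop a)      = a
  base-adj (node a _ _)  = a

  data Ctx (l h : V) : V → V → Set where
    hole : Ctx l h l h
    inl  : Adj u w → Ctx l h u z → Poly z w → Ctx l h u w
    inr  : Adj u w → Poly u z → Ctx l h z w → Ctx l h u w

  plug : Ctx l h u w → Poly l h → Poly u w
  plug hole        P = P
  plug (inl a C M) P = node a (plug C P) M
  plug (inr a L C) P = node a L (plug C P)

  countC : V → Ctx l h u w → ℕ
  countC q hole        = 0
  countC q (inl _ C M) = countC q C + count q M
  countC q (inr _ L C) = count q L + countC q C

  chC : (V → V) → Ctx l h u w → ℕ
  chC c hole        = 0
  chC c (inl _ C M) = chC c C + ch c M
  chC c (inr _ L C) = ch c L + chC c C

  sizeC : Ctx l h u w → ℕ
  sizeC hole        = 0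
  sizeC (inl _ C M) = suc (sizeC C + size M)
  sizeC (inr _ L C) = suc (size L + sizeC C)

  StopsC : (V → Set) → Ctx l h u w → Set
  StopsC R hole        = ⊤
  StopsC R (inl _ C M) = StopsC R C × Stops R M
  StopsC R (inr _ L C) = Stops R L × StopsC R C

  private
    swap-last : ∀ a b e → (a + b) + e ≡ (a + e) + b
    swap-last a b e = trans (+-assoc a b e) (trans (cong (a +_) (+-comm b e)) (sym (+-assoc a e b)))

    interchange : ∀ a b e f → (a + b) + (e + f) ≡ (a + e) + (b + f)
    interchange = solve 4 (λ a b e f → (a :+ b) :+ (e :+ f) := (a :+ e) :+ (b :+ f)) refl
      where open +-*-Solver

  plug-count : ∀ q (C : Ctx l h u w) P → count q (plug C P) ≡ countC q C + count q P
  plug-count q hole P = refl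
  plug-count q (inl _ C M) P = trans (cong (_+ count q M) (plug-count q C P)) (swap-last (countC q C) _ _)
  plug-count q (inr _ L C) P = trans (cong (count q L +_) (plug-count q C P)) (sym (+-assoc (count q L) _ _))

  plug-ch : ∀ c (C : Ctx l h u w) P → ch c (plug C P) ≡ chC c C + ch c P
  plug-ch c hole P = refl
  plug-ch c (inl _ C M) P = trans (cong (_+ ch c M) (plug-ch c C P)) (swap-last (chC c C) _ _)
  plug-ch c (inr _ L C) P = trans (cong (ch c L +_) (plug-ch c C P)) (sym (+-assoc (ch c L) _ _))

  plug-size : (C : Ctx l h u w) → ∀ P → size (plug C P) ≡ sizeC C + size P
  plug-size hole P = refl
  plug-size (inl _ C M) P = cong suc (trans (cong (_+ size M) (plug-size C P)) (swap-last (sizeC C) _ _))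
  plug-size (inr _ L C) P = cong suc (trans (cong (size L +_) (plug-size C P)) (sym (+-assoc (size L) _ _)))

  plug-stops : ∀ {R : V → Set} (C : Ctx l h u w) P → Stops R (plug C P) → StopsC R C × Stops R P
  plug-stops hole P s = tt , s
  plug-stops (inl _ C M) P (s , t) = let a , b = plug-stops C P s in (a , t) , b
  plug-stops (inr _ L C) P (s , t) = let a , b = plug-stops C P t in (s , a) , b

  stops-plug : ∀ {R : V → Set} (C : Ctx l h u w) {P} → StopsC R C → Stops R P → Stops R (plug C P)
  stops-plug hole s t = t
  stops-plug (inl _ C M) (s , s′) t = stops-plug C s t , s′
  stops-plug (inr _ L C) (s , s′) t = s , stops-plug C s′ t

  plug-corner : (C : Ctx l h u w) → ∀ {P Q} → (∀ {v} → Corner P v → Corner Q v) →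
                ∀ {v} → Corner (plug C P) v → Corner (plug C Q) v
  plug-corner hole f p = f p
  plug-corner (inl _ C M) f (inj₁ p) = inj₁ (plug-corner C f p)
  plug-corner (inl _ C M) f (inj₂ p) = inj₂ p
  plug-corner (inr _ L C) f (inj₁ p) = inj₁ p
  plug-corner (inr _ L C) f (inj₂ p) = inj₂ (plug-corner C f p)

  corner-plug : (C : Ctx l h u w) → ∀ {P v} → Corner P v → Corner (plug C P) v
  corner-plug hole p = p
  corner-plug (inl _ C M) p = inj₁ (corner-plug C p)
  corner-plug (inr _ L C) p = inj₂ (corner-plug C p)

  plug-tri : (C : Ctx l h u w) → ∀ {P Q x y t} → Tri (plug C P) x y t → Tri P x y t ⊎ Tri (plug C Q) x y t
  plug-tri hole p = inj₁ p
  plug-tri (inl _ C M) top = inj₂ top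
  plug-tri (inl _ C M) (right p) = inj₂ (right p)
  plug-tri (inl _ C M) (left p) with plug-tri C p
  ... | inj₁ q = inj₁ q
  ... | inj₂ q = inj₂ (left q)
  plug-tri (inr _ L C) top = inj₂ top
  plug-tri (inr _ L C) (left p) = inj₂ (left p)
  plug-tri (inr _ L C) (right p) with plug-tri C p
  ... | inj₁ q = inj₁ q
  ... | inj₂ q = inj₂ (right q)

  tri-corners : {P : Poly u w} → ∀ {x y t} → Tri P x y t → Corner P x × Corner P y × Corner P t
  tri-corners {P = node _ L M} top = inj₁ (corner-left L) , inj₁ (corner-right L) , inj₂ (corner-right M)
  tri-corners (left p) = let a , b , e = tri-corners p in inj₁ a , inj₁ b , inj₁ e
  tri-corners (right p) = let a , b , e = tri-corners p in inj₂ a , inj₂ b , inj₂ e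

  module BelowC (q : V) where
    open Below q

    enterC : (C : Ctx l h u w) → StopsC (λ v → ¬ X v) C → ¬ X u → X l → 1 ≤ countC q C
    enterC hole _ n x = contradiction x n
    enterC (inl _ C M) (a , b) n x = ≤-trans (enterC C a n x) (m≤m+n _ _)
    enterC (inr {z = z} _ L C) (a , b) n x with anc? q z
    ... | yes y = ≤-trans (enter L a n y) (m≤m+n _ _)
    ... | no y  = ≤-trans (enterC C b y x) (m≤n+m _ (count q L))

    leaveC : (C : Ctx l h u w) → StopsC (λ v → ¬ X v) C → X h → ¬ X w → 1 ≤ countC q C
    leaveC hole _ x n = contradiction x n
    leaveC (inr _ L C) (a , b) x n = ≤-trans (leaveC C b x n) (m≤n+m _ (count q L))
    leaveC (inl {z = z} _ C M) (a , b) x n with anc? q z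
    ... | yes y = ≤-trans (leave M b y n) (m≤n+m _ (countC q C))
    ... | no y  = ≤-trans (leaveC C a x y) (m≤m+n _ _)

    throughC : (C : Ctx l h u w) → StopsC (λ v → ¬ X v) C → ¬ X u → X l → X h → ¬ X w → 2 ≤ countC q C
    throughC hole _ n x _ _ = contradiction x n
    throughC (inl {z = z} _ C M) (a , b) n x y n′ with anc? q z
    ... | yes p = +-mono-≤ (enterC C a n x) (leave M b p n′)
    ... | no p  = ≤-trans (throughC C a n x y p) (m≤m+n _ _)
    throughC (inr {z = z} _ L C) (a , b) n x y n′ with anc? q z
    ... | yes p = +-mono-≤ (enter L a n p) (leaveC C b y n′)
    ... | no p  = ≤-trans (throughC C b p x y n′) (m≤n+m _ (count q L))

    changesC : ∀ {c c′ : V → V} {a} → (∀ {v} → X v → c′ v ≡ a) → (∀ {v} → ¬ X v → c′ v ≡ c v) →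
               (C : Ctx l h u w) → StopsC (λ v → ¬ X v) C → chC c′ C ≤ chC c C + countC q C
    changesC f g hole _ = z≤n
    changesC {c = c} f g (inl _ C M) (a , b) =
      ≤-trans (+-mono-≤ (changesC f g C a) (changes f g M b))
              (≤-reflexive (interchange (chC c C) (countC q C) _ _))
    changesC {c = c} f g (inr _ L C) (a , b) =
      ≤-trans (+-mono-≤ (changes f g L a) (changesC f g C b))
              (≤-reflexive (interchange (ch c L) (count q L) _ _))

  stopsC-map : ∀ {R S : V → Set} (C : Ctx l h u w) → (∀ {v} → R v → S v) → StopsC R C → StopsC S C
  stopsC-map hole f _ = tt
  stopsC-map (inl _ C M) f (a , b) = stopsC-map C f a , stops-map M f b
  stopsC-map (inr _ L C) f (a , b) = stops-map L f a , stopsC-map C f b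

  -- The subtree below the top of a new path avoids `U`. With labelled ends and stops, the boundary
  -- walk thus starts and finishes outside this subtree and can cross its border only on tree edges.
  record Anchored (st : State) (P : Poly u w) : Set where
    constructor anchored
    field
      leftU  : U st u
      rightU : U st w
      stopsU : Stops (U st) P

  open Anchored

  anchored-ext : ∀ {st st′} → Ext st st′ → {P : Poly u w} → Anchored st P → Anchored st′ P
  anchored-ext e {P} (anchored a b s) = anchored (Ext.U-mono e a) (Ext.U-mono e b) (stops-map P (Ext.U-mono e) s)

  Unchanged : State → State → Poly u w → Set
  Unchanged st st′ P = ∀ v → Corner P v → c st′ v ≡ c st v

  U∩X : ∀ st {q} → ¬ U st q → ∀ {v} → U st v → ¬ Anc q v
  U∩X st ¬u u p = ¬u (U-anc st p u)

  -- A common interface for polygons and contexts, since at a chord one of the two arcs is the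
  -- polygon inside and the other the context around it. `K` stands for traversals and `H` for label
  -- changes.
  record Arc (st : State) : Set₁ where
    field
      K : V → ℕ
      H : (V → V) → ℕ
      bound : ∀ {st′ z q} → Fresh st st′ z q → H (c st′) ≤ H (c st) + K q

  open Arc

  polyArc : ∀ st (P : Poly u w) → Stops (U st) P → Arc st
  polyArc st P s = record
    { K = λ q → count q P ; H = λ c → ch c P
    ; bound = λ {_} {_} {q} f → Below.changes q (Fresh.inX f) (Fresh.outX f) P (stops-map P (U∩X st (Fresh.q∉U f)) s) }

  ctxArc : ∀ st (C : Ctx l h u w) → StopsC (U st) C → Arc st
  ctxArc st C s = record
    { K = λ q → countC q C ; H = λ c → chC c C
    ; bound = λ {_} {_} {q} f → BelowC.changesC q (Fresh.inX f) (Fresh.outX f) C (stopsC-map C (U∩X st (Fresh.q∉U f)) s) }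

  -- To see a relabelled vertex the walk would have to enter the subtree and to leave it again,
  -- which takes two traversals.
  unchanged : ∀ {st st′ z q} → Fresh st st′ z q → (P : Poly u w) → Anchored st P → count q P ≤ 0 → Unchanged st st′ P
  unchanged {st = st} {q = q} f P (anchored a b s) e v p with anc? q v
  ... | no ¬x = Fresh.outX f ¬x
  ... | yes x = contradiction
        (≤-trans (Below.visit q P (stops-map P out s) (out a) (out b) p x) e) λ ()
    where
    out : ∀ {v} → U st v → ¬ Anc q v
    out = U∩X st (Fresh.q∉U f)

  -- A new path enters and leaves the subtree hanging at its top exactly once each, through the two
  -- arcs that meet at its bottom z; so no other arc notices it.
  record Between (st st′ : State) (A B : Arc st) (R : V → ℕ) : Set₁ where
    field
      riseˡ : ∀ (D : Arc st) → (∀ q → K D q ≤ K A q) → H D (c st′) ≤ suc (H D (c st))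
      riseʳ : ∀ (D : Arc st) → (∀ q → K D q ≤ K B q) → H D (c st′) ≤ suc (H D (c st))
      still : ∀ (D : Arc st) → (∀ q → K D q ≤ R q) → H D (c st′) ≤ H D (c st)
      calm  : ∀ {u w} (P : Poly u w) → Anchored st P → (∀ q → count q P ≤ R q) → Unchanged st st′ P

  between : ∀ {st z st′} → Add st z st′ → (A B : Arc st) (R : V → ℕ) →
            (∀ q → K A q + K B q + R q ≤ 2) →
            (∀ q → ¬ U st q → Anc q z → 1 ≤ K A q × 1 ≤ K B q) → Between st st′ A B R
  between (old _) A B R _ _ = record
    { riseˡ = λ _ _ → n≤1+n _ ; riseʳ = λ _ _ → n≤1+n _ ; still = λ _ _ → ≤-refl ; calm = λ _ _ _ _ _ → refl }
  between (fresh q f) A B R tot pos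
    with pos q (Fresh.q∉U f) (Fresh.q⊑z f)
  ... | pa , pb with ≤0-of {K A q} {K B q} {R q} (tot q) pa pb
  ...   | a , b , r = record
    { riseˡ = λ D e → ≤-trans (bound D f) (≤-trans (+-monoʳ-≤ _ (≤-trans (e q) a)) (≤-reflexive (+-comm _ 1)))
    ; riseʳ = λ D e → ≤-trans (bound D f) (≤-trans (+-monoʳ-≤ _ (≤-trans (e q) b)) (≤-reflexive (+-comm _ 1)))
    ; still = λ D e → ≤-trans (bound D f) (≤-trans (+-monoʳ-≤ _ (≤-trans (e q) r)) (≤-reflexive (+-identityʳ _)))
    ; calm = λ P a e → unchanged f P a (≤-trans (e q) r) }

  -- `news` collects the labels that the cut vertices receive. By `news-ok` each of them is the
  -- former label of a cut vertex or a name unknown before, as the side condition of `grow`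
  -- requires.
  record Adds (st st′ : State) (zs : List V) : Set where
    field
      ext      : Ext st st′
      news     : List V
      news-len : length news ≡ length zs
      relabel  : ∀ v → c st′ v ≡ c st v ⊎ c st′ v ∈ news
      news-ok  : ∀ {x} → x ∈ news → (∃ λ v → v ∈ zs × x ≡ c st v) ⊎ x ∉ Z st
      inU      : ∀ {v} → v ∈ zs → U st′ v
      Z-len    : length (Z st′) ≤ length zs + length (Z st)
      Z-new    : ∀ {x} → x ∈ Z st′ → x ∈ Z st ⊎ x ∈ news
      news⊆Z   : ∀ {x} → x ∈ news → x ∈ Z st′

  open Adds

  adds-none : ∀ {st} → Adds st st []
  adds-none = record { ext = ext-refl ; news = [] ; news-len = refl ; relabel = λ _ → inj₁ refl
                     ; news-ok = λ () ; inU = λ () ; Z-len = ≤-refl ; Z-new = inj₁ ; news⊆Z = λ () }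

  adds-snoc : ∀ {st st₁ st₂ zs z} → Adds st st₁ zs → Add st₁ z st₂ → Adds st st₂ (z ∷ zs)
  adds-snoc {st} {st₁} {st₂} {zs} {z} A a = record
    { ext = ext-trans (ext A) (add-ext a)
    ; news = c st₂ z ∷ news A
    ; news-len = cong suc (news-len A)
    ; relabel = rel
    ; news-ok = ok
    ; inU = λ { (here refl) → add-U a ; (there p) → Ext.U-mono (add-ext a) (inU A p) }
    ; Z-len = ≤-trans (add-length a) (s≤s (Z-len A))
    ; Z-new = zn a
    ; news⊆Z = λ { (here refl) → c∈Z st₂ z ; (there p) → Ext.Z-mono (add-ext a) (news⊆Z A p) } }
    where
    rel : ∀ v → c st₂ v ≡ c st v ⊎ c st₂ v ∈ c st₂ z ∷ news A
    rel v with add-c a v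
    ... | inj₂ e = inj₂ (here e)
    ... | inj₁ e with relabel A v
    ...   | inj₁ e′ = inj₁ (trans e e′)
    ...   | inj₂ p  = inj₂ (there (subst (_∈ news A) (sym e) p))
    ok : ∀ {x} → x ∈ c st₂ z ∷ news A → (∃ λ v → v ∈ z ∷ zs × x ≡ c st v) ⊎ x ∉ Z st
    ok (there p) with news-ok A p
    ... | inj₁ (v , q , e) = inj₁ (v , there q , e)
    ... | inj₂ n = inj₂ n
    ok (here refl) with add-fresh a
    ... | inj₂ n = inj₂ (λ p → n (Ext.Z-mono (ext A) p))
    ... | inj₁ e with relabel A z
    ...   | inj₁ e′ = inj₁ (z , here refl , trans e e′)
    ...   | inj₂ p with news-ok A p
    ...     | inj₁ (v , q , e″) = inj₁ (v , there q , trans e e″)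
    ...     | inj₂ n = inj₂ (subst (_∉ Z st) (sym e) n)
    zn : ∀ {st₂} (a : Add st₁ z st₂) → ∀ {x} → x ∈ Z st₂ → x ∈ Z st ⊎ x ∈ c st₂ z ∷ news A
    zn (old _) p with Z-new A p
    ... | inj₁ q = inj₁ q
    ... | inj₂ q = inj₂ (there q)
    zn (fresh q f) p with subst (_ ∈_) (Fresh.Z≡ f) p
    ... | here e = inj₂ (here (trans e (sym (Fresh.inX f (Fresh.q⊑z f)))))
    ... | there r with Z-new A r
    ...   | inj₁ q = inj₁ q
    ...   | inj₂ q = inj₂ (there q)

  record Peel (st : State) (L : Poly u z) (M : Poly z w) (R : V → ℕ) : Set₁ where
    field
      {st′} : State
      adds  : Adds st st′ (z ∷ [])
      chL   : ch (c st′) L ≤ suc (ch (c st) L)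
      chM   : ch (c st′) M ≤ suc (ch (c st) M)
      calm  : ∀ {u w} (P : Poly u w) → Anchored st P → (∀ q → count q P ≤ R q) → Unchanged st st′ P

  peel : ∀ st {a : Adj u w} (L : Poly u z) (M : Poly z w) (R : V → ℕ) → Anchored st (node a L M) →
         (∀ q → count q L + count q M + R q ≤ 2) → Peel st L M R
  peel {z = z} st L M R (anchored x y (sL , sM)) tot with add st z
  ... | st′ , a = record
    { adds = adds-snoc adds-none a
    ; chL = Between.riseˡ b (polyArc st L sL) (λ _ → ≤-refl)
    ; chM = Between.riseʳ b (polyArc st M sM) (λ _ → ≤-refl) ; calm = Between.calm b }
    where
    b : Between st st′ (polyArc st L sL) (polyArc st M sM) R
    b = between a (polyArc st L sL) (polyArc st M sM) R tot λ q ¬u p →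
          Below.enter q L (stops-map L (U∩X st ¬u) sL) (U∩X st ¬u x) p ,
          Below.leave q M (stops-map M (U∩X st ¬u) sM) p (U∩X st ¬u y)

  -- If a subtree free of labels covers both ends of P without being crossed inside, then P is monochromatic.
  monochrome : ∀ st {q} → ¬ U st q → (P : Poly u w) → Stops (U st) P → count q P ≤ 0 → Anc q u → ch (c st) P ≡ 0
  monochrome st {q} ¬u P s e x = ch-const P λ v p →
    c-const st ¬u (Below.stays q P (stops-map P (U∩X st ¬u) s) e x p)

  -- `inside` speaks of every polygon traversing no edge more often than `I` does, because the two
  -- sides of the triangle on the chord are later bounded separately as well as together.
  record Chord (st : State) (C : Ctx l h u w) (I : Poly l h) (R : V → ℕ) : Set₁ where
    field
      {st′}  : State
      adds   : Adds st st′ (h ∷ l ∷ [])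
      inside : ∀ {x y} (P : Poly x y) → Stops (U st) P → (∀ q → count q P ≤ count q I) → ch (c st′) P ≤ 2 + ch (c st) P
      around : chC (c st′) C ≤ 2 + chC (c st) C
      calm   : ∀ {u w} (P : Poly u w) → Anchored st P → (∀ q → count q P ≤ R q) → Unchanged st st′ P

  private
    cut-off : ∀ {a b r} → a + b + r ≤ 2 → 2 ≤ a → b ≤ 0
    cut-off {a} {zero}  _ _ = z≤n
    cut-off {a} {suc b} {r} p q = contradiction
      (≤-trans (+-mono-≤ q (s≤s (z≤n {b}))) (≤-trans (m≤m+n (a + suc b) r) p)) λ { (s≤s (s≤s ())) }

  unchanged-trans : ∀ s₁ s₂ s₃ (P : Poly u w) → Unchanged s₁ s₂ P → Unchanged s₂ s₃ P → Unchanged s₁ s₃ P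
  unchanged-trans _ _ _ _ f g v p = trans (g v p) (f v p)

  -- The danger is a subtree that contains both ends of the chord. The context then enters and
  -- leaves it, so nothing is left for the inner arc, which lies wholly in the subtree and is
  -- monochromatic. The assumed change on `I` excludes this. It matters for `l` only: when `h` is
  -- added, `l` is labelled and the inner arc starts outside the subtree.
  chord : ∀ st (C : Ctx l h u w) (I : Poly l h) (R : V → ℕ) → U st u → U st w →
          StopsC (U st) C → Stops (U st) I → (∀ q → countC q C + count q I + R q ≤ 2) →
          1 ≤ ch (c st) I → Chord st C I R
  chord {l = l} {h = h} st C I R x y sC sI tot pos
    with add st l
  ... | st₁ , a₁ with add st₁ h
  ...   | st₂ , a₂ = record
    { adds = adds-snoc (adds-snoc adds-none a₁) a₂
    ; inside = λ P s k → ≤-trans (Between.riseˡ b₂ (polyArc st₁ P (stops-map P mono s)) k)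
                                 (s≤s (Between.riseʳ b₁ (polyArc st P s) k))
    ; around = ≤-trans (Between.riseʳ b₂ (ctxArc st₁ C sC₁) (λ _ → ≤-refl))
                       (s≤s (Between.riseˡ b₁ (ctxArc st C sC) (λ _ → ≤-refl)))
    ; calm = λ P a k → unchanged-trans st st₁ st₂ P (Between.calm b₁ P a k)
                         (Between.calm b₂ P (anchored-ext (add-ext a₁) a) k) }
    where
    mono : ∀ {v} → U st v → U st₁ v
    mono = Ext.U-mono (add-ext a₁)
    sC₁ = stopsC-map C mono sC
    sI₁ = stops-map I mono sI
    b₁ : Between st st₁ (ctxArc st C sC) (polyArc st I sI) R
    b₁ = between a₁ _ _ R tot λ q ¬u p →
      BelowC.enterC q C (stopsC-map C (U∩X st ¬u) sC) (U∩X st ¬u x) p , leaves q ¬u p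
      where
      leaves : ∀ q → ¬ U st q → Anc q l → 1 ≤ count q I
      leaves q ¬u p with anc? q h
      ... | no ¬p = Below.leave q I (stops-map I (U∩X st ¬u) sI) p ¬p
      ... | yes p′ = contradiction pos (<⇒≱ (s≤s (≤-reflexive (monochrome st ¬u I sI
              (cut-off (tot q) (BelowC.throughC q C (stopsC-map C (U∩X st ¬u) sC) (U∩X st ¬u x) p p′ (U∩X st ¬u y))) p))))
    b₂ : Between st₁ st₂ (polyArc st₁ I sI₁) (ctxArc st₁ C sC₁) R
    b₂ = between a₂ _ _ R (λ q → subst (λ s → s + R q ≤ 2) (+-comm (countC q C) _) (tot q)) λ q ¬u p →
      Below.enter q I (stops-map I (U∩X st₁ ¬u) sI₁) (U∩X st₁ ¬u (add-U a₁)) p ,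
      BelowC.leaveC q C (stopsC-map C (U∩X st₁ ¬u) sC₁) p (U∩X st₁ ¬u (mono y))

  record Tricut (st : State) (C : Ctx l h u w) (L : Poly l m) (M : Poly m h) (R : V → ℕ) : Set₁ where
    field
      {st′}  : State
      adds   : Adds st st′ (h ∷ m ∷ l ∷ [])
      chL    : ch (c st′) L ≤ 2 + ch (c st) L
      chM    : ch (c st′) M ≤ 2 + ch (c st) M
      around : chC (c st′) C ≤ 2 + chC (c st) C
      calm   : ∀ {u w} (P : Poly u w) → Anchored st P → (∀ q → count q P ≤ R q) → Unchanged st st′ P

  tricut : ∀ st (C : Ctx l h u w) (L : Poly l m) (M : Poly m h) (R : V → ℕ) → U st u → U st w →
           StopsC (U st) C → Stops (U st) L → Stops (U st) M →
           (∀ q → countC q C + count q L + (count q M + R q) ≤ 2) →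
           1 ≤ ch (c st) L → 1 ≤ ch (c st) M → Tricut st C L M R
  tricut {l = l} {h = h} {m = m} st C L M R x y sC sL sM tot posL posM
    with add st l
  ... | st₁ , a₁ with add st₁ m
  ...   | st₂ , a₂ with add st₂ h
  ...     | st₃ , a₃ = record
    { adds = adds-snoc (adds-snoc (adds-snoc adds-none a₁) a₂) a₃
    ; chL = ≤-trans (Between.still b₃ (polyArc st₂ L sL₂) (λ q → m≤m+n _ _))
             (≤-trans (Between.riseˡ b₂ (polyArc st₁ L sL₁) (λ _ → ≤-refl))
               (s≤s (Between.riseʳ b₁ (polyArc st L sL) (λ _ → ≤-refl))))
    ; chM = ≤-trans (Between.riseˡ b₃ (polyArc st₂ M sM₂) (λ q → ≤-refl))
             (s≤s (≤-trans (Between.riseʳ b₂ (polyArc st₁ M sM₁) (λ _ → ≤-refl))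
               (s≤s (Between.still b₁ (polyArc st M sM) (λ _ → m≤m+n _ _)))))
    ; around = ≤-trans (Between.riseʳ b₃ (ctxArc st₂ C sC₂) (λ q → ≤-refl))
             (s≤s (≤-trans (Between.still b₂ (ctxArc st₁ C sC₁) (λ _ → m≤m+n _ _))
               (Between.riseˡ b₁ (ctxArc st C sC) (λ _ → ≤-refl))))
    ; calm = λ P a k → unchanged-trans st st₂ st₃ P
         (unchanged-trans st st₁ st₂ P (Between.calm b₁ P a (λ q → ≤-trans (k q) (m≤n+m _ (count q M))))
           (Between.calm b₂ P (anchored-ext (add-ext a₁) a) (λ q → ≤-trans (k q) (m≤n+m _ (countC q C)))))
         (Between.calm b₃ P (anchored-ext (ext-trans (add-ext a₁) (add-ext a₂)) a) (λ q → ≤-trans (k q) (m≤n+m _ (count q L)))) }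
    where
    open +-*-Solver
    mono₁ : ∀ {v} → U st v → U st₁ v
    mono₁ = Ext.U-mono (add-ext a₁)
    mono₂ : ∀ {v} → U st₁ v → U st₂ v
    mono₂ = Ext.U-mono (add-ext a₂)
    sC₁ = stopsC-map C mono₁ sC
    sL₁ = stops-map L mono₁ sL
    sM₁ = stops-map M mono₁ sM
    sC₂ = stopsC-map C mono₂ sC₁
    sL₂ = stops-map L mono₂ sL₁
    sM₂ = stops-map M mono₂ sM₁
    impossible : ∀ {q u w} → ¬ U st q → (P : Poly u w) → Stops (U st) P → count q P ≤ 0 → Anc q u →
                 1 ≤ ch (c st) P → ⊥
    impossible ¬u P s e p pos = contradiction pos (<⇒≱ (s≤s (≤-reflexive (monochrome st ¬u P s e p))))
    b₁ : Between st st₁ (ctxArc st C sC) (polyArc st L sL) (λ q → count q M + R q)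
    b₁ = between a₁ _ _ _ tot λ q ¬u p →
      BelowC.enterC q C (stopsC-map C (U∩X st ¬u) sC) (U∩X st ¬u x) p , leaves q ¬u p
      where
      leaves : ∀ q → ¬ U st q → Anc q l → 1 ≤ count q L
      leaves q ¬u p with anc? q m
      ... | no ¬p = Below.leave q L (stops-map L (U∩X st ¬u) sL) p ¬p
      ... | yes p′ with anc? q h
      ...   | yes p″ = ⊥-elim (impossible ¬u L sL
                 (cut-off (tot q) (BelowC.throughC q C (stopsC-map C (U∩X st ¬u) sC) (U∩X st ¬u x) p p″ (U∩X st ¬u y))) p posL)
      ...   | no ¬p″ = ⊥-elim (impossible ¬u L sL
                 (cut-off {countC q C + count q M} {count q L} {R q}
                    (≤-trans (≤-reflexive (solve 4 (λ a b e r → a :+ e :+ b :+ r := a :+ b :+ (e :+ r)) refl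
                                             (countC q C) (count q L) (count q M) (R q))) (tot q))
                    (+-mono-≤ (BelowC.enterC q C (stopsC-map C (U∩X st ¬u) sC) (U∩X st ¬u x) p)
                              (Below.leave q M (stops-map M (U∩X st ¬u) sM) p′ ¬p″))) p posL)
    b₂ : Between st₁ st₂ (polyArc st₁ L sL₁) (polyArc st₁ M sM₁) (λ q → countC q C + R q)
    b₂ = between a₂ _ _ _ (λ q → ≤-trans (≤-reflexive (perm q)) (tot q)) λ q ¬u p →
      Below.enter q L (stops-map L (U∩X st₁ ¬u) sL₁) (U∩X st₁ ¬u (add-U a₁)) p , leaves q ¬u p
      where
      perm : ∀ q → count q L + count q M + (countC q C + R q) ≡ countC q C + count q L + (count q M + R q)
      perm q = solve 4 (λ a b e r → b :+ e :+ (a :+ r) := a :+ b :+ (e :+ r)) refl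
                 (countC q C) (count q L) (count q M) (R q)
      leaves : ∀ q → ¬ U st₁ q → Anc q m → 1 ≤ count q M
      leaves q ¬u p with anc? q h
      ... | no ¬p = Below.leave q M (stops-map M (U∩X st₁ ¬u) sM₁) p ¬p
      ... | yes p′ = ⊥-elim (impossible (λ u → ¬u (mono₁ u)) M sM
              (cut-off {count q L + countC q C} {count q M} {R q}
                    (≤-trans (≤-reflexive (solve 4 (λ a b e r → b :+ a :+ e :+ r := a :+ b :+ (e :+ r)) refl
                                             (countC q C) (count q L) (count q M) (R q))) (tot q))
                    (+-mono-≤ (Below.enter q L (stops-map L (U∩X st₁ ¬u) sL₁) (U∩X st₁ ¬u (add-U a₁)) p)
                              (BelowC.leaveC q C (stopsC-map C (U∩X st₁ ¬u) sC₁) p′ (U∩X st₁ ¬u (mono₁ y))))) p posM)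
    b₃ : Between st₂ st₃ (polyArc st₂ M sM₂) (ctxArc st₂ C sC₂) (λ q → count q L + R q)
    b₃ = between a₃ _ _ _ (λ q → ≤-trans (≤-reflexive (perm q)) (tot q)) λ q ¬u p →
      Below.enter q M (stops-map M (U∩X st₂ ¬u) sM₂) (U∩X st₂ ¬u (add-U a₂)) p ,
      BelowC.leaveC q C (stopsC-map C (U∩X st₂ ¬u) sC₂) p (U∩X st₂ ¬u (mono₂ (mono₁ y)))
      where
      perm : ∀ q → count q M + countC q C + (count q L + R q) ≡ countC q C + count q L + (count q M + R q)
      perm q = solve 4 (λ a b e r → e :+ a :+ (b :+ r) := a :+ b :+ (e :+ r)) refl
                 (countC q C) (count q L) (count q M) (R q)

  -- A centroid triangle: neither of its two lower arcs is long, but together they are.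
  record Centroid (κ : V → V) (P : Poly u w) : Set where
    constructor centroid
    field
      {x y t} : V
      C   : Ctx x t u w
      a   : Adj x t
      L   : Poly x y
      M   : Poly y t
      eq  : P ≡ plug C (node a L M)
      L≤3 : ch κ L ≤ 3
      M≤3 : ch κ M ≤ 3
      LM≥4 : 4 ≤ ch κ L + ch κ M

  ch-leaf : ∀ κ (P : Poly u w) → size P ≡ 0 → ch κ P ≤ 1
  ch-leaf κ (up _ _) _ = δ≤1 _ _
  ch-leaf κ (down _ _) _ = δ≤1 _ _
  ch-leaf κ (stop _) _ = δ≤1 _ _

  find-centroid : ∀ κ (P : Poly u w) → 4 ≤ ch κ P → Centroid κ P
  find-centroid κ (up r e) p = contradiction (≤-trans p (ch-leaf κ (up r e) refl)) λ { (s≤s ()) }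
  find-centroid κ (down r e) p = contradiction (≤-trans p (ch-leaf κ (down r e) refl)) λ { (s≤s ()) }
  find-centroid κ (stop a) p = contradiction (≤-trans p (ch-leaf κ (stop a) refl)) λ { (s≤s ()) }
  find-centroid κ (node a L M) p with 4 ≤? ch κ L
  ... | yes q with find-centroid κ L q
  ...   | centroid C b L′ M′ e x y t = centroid (inl a C M) b L′ M′ (cong (λ P → node a P M) e) x y t
  find-centroid κ (node a L M) p | no ¬q with 4 ≤? ch κ M
  ... | yes q with find-centroid κ M q
  ...   | centroid C b L′ M′ e x y t = centroid (inr a L C) b L′ M′ (cong (node a L) e) x y t
  find-centroid κ (node a L M) p | no ¬q | no ¬r =
    centroid hole a L M refl (≤-pred (≰⇒> ¬q)) (≤-pred (≰⇒> ¬r)) p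

-- Continuing the decomposition inside the cells.

module Peeling {N : ℕ} {Adj : Fin N → Fin N → Set} (T : BFSTree N Adj)
               (Adj-sym : ∀ {u w} → Adj u w → Adj w u) where
  open BFSTree T
  open Ancestry T
  open Cutting T Adj-sym
  open Decomposition V
  open State
  open Adds

  Region : Set
  Region = ∃₂ λ u w → Poly u w

  private variable
    u w z l h x y t : V
    m : ℕ

  total : V → List Region → ℕ
  total q []                  = 0
  total q ((_ , _ , P) ∷ rs) = count q P + total q rs

  total-++ : ∀ q rs ss → total q (rs ++ ss) ≡ total q rs + total q ss
  total-++ q [] ss = refl
  total-++ q ((_ , _ , P) ∷ rs) ss =
    trans (cong (count q P +_) (total-++ q rs ss)) (sym (+-assoc (count q P) _ _))

  total-∈ : ∀ q {rs} {P : Poly u w} → (u , w , P) ∈ rs → count q P ≤ total q rs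
  total-∈ q (here refl) = m≤m+n _ _
  total-∈ q {(_ , _ , P) ∷ _} (there p) = ≤-trans (total-∈ q p) (m≤n+m _ (count q P))

  Item : ℕ → Set
  Item m = Region × Fin m

  lift : Item m → Item (suc m)
  lift (r , j) = r , suc j

  regions : List (Item m) → List Region
  regions = map proj₁

  regions-++ : ∀ (Ps : List Region) (items : List (Item m)) →
               regions (map (_, zero) Ps ++ map lift items) ≡ Ps ++ regions items
  regions-++ [] [] = refl
  regions-++ [] (i ∷ items) = cong (proj₁ i ∷_) (regions-++ [] items)
  regions-++ (P ∷ Ps) items = cong (P ∷_) (regions-++ Ps items)

  -- Cutting at an apex removes a triangle, whereas cutting along a chord removes none and merely
  -- turns one region into two. Twice the size less one decreases in both cases.
  weight : List Region → ℕ
  weight []                  = 0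
  weight ((_ , _ , P) ∷ rs) = 2 * size P ∸ 1 + weight rs

  weight-++ : ∀ rs ss → weight (rs ++ ss) ≡ weight rs + weight ss
  weight-++ [] ss = refl
  weight-++ ((_ , _ , P) ∷ rs) ss =
    trans (cong (2 * size P ∸ 1 +_) (weight-++ rs ss)) (sym (+-assoc (2 * size P ∸ 1) _ _))

  -- Six labels and the two new ones of a chord fit into a bag of eight. A `peelable` region may
  -- have seven labels, as it is cut at a single vertex, and its sides, having at most four changes,
  -- come out with at most five.
  data Fine (κ : V → V) : Poly u w → Set where
    short    : {P : Poly u w} → ch κ P ≤ 5 → Fine κ P
    peelable : ∀ {a} {L : Poly u z} {M : Poly z w} → ch κ L ≤ 4 → ch κ M ≤ 4 → ch κ L + ch κ M ≤ 6 →
               Fine κ (node a L M)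

  fine-cong : ∀ {κ κ′} {P : Poly u w} → (∀ v → Corner P v → κ′ v ≡ κ v) → Fine κ P → Fine κ′ P
  fine-cong {P = P} f (short p) = short (subst (_≤ 5) (sym (ch-cong P f)) p)
  fine-cong f (peelable {L = L} {M = M} a b e)
    rewrite sym (ch-cong L (λ v p → f v (inj₁ p))) | sym (ch-cong M (λ v p → f v (inj₂ p))) = peelable a b e

  record Good (st : State) (d : TDec m) (P : Poly u w) (j : Fin m) : Set where
    field
      anch   : Anchored st P
      fine   : Fine (c st) P
      onbag  : ∀ v → Corner P v → c st v ∈ bag d j
      nonrt  : j ≢ rt d

  open Good

  record Proc (st : State) (d : TDec m) (items : List (Item m)) : Set where
    field
      bags⊆Z : ∀ {x} t → x ∈ bag d t → x ∈ Z st
      small  : ∀ t → t ≢ rt d → length (bag d t) ≤ 8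
      planar : ∀ q → total q (regions items) ≤ 2
      good   : ∀ {u w} {P : Poly u w} {j} → ((u , w , P) , j) ∈ items → Good st d P j

  open Proc

  Lab : State → TDec m → Fin m → V → Set
  Lab st d s x = U st x × c st x ∈ bag d s

  Done : State → TDec m → Fin m → V → V → V → Set
  Done st d j x y t = ∃ λ s → Desc d j s × Lab st d s x × Lab st d s y × Lab st d s t

  Pending : TDec m → List (Item m) → Fin m → V → V → V → Set
  Pending d items j x y t = ∃₂ λ u w → Σ (Poly u w) λ P → ∃ λ i →
    ((u , w , P) , i) ∈ items × Desc d j i × Tri P x y t

  -- The invariant that leads a triangle into a bag: until its three corners share a bag below `j`,
  -- it lies in an open region attached below `j`.
  Cov : State → (d : TDec m) → List (Item m) → Fin m → V → V → V → Set
  Cov st d items j x y t = Done st d j x y t ⊎ Pending d items j x y t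

  record Evolves {m m′} (st : State) (d : TDec m) (items : List (Item m))
                 (st′ : State) (d′ : TDec m′) (items′ : List (Item m′)) : Set where
    field
      ext  : Ext st st′
      into : d ↪ d′
      cov  : ∀ {j x y t} → Cov st d items j x y t → Cov st′ d′ items′ (emb into j) x y t

  record Next {m} (st : State) (d : TDec m) (items : List (Item m)) : Set₁ where
    field
      {m′}    : ℕ
      {st′}   : State
      {d′}    : TDec m′
      items′  : List (Item m′)
      proc    : Proc st′ d′ items′
      evolves : Evolves st d items st′ d′ items′

  record Advance (st : State) (R : Poly u w) (rest : V → ℕ) : Set₁ where
    field
      {st′}  : State
      {zs}   : List V
      adds   : Adds st st′ zs
      inside : ∀ {v} → v ∈ zs → Corner R v
      calm   : ∀ {u w} (P : Poly u w) → Anchored st P → (∀ q → count q P ≤ rest q) → Unchanged st st′ P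
      Ps     : List Region
      piece  : ∀ {u w} {P : Poly u w} → (u , w , P) ∈ Ps →
               Anchored st′ P × Fine (c st′) P × (∀ v → Corner P v → Corner R v)
      counts : ∀ q → total q Ps ≤ count q R
      tri    : ∀ {x y t} → Tri R x y t → (U st′ x × U st′ y × U st′ t) ⊎
               (∃₂ λ u w → Σ (Poly u w) λ P → (u , w , P) ∈ Ps × Tri P x y t)
      len    : suc (ch (c st) R) + length zs ≤ 8
      shrink : weight Ps < 2 * size R ∸ 1

  -- The new bag holds the labels of `R` before the cut and those created by it: the former tie it
  -- to the bag of `j`, and both together serve the pieces of `R`. The other open regions keep their
  -- bags because `calm` fixes their labels.
  advance : ∀ {st} {d : TDec m} {R : Poly u w} {j items} →
            Proc st d (((u , w , R) , j) ∷ items) → Advance st R (λ q → total q (regions items)) →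
            Σ (Next st d (((u , w , R) , j) ∷ items)) λ n →
              weight (regions (Next.items′ n)) < weight ((u , w , R) ∷ regions items)
  advance {m = m} {u} {w} {st} {d} {R} {j} {items} I A = record
    { items′ = items′
    ; proc = record
        { bags⊆Z = bz
        ; small = λ { zero _ → ≤-trans (≤-reflexive (trans (length-++ (labels κ R))
                                  (cong₂ _+_ (labels-length κ R) (news-len adds)))) len
                    ; (suc t) n → small I t (n ∘ cong suc) }
        ; planar = λ q → ≤-trans (≤-reflexive (trans (cong (total q) (regions-++ Ps items)) (total-++ q Ps _)))
                           (≤-trans (+-monoˡ-≤ _ (counts q)) (planar I q))
        ; good = gd }
    ; evolves = record { ext = ext adds ; into = e ; cov = [ cv₁ , cv₂ ]′ } } ,
    ≤-trans (s≤s (≤-reflexive (trans (cong weight (regions-++ Ps items)) (weight-++ Ps _))))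
            (+-monoˡ-≤ (weight (regions items)) shrink)
    where
    open Advance A
    κ = c st
    g : Good st d R j
    g = good I (here refl)
    b : List V
    b = labels κ R ++ news adds
    -- Former labels of corners of `R` lie in the bag of `j`. A name outside `Z st` lies in no bag
    -- at all, by `bags⊆Z`.
    valid : ∀ x → x ∈ b → x ∈ bag d j ⊎ (∀ t → x ∉ bag d t)
    valid x p with ∈-++⁻ (labels κ R) p
    ... | inj₁ q = let v , cv , e = labels-corner κ R q in inj₁ (subst (_∈ bag d j) (sym e) (onbag g v cv))
    ... | inj₂ q with news-ok adds q
    ...   | inj₁ (v , v∈ , e) = inj₁ (subst (_∈ bag d j) (sym e) (onbag g v (inside v∈)))
    ...   | inj₂ n = inj₂ λ t r → n (bags⊆Z I t r)
    d′ : TDec (suc m)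
    d′ = grow d j b valid
    e : d ↪ d′
    e = ↪-grow (nonrt g)
    items′ : List (Item (suc m))
    items′ = map (_, zero) Ps ++ map lift items
    onb : ∀ v → Corner R v → c st′ v ∈ b
    onb v p with relabel adds v
    ... | inj₁ e = subst (_∈ b) (sym e) (∈-++⁺ˡ (labels-all κ R p))
    ... | inj₂ q = ∈-++⁺ʳ (labels κ R) q
    bz : ∀ {x} t → x ∈ bag d′ t → x ∈ Z st′
    bz (suc t) p = Ext.Z-mono (ext adds) (bags⊆Z I t p)
    bz zero p with ∈-++⁻ (labels κ R) p
    ... | inj₁ q = let v , cv , e = labels-corner κ R q in
                   Ext.Z-mono (ext adds) (subst (_∈ Z st) (sym e) (c∈Z st v))
    ... | inj₂ q = news⊆Z adds q
    gd : ∀ {u w} {P : Poly u w} {i} → ((u , w , P) , i) ∈ items′ → Good st′ d′ P i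
    gd p with ∈-++⁻ (map (_, zero) Ps) p
    ... | inj₁ q with ∈-map⁻ (_, zero) q
    ...   | _ , r , refl = let a , f , cs = piece r in record
              { anch = a ; fine = f ; onbag = λ v cv → onb v (cs v cv) ; nonrt = λ () }
    gd p | inj₂ q with ∈-map⁻ lift q
    ... | (( u , w , P) , i) , r , refl = record
            { anch = anchored-ext (ext adds) (anch g′) ; fine = fine-cong same (fine g′)
            ; onbag = λ v cv → subst (_∈ bag d i) (sym (same v cv)) (onbag g′ v cv)
            ; nonrt = λ eq → nonrt g′ (Finₚ.suc-injective eq) }
      where
      g′ : Good st d P i
      g′ = good I (there r)
      same : Unchanged st st′ P
      same = calm P (anch g′) (λ q → total-∈ q (∈-map⁺ proj₁ r))
    below : ∀ {i} → Desc d i j → Desc d′ (suc i) zero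
    below p = desc-trans {d = d′} (desc-lift {d = d} p) (1 , refl)
    cv₁ : ∀ {i x y t} → Done st d i x y t → Cov st′ d′ items′ (suc i) x y t
    cv₁ (s , D , p , q , r) = inj₁ (suc s , desc-lift {d = d} D , lab p , lab q , lab r)
      where
      lab : ∀ {x} → Lab st d s x → Lab st′ d′ (suc s) x
      lab (u , p) = Ext.U-mono (ext adds) u , subst (_∈ bag d s) (sym (Ext.c-stay (ext adds) u)) p
    cv₂ : ∀ {i x y t} → Pending d (((u , w , R) , j) ∷ items) i x y t → Cov st′ d′ items′ (suc i) x y t
    cv₂ (_ , _ , P , i , there p , D , τ) =
      inj₂ (_ , _ , P , suc i , ∈-++⁺ʳ (map (_, zero) Ps) (∈-map⁺ lift p) , desc-lift {d = d} D , τ)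
    cv₂ (_ , _ , P , i , here refl , D , τ) with tri τ | tri-corners τ
    ... | inj₁ (a , b , e) | a′ , b′ , e′ =
            inj₁ (zero , below D , (a , onb _ a′) , (b , onb _ b′) , (e , onb _ e′))
    ... | inj₂ (_ , _ , Q , q , τ′) | _ =
            inj₂ (_ , _ , Q , zero , ∈-++⁺ˡ (∈-map⁺ (_, zero) q) , below D , τ′)

  private
    w-peel : ∀ a b → 2 * a ∸ 1 + (2 * b ∸ 1 + 0) < 2 * suc (a + b) ∸ 1
    w-peel a b = ≤-trans (s≤s (+-mono-≤ (m∸n≤m (2 * a) 1) (+-monoˡ-≤ 0 (m∸n≤m (2 * b) 1))))
      (≤-reflexive (solve 2 (λ a b → con 1 :+ (a :+ (a :+ con 0) :+ (b :+ (b :+ con 0) :+ con 0))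
                                  := (a :+ b) :+ (con 1 :+ (a :+ b) :+ con 0)) refl a b))
      where open +-*-Solver

    w-chord : ∀ {a b} → 1 ≤ a → 1 ≤ b → 2 * b ∸ 1 + (2 * a ∸ 1 + 0) < 2 * (a + b) ∸ 1
    w-chord {suc a} {suc b} _ _ = ≤-reflexive
      (solve 2 (λ a b → con 1 :+ ((b :+ (con 1 :+ b :+ con 0)) :+ ((a :+ (con 1 :+ a :+ con 0)) :+ con 0))
                     := (a :+ (con 1 :+ b)) :+ (con 1 :+ (a :+ (con 1 :+ b)) :+ con 0)) refl a b)
      where open +-*-Solver

  peel-step : ∀ {st} {a : Adj u w} (L : Poly u z) (M : Poly z w) {rest} → Anchored st (node a L M) →
              (∀ q → count q L + count q M + rest q ≤ 2) →
              ch (c st) L ≤ 4 → ch (c st) M ≤ 4 → ch (c st) L + ch (c st) M ≤ 6 → Advance st (node a L M) rest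
  peel-step {u = u} {w = w} {z = z} {st = st} {a} L M {rest} an tot pL pM pLM = record
    { adds = adds
    ; inside = λ { (here refl) → inj₁ (corner-right L) }
    ; calm = calm
    ; Ps = (u , z , L) ∷ (z , w , M) ∷ []
    ; piece = λ { (here refl) → anchored (mono (leftU an)) zU (stops-map L mono (proj₁ (stopsU an))) ,
                                short (≤-trans chL (s≤s pL)) , λ _ → inj₁
                ; (there (here refl)) → anchored zU (mono (rightU an)) (stops-map M mono (proj₂ (stopsU an))) ,
                                short (≤-trans chM (s≤s pM)) , λ _ → inj₂ }
    ; counts = λ q → ≤-reflexive (cong (count q L +_) (+-identityʳ _))
    ; tri = λ { top → inj₁ (mono (leftU an) , zU , mono (rightU an))
              ; (left τ) → inj₂ (_ , _ , L , here refl , τ)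
              ; (right τ) → inj₂ (_ , _ , M , there (here refl) , τ) }
    ; len = ≤-trans (+-monoˡ-≤ 1 (s≤s pLM)) ≤-refl
    ; shrink = w-peel (size L) (size M) }
    where
    open Anchored
    open Peel (peel st L M rest an tot)
    mono : ∀ {v} → U st v → U st′ v
    mono = Ext.U-mono (ext adds)
    zU : U st′ z
    zU = inU adds (here refl)

  -- At least three of the at most five changes are inside, so at most two are around. Two more at
  -- the ends of the chord and one on the chord itself make five again.
  chord-step : ∀ {st} (C : Ctx l h u w) (I : Poly l h) {rest} → Anchored st (plug C I) →
               (∀ q → countC q C + count q I + rest q ≤ 2) →
               ch (c st) (plug C I) ≤ 5 → 3 ≤ ch (c st) I → 1 ≤ sizeC C → 1 ≤ size I →
               (∀ κ → (∀ {x y} (P : Poly x y) → Stops (U st) P → (∀ q → count q P ≤ count q I) → ch κ P ≤ 2 + ch (c st) P) → Fine κ I) →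
               Advance st (plug C I) rest
  chord-step {l = l} {h} {u} {w} {st} C I {rest} (anchored lu ru ss) tot p5 p3 sC sI fineI
    with plug-stops C I ss
  ... | stC , stI = record
    { adds = adds
    ; inside = λ { (here refl) → corner-plug C (corner-right I)
                 ; (there (here refl)) → corner-plug C (corner-left I) }
    ; calm = calm
    ; Ps = (l , h , I) ∷ (u , w , outer) ∷ []
    ; piece = λ { (here refl) → anchored lU hU (stops-map I mono stI) , fineI (c st′) inside , λ _ → corner-plug C
                ; (there (here refl)) → anchored (mono lu) (mono ru) (stops-plug C (stopsC-map C mono stC) (lU , hU)) ,
                    short outer≤ , λ _ → plug-corner C {stop (base-adj I)} {I} λ { (inj₁ refl) → corner-left I ; (inj₂ refl) → corner-right I } }
    ; counts = λ q → ≤-reflexive (trans (cong (count q I +_) (trans (+-identityʳ _)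
                 (trans (plug-count q C (stop (base-adj I))) (+-identityʳ _))))
                 (trans (+-comm (count q I) _) (sym (plug-count q C I))))
    ; tri = tr
    ; len = ≤-trans (+-monoˡ-≤ 2 (s≤s p5)) ≤-refl
    ; shrink = ≤-trans (≤-reflexive (cong (λ s → suc (2 * size I ∸ 1 + (2 * s ∸ 1 + 0)))
                 (trans (plug-size C (stop (base-adj I))) (+-identityʳ _))))
                 (≤-trans (w-chord sC sI) (≤-reflexive (cong (λ s → 2 * s ∸ 1) (sym (plug-size C I))))) }
    where
    open Chord (chord st C I rest lu ru stC stI tot (≤-trans (s≤s z≤n) p3))
    outer : Poly u w
    outer = plug C (stop (base-adj I))
    mono : ∀ {v} → U st v → U st′ v
    mono = Ext.U-mono (ext adds)
    lU : U st′ l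
    lU = inU adds (there (here refl))
    hU : U st′ h
    hU = inU adds (here refl)
    chC≤2 : chC (c st) C ≤ 2
    chC≤2 = +-cancelʳ-≤ 3 _ 2 (≤-trans (+-monoʳ-≤ _ p3) (≤-trans (≤-reflexive (sym (plug-ch (c st) C I))) p5))
    outer≤ : ch (c st′) outer ≤ 5
    outer≤ = ≤-trans (≤-reflexive (plug-ch (c st′) C (stop (base-adj I))))
               (+-mono-≤ (≤-trans around (s≤s (s≤s chC≤2))) (δ≤1 _ _))
    tr : ∀ {x y t} → Tri (plug C I) x y t → (U st′ x × U st′ y × U st′ t) ⊎
           (∃₂ λ a b → Σ (Poly a b) λ P → (a , b , P) ∈ (l , h , I) ∷ (u , w , outer) ∷ [] × Tri P x y t)
    tr τ with plug-tri C τ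
    ... | inj₁ σ = inj₂ (_ , _ , I , here refl , σ)
    ... | inj₂ σ = inj₂ (_ , _ , outer , there (here refl) , σ)

  _⊙_ : ∀ {a b} → Ctx l h u w → Ctx a b l h → Ctx a b u w
  hole      ⊙ D = D
  inl e C M ⊙ D = inl e (C ⊙ D) M
  inr e L C ⊙ D = inr e L (C ⊙ D)

  plug-⊙ : ∀ {a b} (C : Ctx l h u w) (D : Ctx a b l h) (P : Poly a b) → plug (C ⊙ D) P ≡ plug C (plug D P)
  plug-⊙ hole D P = refl
  plug-⊙ (inl e C M) D P = cong (λ X → node e X M) (plug-⊙ C D P)
  plug-⊙ (inr e L C) D P = cong (node e L) (plug-⊙ C D P)

  size-⊙ : ∀ {a b} (C : Ctx l h u w) (D : Ctx a b l h) → 1 ≤ sizeC D → 1 ≤ sizeC (C ⊙ D)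
  size-⊙ hole D p = p
  size-⊙ (inl e C M) D p = s≤s z≤n
  size-⊙ (inr e L C) D p = s≤s z≤n

  size≥1 : ∀ κ (P : Poly u w) → 3 ≤ ch κ P → 1 ≤ size P
  size≥1 κ P p with size P in eq
  ... | zero  = contradiction (≤-trans p (ch-leaf κ P eq)) λ { (s≤s ()) }
  ... | suc _ = s≤s z≤n

  Light : (V → V) → Poly u w → Set
  Light κ (node _ L M) = ch κ L ≤ 4 × ch κ M ≤ 4
  Light κ _            = ⊥

  -- If a lower arc of the centroid triangle has three changes, the chord below it leaves at most
  -- five on either side. Otherwise both lower arcs have exactly two, and the chord above the
  -- triangle is taken: inside there may now be six changes, but the triangle splits them into at
  -- most four and four.
  separate : ∀ {st} (R : Poly u w) {rest} (κ : Centroid (c st) R) →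
             ¬ Light (c st) R →
             Anchored st R → (∀ q → count q R + rest q ≤ 2) → ch (c st) R ≤ 5 → Advance st R rest
  separate {st = st} R {rest} (centroid C a L M refl L≤3 M≤3 LM≥4) nh an tot p5 with 3 ≤? ch (c st) L
  ... | yes p = subst (λ R → Advance st R rest) (plug-⊙ C (inl a hole M) L)
      (chord-step (C ⊙ inl a hole M) L (subst (Anchored st) (sym eq) an)
        (λ q → subst (λ s → s + rest q ≤ 2) (trans (cong (count q) (sym eq)) (plug-count q (C ⊙ inl a hole M) L)) (tot q))
        (subst (λ R → ch (c st) R ≤ 5) (sym eq) p5) p (size-⊙ C _ (s≤s z≤n)) (size≥1 (c st) L p)
        λ κ f → short (≤-trans (f L (proj₂ (plug-stops (C ⊙ inl a hole M) L (subst (Stops (U st)) (sym eq) (Anchored.stopsU an)))) (λ _ → ≤-refl)) (s≤s (s≤s L≤3))))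
    where eq = plug-⊙ C (inl a hole M) L
  ... | no ¬p with 3 ≤? ch (c st) M
  ...   | yes p = subst (λ R → Advance st R rest) (plug-⊙ C (inr a L hole) M)
      (chord-step (C ⊙ inr a L hole) M (subst (Anchored st) (sym eq) an)
        (λ q → subst (λ s → s + rest q ≤ 2) (trans (cong (count q) (sym eq)) (plug-count q (C ⊙ inr a L hole) M)) (tot q))
        (subst (λ R → ch (c st) R ≤ 5) (sym eq) p5) p (size-⊙ C _ (s≤s z≤n)) (size≥1 (c st) M p)
        λ κ f → short (≤-trans (f M (proj₂ (plug-stops (C ⊙ inr a L hole) M (subst (Stops (U st)) (sym eq) (Anchored.stopsU an)))) (λ _ → ≤-refl)) (s≤s (s≤s M≤3))))
    where eq = plug-⊙ C (inr a L hole) M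
  ...   | no ¬q =
      chord-step C (node a L M) an
        (λ q → subst (λ s → s + rest q ≤ 2) (plug-count q C (node a L M)) (tot q)) p5 (≤-trans (n≤1+n 3) LM≥4)
        (ctx-size C nh) (s≤s z≤n)
        λ κ f → peelable (≤-trans (f L sL (λ q → m≤m+n _ _)) (s≤s (s≤s L≤2)))
                         (≤-trans (f M sM (λ q → m≤n+m _ (count q L))) (s≤s (s≤s M≤2)))
                         (≤-trans (f (node a L M) (sL , sM) (λ _ → ≤-refl)) (s≤s (s≤s (+-mono-≤ L≤2 M≤2))))
    where
    L≤2 = ≤-pred (≰⇒> ¬p)
    M≤2 = ≤-pred (≰⇒> ¬q)
    -- Were the centroid triangle the one on the base of `R`, both sides of `R` would have at most
    -- two changes, so `R` would be light. Hence the chord really cuts something off.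
    ctx-size : ∀ {u w} (C : Ctx _ _ u w) → ¬ Light (c st) (plug C (node a L M)) → 1 ≤ sizeC C
    ctx-size hole n = contradiction (≤-trans L≤2 (s≤s (s≤s z≤n)) , ≤-trans M≤2 (s≤s (s≤s z≤n))) n
    ctx-size (inl _ _ _) _ = s≤s z≤n
    ctx-size (inr _ _ _) _ = s≤s z≤n
    sL = proj₁ (proj₂ (plug-stops C (node a L M) (Anchored.stopsU an)))
    sM = proj₂ (proj₂ (plug-stops C (node a L M) (Anchored.stopsU an)))

  progress : ∀ {st} {d : TDec m} {a : Adj u w} {L : Poly u z} {M : Poly z w} {j items} →
         Proc st d (((u , w , node a L M) , j) ∷ items) → Advance st (node a L M) (λ q → total q (regions items))
  progress {st = st} {a = a} {L} {M} I with Good.fine (good I (here refl))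
  ... | peelable p q r = peel-step L M (Good.anch (good I (here refl))) (planar I) p q r
  ... | short p with ch (c st) L ≤? 4 | ch (c st) M ≤? 4
  ...   | yes x | yes y = peel-step L M (Good.anch (good I (here refl))) (planar I) x y (≤-trans p (n≤1+n 5))
  ...   | no x  | _ = separate (node a L M)
                        (find-centroid (c st) (node a L M) (≤-trans (≤-trans (n≤1+n 4) (≰⇒> x)) (m≤m+n _ _)))
                        (λ l → x (proj₁ l)) (Good.anch (good I (here refl))) (planar I) p
  ...   | yes _ | no y = separate (node a L M)
                        (find-centroid (c st) (node a L M) (≤-trans (≤-trans (n≤1+n 4) (≰⇒> y)) (m≤n+m _ (ch (c st) L))))
                        (λ l → y (proj₂ l)) (Good.anch (good I (here refl))) (planar I) p

  record Final (st : State) (d : TDec m) (items : List (Item m)) : Set₁ where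
    field
      {m′}    : ℕ
      {st′}   : State
      {d′}    : TDec m′
      proc    : Proc st′ d′ []
      evolves : Evolves st d items st′ d′ []

  private
    drop : ∀ {st} {d : TDec m} {P : Poly u w} {j items} → (∀ {x y t} → ¬ Tri P x y t) →
           Proc st d (((u , w , P) , j) ∷ items) → Final st d items → Final st d (((u , w , P) , j) ∷ items)
    drop n I f = record
      { proc = Final.proc f
      ; evolves = record
          { ext = Evolves.ext e ; into = Evolves.into e
          ; cov = λ { (inj₁ p) → Evolves.cov e (inj₁ p)
                    ; (inj₂ (_ , _ , _ , _ , here refl , _ , τ)) → contradiction τ n
                    ; (inj₂ (_ , _ , _ , _ , there p , D , τ)) → Evolves.cov e (inj₂ (_ , _ , _ , _ , p , D , τ)) } } }
      where e = Final.evolves f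

    tail-proc : ∀ {st} {d : TDec m} {P : Poly u w} {j items} →
                Proc st d (((u , w , P) , j) ∷ items) → Proc st d items
    tail-proc {P = P} I = record { bags⊆Z = bags⊆Z I ; small = small I
      ; planar = λ q → ≤-trans (m≤n+m _ (count q P)) (planar I q) ; good = λ p → good I (there p) }

    follow : ∀ {st} {d : TDec m} {items} → (n : Next st d items) →
           Final (Next.st′ n) (Next.d′ n) (Next.items′ n) → Final st d items
    follow n f = record
      { proc = Final.proc f
      ; evolves = record
          { ext = ext-trans (Evolves.ext e₁) (Evolves.ext e₂)
          ; into = ↪-trans (Evolves.into e₁) (Evolves.into e₂)
          ; cov = λ p → Evolves.cov e₂ (Evolves.cov e₁ p) } }
      where
      e₁ = Next.evolves n
      e₂ = Final.evolves f

  run : ∀ n {st} {d : TDec m} (items : List (Item m)) → Proc st d items → weight (regions items) ≤ n → Final st d items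
  run n [] I _ = record { proc = I ; evolves = record { ext = ext-refl ; into = ↪-refl ; cov = λ p → p } }
  run n (((_ , _ , up _ _) , _) ∷ items) I p = drop (λ ()) I (run n items (tail-proc I) p)
  run n (((_ , _ , down _ _) , _) ∷ items) I p = drop (λ ()) I (run n items (tail-proc I) p)
  run n (((_ , _ , stop _) , _) ∷ items) I p = drop (λ ()) I (run n items (tail-proc I) p)
  run n (((_ , _ , node _ _ _) , _) ∷ items) I p with advance I (progress I)
  run zero (((_ , _ , node _ _ _) , _) ∷ items) I p | next , lt = contradiction (≤-trans lt p) λ ()
  run (suc n) (((_ , _ , node _ _ _) , _) ∷ items) I p | next , lt =
    follow next (run n (Next.items′ next) (Next.proc next) (≤-pred (≤-trans lt p)))

-- Splitting the polygon into pieces with at most five label changes.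

module RootBag {N : ℕ} {Adj : Fin N → Fin N → Set} (T : BFSTree N Adj)
               (Adj-sym : ∀ {u w} → Adj u w → Adj w u) where
  open BFSTree T
  open Ancestry T
  open Cutting T Adj-sym
  open Peeling T Adj-sym
  open State
  open Adds
  open Anchored

  private variable
    u w z l h x y t : V

  record Bounded (st : State) (r : Region × ℕ) : Set where
    constructor bounded
    field
      anch  : Anchored st (proj₂ (proj₂ (proj₁ r)))
      ch≤   : ch (c st) (proj₂ (proj₂ (proj₁ r))) ≤ proj₂ r
      low   : 1 ≤ proj₂ r
      high  : proj₂ r ≤ 5

  open Bounded

  -- A piece with bound `s` will contribute at most `2s` groups of cells, so this is a bound for the
  -- number of children of the root.
  budget : List (Region × ℕ) → ℕ
  budget []             = 0
  budget ((_ , s) ∷ rs) = 2 * s + budget rs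

  regs : List (Region × ℕ) → List Region
  regs = map proj₁

  record Split (st : State) (P : Poly u w) (done : List (Region × ℕ)) (n s : ℕ) : Set₁ where
    field
      {st′}   : State
      pieces  : List (Region × ℕ)
      ext     : Ext st st′
      good    : ∀ {r} → r ∈ pieces → Bounded st′ r
      planar  : ∀ q → total q (regs pieces) ≤ 2
      budget≤ : budget pieces ≤ budget done + (2 * s + 14 * n)
      paths   : length (Z st′) ≤ length (Z st) + 3 * n
      keep    : ∀ {r} → r ∈ done → r ∈ pieces
      tri     : ∀ {x y t} → Tri P x y t → (U st′ x × U st′ y × U st′ t) ⊎
                (∃ λ r → r ∈ pieces × Tri (proj₂ (proj₂ (proj₁ r))) x y t)

  private
    stop-now : ∀ st (P : Poly u w) done n s → Anchored st P → (∀ {r} → r ∈ done → Bounded st r) →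
               (∀ q → count q P + total q (regs done) ≤ 2) → ch (c st) P ≤ s → 1 ≤ s → ch (c st) P ≤ 5 →
               Split st P done n s
    stop-now st P done n s a g tot p₁ p₂ p₃ = record
      -- The bound `s` carried along may still exceed five when `P` itself has at most five changes.
      { pieces = ((_ , _ , P) , s ⊓ 5) ∷ done
      ; ext = ext-refl
      ; good = λ { (here refl) → bounded a (⊓-glb p₁ p₃) (⊓-glb p₂ (s≤s z≤n)) (m⊓n≤n s 5) ; (there q) → g q }
      ; planar = tot
      ; budget≤ = ≤-trans (≤-reflexive (+-comm _ (budget done)))
                    (+-monoʳ-≤ (budget done) (≤-trans (*-monoʳ-≤ 2 (m⊓n≤m s 5)) (m≤m+n _ _)))
      ; paths = m≤m+n _ _
      ; keep = there
      ; tri = λ τ → inj₂ (_ , here refl , τ) }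

    -- A round costs 14, twice 2 + 2 + 3: two changes gained on each lower arc, two on the
    -- surrounding arc and one on the new chord.
    budget-step : ∀ B A A′ s n e → A + A′ + e ≤ s →
                  (2 * (2 + A) + (2 * (2 + A′) + B)) + (2 * (3 + e) + 14 * n) ≤ B + (2 * s + 14 * suc n)
    budget-step B A A′ s n e p = ≤-trans (≤-reflexive
      (solve 5 (λ B A A′ e n → con 2 :* (con 2 :+ A) :+ (con 2 :* (con 2 :+ A′) :+ B) :+ (con 2 :* (con 3 :+ e) :+ con 14 :* n)
                             := B :+ (con 2 :* (A :+ A′ :+ e) :+ con 14 :* (con 1 :+ n))) refl B A A′ e n))
      (+-monoʳ-≤ B (+-monoˡ-≤ _ (*-monoʳ-≤ 2 p)))
      where open +-*-Solver

  -- The two lower arcs have at most three changes each, so they end with at most five and are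
  -- finished. They take away at least four changes and the outer region regains three, so its bound
  -- falls in every round.
  split : ∀ n st (P : Poly u w) done s → Anchored st P → (∀ {r} → r ∈ done → Bounded st r) →
          (∀ q → count q P + total q (regs done) ≤ 2) → ch (c st) P ≤ s → 1 ≤ s → s ≤ 5 + n →
          Split st P done n s
  split n st P done s a g tot p₁ p₂ p₃ with ch (c st) P ≤? 5
  ... | yes p = stop-now st P done n s a g tot p₁ p₂ p
  split zero st P done s a g tot p₁ p₂ p₃ | no ¬p = contradiction (≤-trans p₁ p₃) ¬p
  split {u} {w} (suc n) st P done s an g tot p₁ p₂ p₃ | no ¬p
    with find-centroid (c st) P (≤-trans (n≤1+n 4) (≤-trans (n≤1+n 5) (≰⇒> ¬p)))
  ... | centroid {l} {m} {h} C e L M refl L≤3 M≤3 LM≥4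
    with plug-stops C (node e L M) (stopsU an)
  ...   | sC , sL , sM
    with tricut st C L M (λ q → total q (regs done)) (leftU an) (rightU an) sC sL sM
           (λ q → ≤-trans (≤-reflexive (perm q)) (tot q))
           -- At most three of the four changes lie on the other arc, so each lower arc has one, as
           -- `tricut` requires.
           (+-cancelʳ-≤ 3 1 _ (≤-trans LM≥4 (+-monoʳ-≤ _ M≤3)))
           (+-cancelʳ-≤ 3 1 _ (≤-trans LM≥4 (≤-trans (+-monoˡ-≤ _ L≤3) (≤-reflexive (+-comm 3 _)))))
    where
    perm : ∀ q → countC q C + count q L + (count q M + total q (regs done)) ≡
                 count q (plug C (node e L M)) + total q (regs done)
    perm q = trans (solve 4 (λ a b c d → a :+ b :+ (c :+ d) := a :+ (b :+ c) :+ d) refl (countC q C) (count q L) _ _)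
                   (cong (_+ total q (regs done)) (sym (plug-count q C (node e L M))))
      where open +-*-Solver
  ...     | X = record
    { pieces = Split.pieces rec
    ; ext = ext-trans (ext adds) (Split.ext rec)
    ; good = Split.good rec
    ; planar = Split.planar rec
    ; budget≤ = ≤-trans (Split.budget≤ rec) (budget-step (budget done) (ch κ L) (ch κ M) s n (chC κ C)
                   (≤-trans (≤-reflexive sumEq) p₁))
    ; paths = ≤-trans (Split.paths rec) (≤-trans (+-monoˡ-≤ (3 * n) (Z-len adds)) (≤-reflexive
                (solve 2 (λ z n → con 3 :+ z :+ con 3 :* n := z :+ con 3 :* (con 1 :+ n)) refl (length (Z st)) n)))
    ; keep = λ p → Split.keep rec (there (there p))
    ; tri = tr }
    where
    open +-*-Solver
    open Tricut X
    κ = c st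
    sumEq : ch κ L + ch κ M + chC κ C ≡ ch κ (plug C (node e L M))
    sumEq = trans (+-comm _ (chC κ C)) (sym (plug-ch κ C (node e L M)))
    mono : ∀ {v} → U st v → U st′ v
    mono = Ext.U-mono (ext adds)
    lU : U st′ l
    lU = inU adds (there (there (here refl)))
    mU : U st′ m
    mU = inU adds (there (here refl))
    hU : U st′ h
    hU = inU adds (here refl)
    outer : Poly u w
    outer = plug C (stop e)
    done′ : List (Region × ℕ)
    done′ = ((l , m , L) , 2 + ch κ L) ∷ ((m , h , M) , 2 + ch κ M) ∷ done
    g′ : ∀ {r} → r ∈ done′ → Bounded st′ r
    g′ (here refl) = bounded (anchored lU mU (stops-map L mono sL)) chL (s≤s z≤n) (s≤s (s≤s L≤3))
    g′ (there (here refl)) = bounded (anchored mU hU (stops-map M mono sM)) chM (s≤s z≤n) (s≤s (s≤s M≤3))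
    g′ {(_ , _ , Q) , _} (there (there p)) = bounded (anchored-ext (ext adds) (anch b))
        (subst (_≤ _) (sym (ch-cong Q (calm Q (anch b) (λ q → total-∈ q (∈-map⁺ proj₁ p))))) (ch≤ b)) (low b) (high b)
      where b = g p
    tot′ : ∀ q → count q outer + total q (regs done′) ≤ 2
    tot′ q = ≤-trans (≤-reflexive (trans (cong (_+ total q (regs done′)) (plug-count q C (stop e)))
      (trans (solve 4 (λ a b c d → a :+ con 0 :+ (b :+ (c :+ d)) := a :+ (b :+ c) :+ d) refl (countC q C) (count q L) _ _)
        (cong (_+ total q (regs done)) (sym (plug-count q C (node e L M))))))) (tot q)
    outer≤ : ch (c st′) outer ≤ 3 + chC κ C
    outer≤ = ≤-trans (≤-reflexive (plug-ch (c st′) C (stop e)))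
      (≤-trans (+-mono-≤ around (δ≤1 _ _)) (≤-reflexive (+-comm _ 1)))
    s′≤ : 3 + chC κ C ≤ 5 + n
    s′≤ = +-cancelˡ-≤ 1 _ _ (≤-trans (+-monoˡ-≤ (chC κ C) LM≥4)
            (≤-trans (≤-reflexive sumEq) (≤-trans p₁ (≤-trans p₃ (≤-reflexive (cong (5 +_) refl))))))
    rec : Split st′ outer done′ n (3 + chC κ C)
    rec = split n st′ outer done′ (3 + chC κ C)
            (anchored (mono (leftU an)) (mono (rightU an)) (stops-plug C (stopsC-map C mono sC) (lU , hU)))
            g′ tot′ outer≤ (s≤s z≤n) s′≤
    mono′ : ∀ {v} → U st′ v → U (Split.st′ rec) v
    mono′ = Ext.U-mono (Split.ext rec)
    tr : ∀ {x y t} → Tri (plug C (node e L M)) x y t →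
         (U (Split.st′ rec) x × U (Split.st′ rec) y × U (Split.st′ rec) t) ⊎
         (∃ λ r → r ∈ Split.pieces rec × Tri (proj₂ (proj₂ (proj₁ r))) x y t)
    tr τ with plug-tri C {Q = stop e} τ
    ... | inj₂ σ = Split.tri rec σ
    ... | inj₁ top = inj₁ (mono′ lU , mono′ mU , mono′ hU)
    ... | inj₁ (left σ) = inj₂ (_ , Split.keep rec (here refl) , σ)
    ... | inj₁ (right σ) = inj₂ (_ , Split.keep rec (there (here refl)) , σ)

-- Cells between labelled chords, and their grouping by labels.

module Cells {N : ℕ} {Adj : Fin N → Fin N → Set} (T : BFSTree N Adj)
             (Adj-sym : ∀ {u w} → Adj u w → Adj w u) (st : Ancestry.State T) where
  open BFSTree T
  open Ancestry T
  open Cutting T Adj-sym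
  open Peeling T Adj-sym
  open State st

  open DecMembership (_≟_ {N}) using (_∈?_)

  private variable
    u w z x y t : V

  -- Opaque, so that case distinctions on U? do not reach into cut.
  abstract
    UU? : ∀ u w → Dec (U u × U w)
    UU? u w = U? u ×-dec U? w

  -- Everything beyond the first chords with two labelled ends is dropped. A cell will be a triangle
  -- with labelled base and unlabelled apex, with its two sides truncated in this way.
  cut : Poly u w → Poly u w
  cut {u} {w} P with UU? u w
  ... | yes _ = stop (base-adj P)
  cut (node a L M) | no _ = node a (cut L) (cut M)
  cut P            | no _ = P

  cut-yes : (P : Poly u w) → U u → U w → cut P ≡ stop (base-adj P)
  cut-yes {u} {w} P a b with UU? u w
  ... | yes _ = refl
  ... | no n  = contradiction (a , b) n

  cut-stops : (P : Poly u w) → Stops U P → Stops U (cut P)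
  cut-stops {u} {w} P s with UU? u w
  cut-stops P s | yes p = p
  cut-stops (node a L M) (s , t) | no _ = cut-stops L s , cut-stops M t
  cut-stops (up _ _) s | no _ = s
  cut-stops (down _ _) s | no _ = s
  cut-stops (stop _) s | no _ = s

  cut-ch : (P : Poly u w) → ch c (cut P) ≤ ch c P
  cut-ch {u} {w} P with UU? u w
  cut-ch P | yes _ = ch-ends c P
  cut-ch (node a L M) | no _ = +-mono-≤ (cut-ch L) (cut-ch M)
  cut-ch (up _ _) | no _ = ≤-refl
  cut-ch (down _ _) | no _ = ≤-refl
  cut-ch (stop _) | no _ = ≤-refl

  Lb : Region → List V
  Lb (_ , _ , P) = labels c P

  labels-node : ∀ {a} (L : Poly u z) (M : Poly z w) {x} →
                x ∈ labels c (node a L M) → x ∈ labels c L ⊎ x ∈ labels c M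
  labels-node L M (here e) = inj₁ (here e)
  labels-node L M (there p) with ∈-++⁻ (tail c L) p
  ... | inj₁ q = inj₁ (there q)
  ... | inj₂ q = inj₂ (there q)

  labels-sub : ∀ {P : Poly u w} {xs} → (∀ v → Corner P v → c v ∈ xs) → labels c P ⊆ xs
  labels-sub {P = P} f p with labels-corner c P p
  ... | v , q , refl = f v q

  labels-left : ∀ {a} (L : Poly u z) (M : Poly z w) → labels c L ⊆ labels c (node a L M)
  labels-left {a = a} L M = labels-sub {P = L} λ v p → labels-all c (node a L M) (inj₁ p)

  labels-right : ∀ {a} (L : Poly u z) (M : Poly z w) → labels c M ⊆ labels c (node a L M)
  labels-right {a = a} L M = labels-sub {P = M} λ v p → labels-all c (node a L M) (inj₂ p)

  labels-stop : ∀ {a : Adj u w} → labels c (stop a) ⊆ c u ∷ c w ∷ []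
  labels-stop {a = a} = labels-sub {P = stop a} λ { v (inj₁ refl) → here refl ; v (inj₂ refl) → there (here refl) }

  pair-⊆ : ∀ {a b : V} {xs} → a ∈ xs → b ∈ xs → a ∷ b ∷ [] ⊆ xs
  pair-⊆ p q (here refl)         = p
  pair-⊆ p q (there (here refl)) = q

  ends-labels : ∀ (P : Poly u w) → c u ∷ c w ∷ [] ⊆ labels c P
  ends-labels P = pair-⊆ (labels-all c P (corner-left P)) (labels-all c P (corner-right P))

  module _ (I : V → Set) where
    private
      leaf : ∀ {u w v e} (P : Poly u w) → (∀ {v} → v ≡ u ⊎ v ≡ w → ¬ U v → I v) → v ≡ u ⊎ v ≡ w → ¬ U v →
             e ≡ u ⊎ e ≡ w → ¬ U e → WalkIn Adj I e v
      leaf P i (inj₁ refl) ¬v (inj₁ refl) ¬e = here (i (inj₁ refl) ¬v)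
      leaf P i (inj₂ refl) ¬v (inj₂ refl) ¬e = here (i (inj₂ refl) ¬v)
      leaf P i (inj₁ refl) ¬v (inj₂ refl) ¬e = step (i (inj₂ refl) ¬e) (Adj-sym (base-adj P)) (here (i (inj₁ refl) ¬v))
      leaf P i (inj₂ refl) ¬v (inj₁ refl) ¬e = step (i (inj₁ refl) ¬e) (base-adj P) (here (i (inj₂ refl) ¬v))

    -- Every triangle left has an unlabelled corner on its base, and from there one edge leads to an
    -- unlabelled end of the side behind which `v` lies. If that side had no such end, it would have
    -- been truncated and would offer no unlabelled corner.
    connected : (P : Poly u w) → ¬ (U u × U w) → (∀ {v} → Corner (cut P) v → ¬ U v → I v) →
                ∀ {v} → Corner (cut P) v → ¬ U v → ∀ e → e ≡ u ⊎ e ≡ w → ¬ U e → WalkIn Adj I e v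
    connected {u} {w} P n i p ¬v e e∈ ¬e with UU? u w
    connected P n i p ¬v e e∈ ¬e | yes q = contradiction q n
    connected (node {u = u} {z = z} {w = w} a L M) n i p ¬v e e∈ ¬e | no _ = go p e∈
      where
      iu : ¬ U u → I u
      iu = i (inj₁ (corner-left (cut L)))
      iw : ¬ U w → I w
      iw = i (inj₂ (corner-right (cut M)))
      go : Corner (cut L) _ ⊎ Corner (cut M) _ → e ≡ u ⊎ e ≡ w → WalkIn Adj I e _
      go (inj₁ q) e∈ with U? z
      go (inj₁ q) (inj₁ refl) | no ¬z = step (iu ¬e) (base-adj L) (connected L (¬z ∘ proj₂) (i ∘ inj₁) q ¬v z (inj₂ refl) ¬z)
      go (inj₁ q) (inj₂ refl) | no ¬z = step (iw ¬e) (Adj-sym (base-adj M)) (connected L (¬z ∘ proj₂) (i ∘ inj₁) q ¬v z (inj₂ refl) ¬z)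
      ... | yes uz with U? u
      go (inj₁ q) (inj₁ refl) | yes uz | no ¬u = connected L (¬u ∘ proj₁) (i ∘ inj₁) q ¬v u (inj₁ refl) ¬u
      go (inj₁ q) (inj₂ refl) | yes uz | no ¬u = step (iw ¬e) (Adj-sym a) (connected L (¬u ∘ proj₁) (i ∘ inj₁) q ¬v u (inj₁ refl) ¬u)
      go (inj₁ q) e∈ | yes uz | yes uu with subst (λ X → Corner X _) (cut-yes L uu uz) q
      ... | inj₁ refl = contradiction uu ¬v
      ... | inj₂ refl = contradiction uz ¬v
      go (inj₂ q) e∈ with U? z
      go (inj₂ q) (inj₁ refl) | no ¬z = step (iu ¬e) (base-adj L) (connected M (¬z ∘ proj₁) (i ∘ inj₂) q ¬v z (inj₁ refl) ¬z)
      go (inj₂ q) (inj₂ refl) | no ¬z = step (iw ¬e) (Adj-sym (base-adj M)) (connected M (¬z ∘ proj₁) (i ∘ inj₂) q ¬v z (inj₁ refl) ¬z)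
      ... | yes uz with U? w
      go (inj₂ q) (inj₁ refl) | yes uz | no ¬w = step (iu ¬e) a (connected M (¬w ∘ proj₂) (i ∘ inj₂) q ¬v w (inj₂ refl) ¬w)
      go (inj₂ q) (inj₂ refl) | yes uz | no ¬w = connected M (¬w ∘ proj₂) (i ∘ inj₂) q ¬v w (inj₂ refl) ¬w
      go (inj₂ q) e∈ | yes uz | yes uw with subst (λ X → Corner X _) (cut-yes M uz uw) q
      ... | inj₁ refl = contradiction uz ¬v
      ... | inj₂ refl = contradiction uw ¬v
    connected P@(up _ _) n i p ¬v e e∈ ¬e | no _ = leaf P i p ¬v e∈ ¬e
    connected P@(down _ _) n i p ¬v e e∈ ¬e | no _ = leaf P i p ¬v e∈ ¬e
    connected P@(stop _) n i p ¬v e e∈ ¬e | no _ = leaf P i p ¬v e∈ ¬e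

  Inner : Poly u w → V → Set
  Inner P v = Corner P v × ¬ U v

  -- Walking along the boundary from an unlabelled corner, one meets the labelled end of its path.
  Exit : Poly u w → V → Set
  Exit P v = ∃ λ q → Corner P q × ¬ U q × q ≢ root × U (parent q) × c q ≡ c v

  exit-from-left : (P : Poly u w) → Stops U P → ¬ U u → Exit P u ⊎ (¬ U w × c w ≡ c u)
  exit-from-left (up {w = w} r refl) s n with U? w
  ... | yes q = inj₁ (_ , inj₁ refl , n , r , q , refl)
  ... | no ¬q = inj₂ (¬q , sym (c-up n))
  exit-from-left (down r refl) s n = inj₂ ((λ q → n (U-up r q)) , c-up (λ q → n (U-up r q)))
  exit-from-left (stop _) (p , _) n = contradiction p n
  exit-from-left (node a L M) (sL , sM) n with exit-from-left L sL n
  ... | inj₁ (q , cr , rest) = inj₁ (q , inj₁ cr , rest)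
  ... | inj₂ (nz , e) with exit-from-left M sM nz
  ...   | inj₁ (q , cr , nu , r , p , e′) = inj₁ (q , inj₂ cr , nu , r , p , trans e′ e)
  ...   | inj₂ (nw , e′) = inj₂ (nw , trans e′ e)

  exit : (P : Poly u w) → Stops U P → ∀ {v} → Inner P v → Exit P v ⊎ (¬ U w × c w ≡ c v)
  exit (node a L M) (sL , sM) (inj₁ p , n) with exit L sL (p , n)
  ... | inj₁ (q , cr , rest) = inj₁ (q , inj₁ cr , rest)
  ... | inj₂ (nz , e) with exit-from-left M sM nz
  ...   | inj₁ (q , cr , nu , r , p , e′) = inj₁ (q , inj₂ cr , nu , r , p , trans e′ e)
  ...   | inj₂ (nw , e′) = inj₂ (nw , trans e′ e)
  exit (node a L M) (sL , sM) (inj₂ p , n) with exit M sM (p , n)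
  ... | inj₁ (q , cr , rest) = inj₁ (q , inj₂ cr , rest)
  ... | inj₂ r = inj₂ r
  exit P@(up _ _) s (inj₁ refl , n) = exit-from-left P s n
  exit P@(down _ _) s (inj₁ refl , n) = exit-from-left P s n
  exit P@(stop _) s (inj₁ refl , n) = exit-from-left P s n
  exit (up _ _) s (inj₂ refl , n) = inj₂ (n , refl)
  exit (down _ _) s (inj₂ refl , n) = inj₂ (n , refl)
  exit (stop _) s (inj₂ refl , n) = inj₂ (n , refl)

  -- Follow the labelled corner down to a side. If this side is truncated, the third corner of the
  -- triangle on it is unlabelled, since the base of that triangle is not truncated; otherwise the
  -- other end of the side is unlabelled.
  touching : (P : Poly u w) → ¬ (U u × U w) → ∀ {v} → Corner (cut P) v → U v → ∃ λ e → Inner (cut P) e × Adj e v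
  touching {u} {w} P n p uv with UU? u w
  touching P n p uv | yes q = contradiction q n
  touching P@(up _ _) n (inj₁ refl) uv | no _ = _ , (inj₂ refl , λ x → n (uv , x)) , Adj-sym (base-adj P)
  touching P@(up _ _) n (inj₂ refl) uv | no _ = _ , (inj₁ refl , λ x → n (x , uv)) , base-adj P
  touching P@(down _ _) n (inj₁ refl) uv | no _ = _ , (inj₂ refl , λ x → n (uv , x)) , Adj-sym (base-adj P)
  touching P@(down _ _) n (inj₂ refl) uv | no _ = _ , (inj₁ refl , λ x → n (x , uv)) , base-adj P
  touching P@(stop _) n (inj₁ refl) uv | no _ = _ , (inj₂ refl , λ x → n (uv , x)) , Adj-sym (base-adj P)
  touching P@(stop _) n (inj₂ refl) uv | no _ = _ , (inj₁ refl , λ x → n (x , uv)) , base-adj P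
  touching (node {u} {z} {w} a L M) n (inj₁ p) uv | no _ = go (UU? u z)
    where
    go : Dec (U u × U z) → ∃ λ e → Inner (node a (cut L) (cut M)) e × Adj e _
    go (no ¬uz) = let e , (q , r) , s = touching L ¬uz p uv in e , (inj₁ q , r) , s
    go (yes (uu , uz)) with subst (λ X → Corner X _) (cut-yes L uu uz) p
    ... | inj₁ refl = w , (inj₂ (corner-right (cut M)) , λ x → n (uu , x)) , Adj-sym a
    ... | inj₂ refl = w , (inj₂ (corner-right (cut M)) , λ x → n (uu , x)) , Adj-sym (base-adj M)
  touching (node {u} {z} {w} a L M) n (inj₂ p) uv | no _ = go (UU? z w)
    where
    go : Dec (U z × U w) → ∃ λ e → Inner (node a (cut L) (cut M)) e × Adj e _
    go (no ¬zw) = let e , (q , r) , s = touching M ¬zw p uv in e , (inj₂ q , r) , s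
    go (yes (uz , uw)) with subst (λ X → Corner X _) (cut-yes M uz uw) p
    ... | inj₁ refl = u , (inj₁ (corner-left (cut L)) , λ x → n (x , uw)) , base-adj L
    ... | inj₂ refl = u , (inj₁ (corner-left (cut L)) , λ x → n (x , uw)) , a

  record Cell (K : Region) : Set where
    field
      anch   : Anchored st (proj₂ (proj₂ K))
      centre : V
      inner  : Inner (proj₂ (proj₂ K)) centre
      linked : ∀ {v} → Inner (proj₂ (proj₂ K)) v → WalkIn Adj (Inner (proj₂ (proj₂ K))) centre v
      touch  : ∀ {x} → x ∈ Lb K → ∃₂ λ e v → Inner (proj₂ (proj₂ K)) e × U v × c v ≡ x × Adj e v
      inTri  : ∀ {v} → Corner (proj₂ (proj₂ K)) v → ∃ λ x → ∃₂ λ y t →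
                 Tri (proj₂ (proj₂ K)) x y t × (v ≡ x ⊎ v ≡ y ⊎ v ≡ t)

  corner-tri : (P : Poly u w) → ∀ {v} → Corner P v → (v ≡ u ⊎ v ≡ w) ⊎
               (∃ λ x → ∃₂ λ y t → Tri P x y t × (v ≡ x ⊎ v ≡ y ⊎ v ≡ t))
  corner-tri (up _ _) p = inj₁ p
  corner-tri (down _ _) p = inj₁ p
  corner-tri (stop _) p = inj₁ p
  corner-tri (node a L M) (inj₁ p) with corner-tri L p
  ... | inj₁ (inj₁ e) = inj₁ (inj₁ e)
  ... | inj₁ (inj₂ e) = inj₂ (_ , _ , _ , top , inj₂ (inj₁ e))
  ... | inj₂ (_ , _ , _ , τ , m) = inj₂ (_ , _ , _ , left τ , m)
  corner-tri (node a L M) (inj₂ p) with corner-tri M p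
  ... | inj₁ (inj₂ e) = inj₁ (inj₂ e)
  ... | inj₁ (inj₁ e) = inj₂ (_ , _ , _ , top , inj₂ (inj₁ e))
  ... | inj₂ (_ , _ , _ , τ , m) = inj₂ (_ , _ , _ , right τ , m)

  node-tri : ∀ {a} {L : Poly u z} {M : Poly z w} {v} → Corner (node a L M) v →
             ∃ λ x → ∃₂ λ y t → Tri (node a L M) x y t × (v ≡ x ⊎ v ≡ y ⊎ v ≡ t)
  node-tri {a = a} {L} {M} p with corner-tri (node a L M) p
  ... | inj₂ q = q
  ... | inj₁ (inj₁ e) = _ , _ , _ , top , inj₁ e
  ... | inj₁ (inj₂ e) = _ , _ , _ , top , inj₂ (inj₂ e)

  cell : ∀ {a : Adj u w} (L : Poly u z) (M : Poly z w) → U u → U w → ¬ U z → Stops U L → Stops U M →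
         Cell (u , w , node a (cut L) (cut M))
  cell {u} {w} {z} {a} L M uu uw nz sL sM = record
    { anch = anchored uu uw (cut-stops L sL , cut-stops M sM)
    ; centre = z
    ; inner = inj₁ (corner-right (cut L)) , nz
    ; linked = λ { (inj₁ p , n) → connected _ L (nz ∘ proj₂) (λ q n → inj₁ q , n) p n z (inj₂ refl) nz
                 ; (inj₂ p , n) → connected _ M (nz ∘ proj₁) (λ q n → inj₂ q , n) p n z (inj₁ refl) nz }
    ; touch = tch
    ; inTri = node-tri }
    where
    K = node a (cut L) (cut M)
    tch : ∀ {x} → x ∈ labels c K → ∃₂ λ e v → Inner K e × U v × c v ≡ x × Adj e v
    tch x∈ with labels-corner c K x∈
    ... | v , p , refl with U? v
    tch x∈ | v , inj₁ p , refl | yes uv = let e , (q , n) , r = touching L (nz ∘ proj₂) p uv in e , v , (inj₁ q , n) , uv , refl , r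
    tch x∈ | v , inj₂ p , refl | yes uv = let e , (q , n) , r = touching M (nz ∘ proj₁) p uv in e , v , (inj₂ q , n) , uv , refl , r
    -- The label was found at an unlabelled corner, which need not be next to its path. Further
    -- along the boundary the walk climbs from an unlabelled `q` to its parent on this very path.
    ... | no nv with exit K (cut-stops L sL , cut-stops M sM) (p , nv)
    ...   | inj₂ (nw , _) = contradiction uw nw
    ...   | inj₁ (q , cr , nq , r , pq , e) = q , parent q , (cr , nq) , pq , trans (sym (c-up nq)) e , parent-adj q r

  -- A head cell with its followers. The cells of a group share one child of the root, whose bag
  -- consists of the labels of the head. It is also the head alone that provides the component
  -- required for that child.
  Group : Set
  Group = Region × List Region

  gtotal : V → List Group → ℕ
  gtotal q []             = 0
  gtotal q ((r , fs) ∷ gs) = total q (r ∷ fs) + gtotal q gs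

  gtotal-++ : ∀ q gs hs → gtotal q (gs ++ hs) ≡ gtotal q gs + gtotal q hs
  gtotal-++ q [] hs = refl
  gtotal-++ q ((r , fs) ∷ gs) hs =
    trans (cong (total q (r ∷ fs) +_) (gtotal-++ q gs hs)) (sym (+-assoc (total q (r ∷ fs)) _ _))

  InGroup : List Group → Region → Set
  InGroup gs K = ∃ λ g → g ∈ gs × K ∈ proj₁ g ∷ proj₂ g

  Mem : List Group → List Region → Region → Set
  Mem gs ps K = InGroup gs K ⊎ K ∈ ps

  mem-++ : ∀ gs {hs ps qs K} → Mem (gs ++ hs) (ps ++ qs) K → Mem gs ps K ⊎ Mem hs qs K
  mem-++ gs (inj₁ (g , p , m)) with ∈-++⁻ gs p
  ... | inj₁ q = inj₁ (inj₁ (g , q , m))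
  ... | inj₂ q = inj₂ (inj₁ (g , q , m))
  mem-++ gs {ps = ps} (inj₂ p) with ∈-++⁻ ps p
  ... | inj₁ q = inj₁ (inj₂ q)
  ... | inj₂ q = inj₂ (inj₂ q)

  mem-++ˡ : ∀ {gs hs ps qs K} → Mem gs ps K → Mem (gs ++ hs) (ps ++ qs) K
  mem-++ˡ (inj₁ (g , p , m)) = inj₁ (g , ∈-++⁺ˡ p , m)
  mem-++ˡ (inj₂ p) = inj₂ (∈-++⁺ˡ p)

  mem-++ʳ : ∀ gs {hs} ps {qs K} → Mem hs qs K → Mem (gs ++ hs) (ps ++ qs) K
  mem-++ʳ gs ps (inj₁ (g , p , m)) = inj₁ (g , ∈-++⁺ʳ gs p , m)
  mem-++ʳ gs ps (inj₂ p) = inj₂ (∈-++⁺ʳ ps p)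

  TriIn : Region → V → V → V → Set
  TriIn (_ , _ , P) = Tri P

  chR : Region → ℕ
  chR (_ , _ , P) = ch c P

  AllU : V → V → V → Set
  AllU x y t = U x × U y × U t

  Covered : Poly u w → List Group → List Region → V → V → V → Set
  Covered Q gs ps x y t = AllU x y t ⊎ Tri Q x y t ⊎ (∃ λ K → Mem gs ps K × TriIn K x y t)

  -- The cells cut off from P by chords with two labelled ends are collected into groups, each headed by
  -- a cell that sees all labels of the group; pending are those that only see labels of Q, where Q is
  -- what remains of P.  The bound on the number of groups is the number 2 (k + 1) - 3 of edges of a
  -- triangulated (k + 1)-gon, less the edge between the two ends of P.
  record Sorted (P Q : Poly u w) : Set where
    field
      groups : List Group
      pend   : List Region
      cells  : ∀ {K} → Mem groups pend K → Cell K
      low    : ∀ {K} → Mem groups pend K → chR K ≤ ch c P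
      fit    : ∀ {g K} → g ∈ groups → K ∈ proj₂ g → Lb K ⊆ Lb (proj₁ g)
      fitP   : ∀ {K} → K ∈ pend → Lb K ⊆ labels c Q
      counts : ∀ q → gtotal q groups + total q pend + count q Q ≤ count q P
      tri    : ∀ {x y t} → Tri P x y t → Covered Q groups pend x y t
      few    : (labels c Q ⊆ c u ∷ c w ∷ [] × length groups ≤ 2 * ch c P ∸ 2) ⊎
               suc (length groups) ≤ 2 * ch c P ∸ 2

  open Sorted

  few-all : ∀ {P Q : Poly u w} (S : Sorted P Q) → length (groups S) ≤ 2 * ch c P ∸ 2
  few-all S with few S
  ... | inj₁ (_ , p) = p
  ... | inj₂ p = ≤-trans (n≤1+n _) p

  private
    twice-suc : ∀ a b → 2 + ((2 * suc a ∸ 2) + (2 * suc b ∸ 2)) ≡ 2 * (suc a + suc b) ∸ 2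
    twice-suc a b = begin
      2 + ((2 * suc a ∸ 2) + (2 * suc b ∸ 2)) ≡⟨ cong (2 +_) (cong₂ (λ x y → (x ∸ 2) + (y ∸ 2)) (*-suc 2 a) (*-suc 2 b)) ⟩
      2 + (2 * a + 2 * b)                     ≡⟨ cong (2 +_) (sym (*-distribˡ-+ 2 a b)) ⟩
      2 + 2 * (a + b)                         ≡⟨ sym (*-suc 2 (a + b)) ⟩
      2 * suc (a + b)                         ≡⟨ cong (2 *_) (sym (+-suc a b)) ⟩
      2 * (a + suc b)                         ≡⟨ cong (_∸ 2) (sym (*-suc 2 (a + suc b))) ⟩
      2 * (suc a + suc b) ∸ 2                 ∎
      where open ≡-Reasoning

    twice-sum : ∀ a b → (2 * a ∸ 2) + (2 * b ∸ 2) ≤ 2 * (a + b) ∸ 2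
    twice-sum zero b = ≤-refl
    twice-sum (suc a) zero = ≤-reflexive (trans (+-identityʳ _) (cong (λ s → 2 * s ∸ 2) (sym (+-identityʳ (suc a)))))
    twice-sum (suc a) (suc b) = ≤-trans (m≤n+m _ 2) (≤-reflexive (twice-suc a b))

    twice-sum₂ : ∀ {a b} → 1 ≤ a → 1 ≤ b → 2 + ((2 * a ∸ 2) + (2 * b ∸ 2)) ≤ 2 * (a + b) ∸ 2
    twice-sum₂ {suc a} {suc b} _ _ = ≤-reflexive (twice-suc a b)

    sum-shuffle : ∀ a b e f g h → (a + b) + (e + f) + (g + h) ≡ (a + e + g) + (b + f + h)
    sum-shuffle = solve 6 (λ a b e f g h → (a :+ b) :+ (e :+ f) :+ (g :+ h) := (a :+ e :+ g) :+ (b :+ f :+ h)) refl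
      where open +-*-Solver

  c-≢ : ∀ {x y} (P : Poly x y) → c x ≢ c y → 1 ≤ ch c P
  c-≢ P n = ≤-trans (δ-≢ n) (ch-ends c P)

  -- Slack on either side is passed on. Without slack, if the label of the apex agrees with that of
  -- an end, the labels stay within those of the ends; if it differs from both, each side has a
  -- change and the bound gains two, which yields the strict alternative.
  merge : ∀ {a : Adj u w} {L QL : Poly u z} {M QM : Poly z w} → Sorted L QL → Sorted M QM →
          Sorted (node a L M) (node a QL QM)
  merge {u} {w} {z} {a} {L} {QL} {M} {QM} S R = record
    { groups = groups S ++ groups R
    ; pend = pend S ++ pend R
    ; cells = λ m → [ cells S , cells R ]′ (mem-++ (groups S) m)
    ; low = λ m → [ (λ p → ≤-trans (low S p) (m≤m+n _ _)) , (λ p → ≤-trans (low R p) (m≤n+m _ (ch c L))) ]′ (mem-++ (groups S) m)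
    ; fit = λ p → [ fit S , fit R ]′ (∈-++⁻ (groups S) p)
    ; fitP = λ p → [ (λ q x → labels-left {a = a} QL QM (fitP S q x)) , (λ q x → labels-right {a = a} QL QM (fitP R q x)) ]′ (∈-++⁻ (pend S) p)
    ; counts = λ q → ≤-trans (≤-reflexive (trans (cong₂ (λ g p → g + p + _) (gtotal-++ q (groups S) _) (total-++ q (pend S) _))
                 (sum-shuffle (gtotal q (groups S)) _ _ _ _ _))) (+-mono-≤ (counts S q) (counts R q))
    ; tri = tr
    ; few = fw (few S) (few R) }
    where
    tr : ∀ {x y t} → Tri (node a L M) x y t → Covered (node a QL QM) (groups S ++ groups R) (pend S ++ pend R) x y t
    tr top = inj₂ (inj₁ top)
    tr (left τ) with tri S τ
    ... | inj₁ p = inj₁ p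
    ... | inj₂ (inj₁ σ) = inj₂ (inj₁ (left σ))
    ... | inj₂ (inj₂ (K , m , σ)) = inj₂ (inj₂ (K , mem-++ˡ m , σ))
    tr (right τ) with tri R τ
    ... | inj₁ p = inj₁ p
    ... | inj₂ (inj₁ σ) = inj₂ (inj₁ (right σ))
    ... | inj₂ (inj₂ (K , m , σ)) = inj₂ (inj₂ (K , mem-++ʳ (groups S) (pend S) m , σ))
    len : length (groups S ++ groups R) ≡ length (groups S) + length (groups R)
    len = length-++ (groups S)
    T₂ = 2 * (ch c L + ch c M) ∸ 2
    fw : (labels c QL ⊆ c u ∷ c z ∷ [] × length (groups S) ≤ 2 * ch c L ∸ 2) ⊎ suc (length (groups S)) ≤ 2 * ch c L ∸ 2 →
         (labels c QM ⊆ c z ∷ c w ∷ [] × length (groups R) ≤ 2 * ch c M ∸ 2) ⊎ suc (length (groups R)) ≤ 2 * ch c M ∸ 2 →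
         (labels c (node a QL QM) ⊆ c u ∷ c w ∷ [] × length (groups S ++ groups R) ≤ T₂) ⊎
         suc (length (groups S ++ groups R)) ≤ T₂
    fw (inj₂ p) _ = inj₂ (≤-trans (≤-reflexive (cong suc len)) (≤-trans (+-mono-≤ p (few-all R)) (twice-sum (ch c L) (ch c M))))
    fw (inj₁ _) (inj₂ p) = inj₂ (≤-trans (≤-reflexive (trans (cong suc len) (sym (+-suc _ _))))
                              (≤-trans (+-mono-≤ (few-all S) p) (twice-sum (ch c L) (ch c M))))
    fw (inj₁ (s₁ , p)) (inj₁ (s₂ , q)) with c u ≟ c z
    ... | yes e = inj₁ ((λ m → [ (λ r → pair-⊆ (here refl) (here (sym e)) (s₁ r))
                               , (λ r → pair-⊆ (here (sym e)) (there (here refl)) (s₂ r)) ]′ (labels-node {a = a} QL QM m)) ,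
                        ≤-trans (≤-reflexive len) (≤-trans (+-mono-≤ p q) (twice-sum (ch c L) (ch c M))))
    ... | no n with c z ≟ c w
    ...   | yes e = inj₁ ((λ m → [ (λ r → pair-⊆ (here refl) (there (here e)) (s₁ r))
                                 , (λ r → pair-⊆ (there (here e)) (there (here refl)) (s₂ r)) ]′ (labels-node {a = a} QL QM m)) ,
                          ≤-trans (≤-reflexive len) (≤-trans (+-mono-≤ p q) (twice-sum (ch c L) (ch c M))))
    ...   | no n′ = inj₂ (≤-trans (s≤s (≤-trans (≤-reflexive len) (+-mono-≤ p q)))
                      (≤-trans (n≤1+n _) (twice-sum₂ (c-≢ L n) (c-≢ M n′))))

  record Parted (D : Region → Set) (Ks : List Region) : Set where
    field
      ys ns : List Region
      sums  : ∀ q → total q ys + total q ns ≡ total q Ks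
      yes∈  : ∀ {K} → K ∈ ys → D K × K ∈ Ks
      no∈   : ∀ {K} → K ∈ ns → ¬ D K × K ∈ Ks
      all   : ∀ {K} → K ∈ Ks → K ∈ ys ⊎ K ∈ ns

  parted : ∀ {D : Region → Set} → (∀ K → Dec (D K)) → ∀ Ks → Parted D Ks
  parted D? [] = record { ys = [] ; ns = [] ; sums = λ _ → refl ; yes∈ = λ () ; no∈ = λ () ; all = λ () }
  parted D? (K@(_ , _ , P) ∷ Ks) with parted D? Ks | D? K
  ... | R | yes d = record
    { ys = K ∷ ys ; ns = ns
    ; sums = λ q → trans (+-assoc (count q P) _ _) (cong (count q P +_) (sums q))
    ; yes∈ = λ { (here refl) → d , here refl ; (there p) → let a , b = yes∈ p in a , there b }
    ; no∈ = λ p → let a , b = no∈ p in a , there b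
    ; all = λ { (here refl) → inj₁ (here refl) ; (there p) → [ inj₁ ∘ there , inj₂ ]′ (all p) } }
    where open Parted R
  ... | R | no d = record
    { ys = ys ; ns = K ∷ ns
    ; sums = λ q → trans (trans (sym (+-assoc (total q ys) _ _)) (trans (cong (_+ total q ns) (+-comm (total q ys) _))
                     (+-assoc (count q P) _ _))) (cong (count q P +_) (sums q))
    ; yes∈ = λ p → let a , b = yes∈ p in a , there b
    ; no∈ = λ { (here refl) → d , here refl ; (there p) → let a , b = no∈ p in a , there b }
    ; all = λ { (here refl) → inj₂ (here refl) ; (there p) → [ inj₁ , inj₂ ∘ there ]′ (all p) } }
    where open Parted R

  record Picked (a b : V) (Ks : List Region) : Set where
    field
      gs   : List Group
      rest : List Region
      one  : length gs ≤ 1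
      sums : ∀ q → gtotal q gs + total q rest ≡ total q Ks
      from : ∀ {K} → Mem gs rest K → K ∈ Ks
      to   : ∀ {K} → K ∈ Ks → Mem gs rest K
      fits : ∀ {g K} → g ∈ gs → K ∈ proj₂ g → Lb K ⊆ Lb (proj₁ g)
      only : ∀ {K} → K ∈ rest → Lb K ⊆ a ∷ []

  -- A cell with both labels dominates all others. If there is none, every cell has a single label:
  -- those with `b` form one group, and those with `a` can wait.
  pick : ∀ a b Ks → (∀ {K} → K ∈ Ks → Lb K ⊆ a ∷ b ∷ []) → Picked a b Ks
  pick a b Ks sub with parted (λ K → (a ∈? Lb K) ×-dec (b ∈? Lb K)) Ks
  ... | record { ys = K@(_ , _ , P) ∷ ys ; ns = ns ; sums = sums ; yes∈ = yes∈ ; no∈ = no∈ ; all = all } = record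
    { gs = (K , ys ++ ns) ∷ [] ; rest = [] ; one = ≤-refl
    ; sums = λ q → trans (trans (+-identityʳ _) (trans (+-identityʳ _) (trans (cong (count q P +_) (total-++ q ys ns))
                     (sym (+-assoc (count q P) _ _))))) (sums q)
    ; from = fr
    ; to = λ p → inj₁ (_ , here refl , [ (λ { (here e) → here e ; (there q) → there (∈-++⁺ˡ q) }) , (λ q → there (∈-++⁺ʳ ys q)) ]′ (all p))
    ; fits = ft
    ; only = λ () }
    where
    back : ∀ {K′} → K′ ∈ ys ++ ns → K′ ∈ Ks
    back q = [ (λ r → proj₂ (yes∈ (there r))) , (λ r → proj₂ (no∈ r)) ]′ (∈-++⁻ ys q)
    fr : ∀ {K′} → Mem ((K , ys ++ ns) ∷ []) [] K′ → K′ ∈ Ks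
    fr (inj₁ (_ , here refl , here e)) = proj₂ (yes∈ (here e))
    fr (inj₁ (_ , here refl , there q)) = back q
    ft : ∀ {g K′} → g ∈ (K , ys ++ ns) ∷ [] → K′ ∈ proj₂ g → Lb K′ ⊆ Lb (proj₁ g)
    ft (here refl) q m with sub (back q) m
    ... | here e = subst (_∈ Lb K) (sym e) (proj₁ (proj₁ (yes∈ (here refl))))
    ... | there (here e) = subst (_∈ Lb K) (sym e) (proj₂ (proj₁ (yes∈ (here refl))))
  ... | record { ys = [] ; no∈ = none ; all = all₀ } with parted (λ K → b ∈? Lb K) Ks
  ...   | record { ys = [] ; ns = ns ; sums = sums ; no∈ = no∈ ; all = all } = record
    { gs = [] ; rest = ns ; one = z≤n ; sums = sums
    ; from = λ { (inj₂ p) → proj₂ (no∈ p) }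
    ; to = λ p → [ (λ ()) , inj₂ ]′ (all p)
    ; fits = λ ()
    ; only = λ p m → onlyA p m (sub (proj₂ (no∈ p)) m) }
    where
    onlyA : ∀ {K x} → K ∈ ns → x ∈ Lb K → x ∈ a ∷ b ∷ [] → x ∈ a ∷ []
    onlyA p m (here e) = here e
    onlyA {K} p m (there (here e)) = contradiction (subst (_∈ Lb K) e m) (proj₁ (no∈ p))
  ...   | record { ys = K@(_ , _ , P) ∷ ys ; ns = ns ; sums = sums ; yes∈ = yes∈ ; no∈ = no∈ ; all = all } = record
    { gs = (K , ys) ∷ [] ; rest = ns ; one = ≤-refl
    ; sums = λ q → trans (cong (_+ total q ns) (+-identityʳ _)) (sums q)
    ; from = fr
    ; to = λ p → [ (λ q → inj₁ (_ , here refl , q)) , inj₂ ]′ (all p)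
    ; fits = ft
    ; only = λ p m → onlyA p m (sub (proj₂ (no∈ p)) m) }
    where
    fr : ∀ {K′} → Mem ((K , ys) ∷ []) ns K′ → K′ ∈ Ks
    fr (inj₁ (_ , here refl , q)) = proj₂ (yes∈ q)
    fr (inj₂ p) = proj₂ (no∈ p)
    onlyA : ∀ {K x} → K ∈ ns → x ∈ Lb K → x ∈ a ∷ b ∷ [] → x ∈ a ∷ []
    onlyA p m (here e) = here e
    onlyA {K} p m (there (here e)) = contradiction (subst (_∈ Lb K) e m) (proj₁ (no∈ p))
    ft : ∀ {g K′} → g ∈ (K , ys) ∷ [] → K′ ∈ proj₂ g → Lb K′ ⊆ Lb (proj₁ g)
    ft {K′ = K′} (here refl) q m with yes∈ (there q)
    ... | b∈ , K∈ with sub K∈ m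
    ...   | there (here e) = subst (_∈ Lb K) (sym e) (proj₁ (yes∈ (here refl)))
    ...   | here e with all₀ K∈
    ...     | inj₂ r = contradiction (subst (_∈ Lb K′) e m , b∈) (proj₁ (none r))

  -- A cell that may see a label beyond those of its base heads a new group, takes in all pending
  -- cells and is paid for by the slack in the bound. Otherwise it joins the pending cells.
  close : ∀ {a : Adj u w} (L : Poly u z) (M : Poly z w) → Sorted (node a L M) (node a (cut L) (cut M)) →
          Cell (u , w , node a (cut L) (cut M)) → Sorted (node a L M) (stop a)
  close {u} {w} {z} {a} L M S K = go (few S)
    where
    K₀ : Region
    K₀ = u , w , node a (cut L) (cut M)
    K₀≤ : chR K₀ ≤ ch c (node a L M)
    K₀≤ = +-mono-≤ (cut-ch L) (cut-ch M)
    go : (Lb K₀ ⊆ c u ∷ c w ∷ [] × length (groups S) ≤ 2 * ch c (node a L M) ∸ 2) ⊎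
         suc (length (groups S)) ≤ 2 * ch c (node a L M) ∸ 2 → Sorted (node a L M) (stop a)
    go (inj₁ (sub , le)) = record
      { groups = groups S
      ; pend = K₀ ∷ pend S
      ; cells = λ { (inj₁ m) → cells S (inj₁ m) ; (inj₂ (here refl)) → K ; (inj₂ (there p)) → cells S (inj₂ p) }
      ; low = λ { (inj₁ m) → low S (inj₁ m) ; (inj₂ (here refl)) → K₀≤ ; (inj₂ (there p)) → low S (inj₂ p) }
      ; fit = fit S
      ; fitP = λ { (here refl) m → ends-labels (stop a) (sub m) ; (there p) m → ends-labels (stop a) (sub (fitP S p m)) }
      ; counts = λ q → ≤-trans (≤-reflexive (trans (+-identityʳ _) (trans (cong (gtotal q (groups S) +_) (+-comm (count q (proj₂ (proj₂ K₀))) _))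
                          (sym (+-assoc (gtotal q (groups S)) _ _))))) (counts S q)
      ; tri = λ τ → tr (tri S τ)
      ; few = inj₁ (labels-stop {a = a} , le) }
      where
      tr : ∀ {x y t} → Covered (proj₂ (proj₂ K₀)) (groups S) (pend S) x y t →
           Covered (stop a) (groups S) (K₀ ∷ pend S) x y t
      tr (inj₁ p) = inj₁ p
      tr (inj₂ (inj₁ σ)) = inj₂ (inj₂ (K₀ , inj₂ (here refl) , σ))
      tr (inj₂ (inj₂ (K , inj₁ m , σ))) = inj₂ (inj₂ (K , inj₁ m , σ))
      tr (inj₂ (inj₂ (K , inj₂ p , σ))) = inj₂ (inj₂ (K , inj₂ (there p) , σ))
    go (inj₂ le) = record
      { groups = (K₀ , pend S) ∷ groups S
      ; pend = []
      ; cells = λ m → [ cells S , (λ { refl → K }) ]′ (prior m)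
      ; low = λ m → [ low S , (λ { refl → K₀≤ }) ]′ (prior m)
      ; fit = λ { (here refl) p → fitP S p ; (there g) p → fit S g p }
      ; fitP = λ ()
      ; counts = λ q → ≤-trans (≤-reflexive (trans (+-identityʳ _) (trans (+-identityʳ _)
                   (trans (+-assoc (count q (proj₂ (proj₂ K₀))) _ _) (trans (+-comm (count q (proj₂ (proj₂ K₀))) _)
                     (cong (_+ count q (proj₂ (proj₂ K₀))) (+-comm (total q (pend S)) _)))))))
                   (counts S q)
      ; tri = λ τ → tr (tri S τ)
      ; few = inj₁ (labels-stop {a = a} , le) }
      where
      prior : ∀ {K} → Mem ((K₀ , pend S) ∷ groups S) [] K → Mem (groups S) (pend S) K ⊎ K ≡ K₀
      prior (inj₁ (_ , here refl , here e)) = inj₂ e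
      prior (inj₁ (_ , here refl , there p)) = inj₁ (inj₂ p)
      prior (inj₁ (g , there p , m)) = inj₁ (inj₁ (g , p , m))
      tr : ∀ {x y t} → Covered (proj₂ (proj₂ K₀)) (groups S) (pend S) x y t →
           Covered (stop a) ((K₀ , pend S) ∷ groups S) [] x y t
      tr (inj₁ p) = inj₁ p
      tr (inj₂ (inj₁ σ)) = inj₂ (inj₂ (K₀ , inj₁ (_ , here refl , here refl) , σ))
      tr (inj₂ (inj₂ (K , inj₁ (g , p , m) , σ))) = inj₂ (inj₂ (K , inj₁ (g , there p , m) , σ))
      tr (inj₂ (inj₂ (K , inj₂ p , σ))) = inj₂ (inj₂ (K , inj₁ (_ , here refl , there p) , σ))

  -- Beyond a triangle with three labelled corners only the labels of its base remain in sight. If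
  -- the apex brings a third label, pending cells seeing it can wait no longer and form at most one
  -- group on each side, paid for by `twice-sum₂`. `pick` gets the end of the base first, so what is
  -- left on each side sees just this end.
  flat : ∀ {a : Adj u w} {a₁ : Adj u z} {a₂ : Adj z w} (L : Poly u z) (M : Poly z w) → U u → U z → U w →
         Sorted L (stop a₁) → Sorted M (stop a₂) → Sorted (node a L M) (stop a)
  flat {u} {w} {z} {a} {a₁} {a₂} L M uu uz uw S R = go (c u ≟ c z) (c z ≟ c w)
    where
    X : Sorted (node a L M) (node a (stop a₁) (stop a₂))
    X = merge S R
    len : length (groups X) ≤ 2 * ch c (node a L M) ∸ 2
    len = few-all X
    same : labels c (node a (stop a₁) (stop a₂)) ⊆ c u ∷ c w ∷ [] → Sorted (node a L M) (stop a)
    same sub = record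
      { groups = groups X ; pend = pend X ; cells = cells X ; low = low X ; fit = fit X
      ; fitP = λ p m → ends-labels (stop a) (sub (fitP X p m))
      ; counts = counts X
      ; tri = λ τ → tr (tri X τ)
      ; few = inj₁ (labels-stop {a = a} , len) }
      where
      tr : ∀ {x y t} → Covered (node a (stop a₁) (stop a₂)) (groups X) (pend X) x y t →
           Covered (stop a) (groups X) (pend X) x y t
      tr (inj₁ p) = inj₁ p
      tr (inj₂ (inj₁ top)) = inj₁ (uu , uz , uw)
      tr (inj₂ (inj₂ m)) = inj₂ (inj₂ m)
    go : Dec (c u ≡ c z) → Dec (c z ≡ c w) → Sorted (node a L M) (stop a)
    go (yes e) _ = same λ m → [ (λ r → pair-⊆ (here refl) (here (sym e)) (labels-stop {a = a₁} r))
                              , (λ r → pair-⊆ (here (sym e)) (there (here refl)) (labels-stop {a = a₂} r)) ]′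
                              (labels-node {a = a} (stop a₁) (stop a₂) m)
    go (no _) (yes e) = same λ m → [ (λ r → pair-⊆ (here refl) (there (here e)) (labels-stop {a = a₁} r))
                                   , (λ r → pair-⊆ (there (here e)) (there (here refl)) (labels-stop {a = a₂} r)) ]′
                                   (labels-node {a = a} (stop a₁) (stop a₂) m)
    go (no n) (no n′) = record
      { groups = (gs PL ++ gs PR) ++ groups X
      ; pend = rest PL ++ rest PR
      ; cells = λ m → cells X (prior m)
      ; low = λ m → low X (prior m)
      ; fit = ft
      ; fitP = λ p m → ends-labels (stop a) ([ (λ q → one-of (only PL q m) (here refl)) , (λ q → one-of (only PR q m) (there (here refl))) ]′ (∈-++⁻ (rest PL) p))
      ; counts = λ q → ≤-trans (≤-reflexive (cnt q)) (counts X q)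
      ; tri = λ τ → tr (tri X τ)
      ; few = inj₁ (labels-stop {a = a} , ≤-trans (≤-reflexive (trans (length-++ (gs PL ++ gs PR)) (cong₂ _+_ (length-++ (gs PL)) (length-++ (groups S)))))
               (≤-trans (+-mono-≤ (+-mono-≤ (one PL) (one PR)) (+-mono-≤ (few-all S) (few-all R))) (twice-sum₂ (c-≢ L n) (c-≢ M n′)))) }
      where
      open Picked
      PL : Picked (c u) (c z) (pend S)
      PL = pick (c u) (c z) (pend S) λ p m → labels-stop {a = a₁} (fitP S p m)
      PR : Picked (c w) (c z) (pend R)
      PR = pick (c w) (c z) (pend R) λ p m → pair-⊆ (there (here refl)) (here refl) (labels-stop {a = a₂} (fitP R p m))
      one-of : ∀ {x y} {xs : List V} → x ∈ y ∷ [] → y ∈ xs → x ∈ xs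
      one-of (here refl) p = p
      prior : ∀ {K} → Mem ((gs PL ++ gs PR) ++ groups X) (rest PL ++ rest PR) K → Mem (groups X) (pend X) K
      prior (inj₁ (g , p , m)) with ∈-++⁻ (gs PL ++ gs PR) p
      ... | inj₂ q = inj₁ (g , q , m)
      ... | inj₁ q with ∈-++⁻ (gs PL) q
      ...   | inj₁ r = inj₂ (∈-++⁺ˡ (from PL (inj₁ (g , r , m))))
      ...   | inj₂ r = inj₂ (∈-++⁺ʳ (pend S) (from PR (inj₁ (g , r , m))))
      prior (inj₂ p) with ∈-++⁻ (rest PL) p
      ... | inj₁ r = inj₂ (∈-++⁺ˡ (from PL (inj₂ r)))
      ... | inj₂ r = inj₂ (∈-++⁺ʳ (pend S) (from PR (inj₂ r)))
      new : ∀ {K} → Mem (groups X) (pend X) K → Mem ((gs PL ++ gs PR) ++ groups X) (rest PL ++ rest PR) K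
      new (inj₁ (g , p , m)) = inj₁ (g , ∈-++⁺ʳ (gs PL ++ gs PR) p , m)
      new (inj₂ p) with ∈-++⁻ (pend S) p
      new (inj₂ p) | inj₁ q with to PL q
      ... | inj₁ (g , r , m) = inj₁ (g , ∈-++⁺ˡ (∈-++⁺ˡ r) , m)
      ... | inj₂ r = inj₂ (∈-++⁺ˡ r)
      new (inj₂ p) | inj₂ q with to PR q
      ... | inj₁ (g , r , m) = inj₁ (g , ∈-++⁺ˡ (∈-++⁺ʳ (gs PL) r) , m)
      ... | inj₂ r = inj₂ (∈-++⁺ʳ (rest PL) r)
      ft : ∀ {g K} → g ∈ (gs PL ++ gs PR) ++ groups X → K ∈ proj₂ g → Lb K ⊆ Lb (proj₁ g)
      ft p with ∈-++⁻ (gs PL ++ gs PR) p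
      ... | inj₂ q = fit X q
      ... | inj₁ q = [ fits PL , fits PR ]′ (∈-++⁻ (gs PL) q)
      cnt : ∀ q → gtotal q ((gs PL ++ gs PR) ++ groups X) + total q (rest PL ++ rest PR) + 0 ≡
                  gtotal q (groups X) + total q (pend X) + (0 + 0)
      cnt q = cong (_+ 0) (begin
        gtotal q ((gs PL ++ gs PR) ++ groups X) + total q (rest PL ++ rest PR)
          ≡⟨ cong₂ _+_ (trans (gtotal-++ q (gs PL ++ gs PR) _) (cong (_+ gtotal q (groups X)) (gtotal-++ q (gs PL) _))) (total-++ q (rest PL) _) ⟩
        ((gtotal q (gs PL) + gtotal q (gs PR)) + gtotal q (groups X)) + (total q (rest PL) + total q (rest PR))
          ≡⟨ solve 5 (λ a b x e f → ((a :+ b) :+ x) :+ (e :+ f) := x :+ ((a :+ e) :+ (b :+ f))) refl (gtotal q (gs PL)) _ _ _ _ ⟩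
        gtotal q (groups X) + ((gtotal q (gs PL) + total q (rest PL)) + (gtotal q (gs PR) + total q (rest PR)))
          ≡⟨ cong (gtotal q (groups X) +_) (cong₂ _+_ (sums PL q) (sums PR q)) ⟩
        gtotal q (groups X) + (total q (pend S) + total q (pend R))
          ≡⟨ cong (gtotal q (groups X) +_) (sym (total-++ q (pend S) _)) ⟩
        gtotal q (groups X) + total q (pend X) ∎)
        where
        open ≡-Reasoning
        open +-*-Solver
      tr : ∀ {x y t} → Covered (node a (stop a₁) (stop a₂)) (groups X) (pend X) x y t →
           Covered (stop a) ((gs PL ++ gs PR) ++ groups X) (rest PL ++ rest PR) x y t
      tr (inj₁ p) = inj₁ p
      tr (inj₂ (inj₁ top)) = inj₁ (uu , uz , uw)
      tr (inj₂ (inj₂ (K , m , σ))) = inj₂ (inj₂ (K , new m , σ))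

  private
    bare : (P Q : Poly u w) → (∀ q → count q Q ≤ count q P) → (∀ {x y t} → ¬ Tri P x y t) → labels c Q ⊆ c u ∷ c w ∷ [] → Sorted P Q
    bare P Q le no-tri sub = record
      { groups = [] ; pend = [] ; cells = λ { (inj₁ (_ , () , _)) ; (inj₂ ()) } ; low = λ { (inj₁ (_ , () , _)) ; (inj₂ ()) }
      ; fit = λ () ; fitP = λ () ; counts = le ; tri = λ τ → contradiction τ no-tri ; few = inj₁ (sub , z≤n) }

    ends-only : {P : Poly u w} → (∀ {v} → Corner P v → v ≡ u ⊎ v ≡ w) → labels c P ⊆ c u ∷ c w ∷ []
    ends-only {P = P} f = labels-sub {P = P} λ v p → [ (λ { refl → here refl }) , (λ { refl → there (here refl) }) ]′ (f p)

  sorted : (P : Poly u w) → Stops U P → Sorted P (cut P)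
  sorted {u} {w} P s with UU? u w
  sorted P@(up _ _) s | yes _ = bare P _ (λ _ → z≤n) (λ ()) (ends-only {P = stop (base-adj P)} (λ p → p))
  sorted P@(down _ _) s | yes _ = bare P _ (λ _ → z≤n) (λ ()) (ends-only {P = stop (base-adj P)} (λ p → p))
  sorted P@(stop _) s | yes _ = bare P _ (λ _ → z≤n) (λ ()) (ends-only {P = stop (base-adj P)} (λ p → p))
  sorted P@(up _ _) s | no _ = bare P P (λ _ → ≤-refl) (λ ()) (ends-only {P = P} (λ p → p))
  sorted P@(down _ _) s | no _ = bare P P (λ _ → ≤-refl) (λ ()) (ends-only {P = P} (λ p → p))
  sorted P@(stop _) s | no _ = bare P P (λ _ → ≤-refl) (λ ()) (ends-only {P = P} (λ p → p))
  sorted (node a L M) (sL , sM) | no _ = merge (sorted L sL) (sorted M sM)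
  sorted (node {z = z} a L M) (sL , sM) | yes (uu , uw) = go (U? z)
    where
    go : Dec (U z) → Sorted (node a L M) (stop a)
    go (no nz) = close L M (merge (sorted L sL) (sorted M sM)) (cell L M uu uw nz sL sM)
    go (yes uz) = flat L M uu uz uw (subst (Sorted L) (cut-yes L uu uz) (sorted L sL))
                                    (subst (Sorted M) (cut-yes M uz uw) (sorted M sM))

  record Grouped (P : Poly u w) : Set where
    field
      groups : List Group
      cells  : ∀ {K} → InGroup groups K → Cell K
      low    : ∀ {K} → InGroup groups K → chR K ≤ ch c P
      fit    : ∀ {g K} → g ∈ groups → K ∈ proj₂ g → Lb K ⊆ Lb (proj₁ g)
      counts : ∀ q → gtotal q groups ≤ count q P
      tri    : ∀ {x y t} → Tri P x y t → AllU x y t ⊎ (∃ λ K → InGroup groups K × TriIn K x y t)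
      few    : length groups ≤ 2 * ch c P ∸ 2 + 2

  -- What is still pending sees only the labels of the two ends of `P`: one group comes from `pick`,
  -- and one more takes the cells whose only label is that of `u`.
  grouped : (P : Poly u w) → Anchored st P → Grouped P
  grouped {u} {w} P (anchored uu uw s) = finish (pick (c u) (c w) (pend S) λ p m → labels-stop {a = base-adj P} (fitP S p m))
    where
    S : Sorted P (stop (base-adj P))
    S = subst (Sorted P) (cut-yes P uu uw) (sorted P s)
    finish : Picked (c u) (c w) (pend S) → Grouped P
    finish record { gs = gs ; rest = rest ; one = one ; sums = sums ; from = from ; to = to ; fits = fits ; only = only } = record
      { groups = hs ++ (gs ++ groups S)
      ; cells = λ m → cells S (prior m)
      ; low = λ m → low S (prior m)
      ; fit = λ p → [ hfit , (λ q → [ fits , fit S ]′ (∈-++⁻ gs q)) ]′ (∈-++⁻ hs p)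
      ; counts = λ q → ≤-trans (≤-reflexive (cnt q)) (counts S q)
      ; tri = λ τ → tr (tri S τ)
      ; few = ≤-trans (≤-reflexive (trans (length-++ hs) (cong (length hs +_) (length-++ gs))))
                (≤-trans (+-mono-≤ (hone rest) (+-mono-≤ one (few-all S))) (≤-reflexive (+-comm 2 _))) }
      where
      heads : List Region → List Group
      heads []       = []
      heads (K ∷ Ks) = (K , Ks) ∷ []
      hs : List Group
      hs = heads rest
      hone : ∀ Ks → length (heads Ks) ≤ 1
      hone []      = z≤n
      hone (_ ∷ _) = ≤-refl
      htotal : ∀ q Ks → gtotal q (heads Ks) ≡ total q Ks
      htotal q [] = refl
      htotal q (K ∷ Ks) = +-identityʳ _
      hfrom : ∀ {Ks K} → InGroup (heads Ks) K → K ∈ Ks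
      hfrom {_ ∷ _} (_ , here refl , m) = m
      hto : ∀ {Ks K} → K ∈ Ks → InGroup (heads Ks) K
      hto {_ ∷ _} p = _ , here refl , p
      hfit′ : ∀ {Ks} → (∀ {K} → K ∈ Ks → Lb K ⊆ c u ∷ []) → ∀ {g K} → g ∈ heads Ks → K ∈ proj₂ g → Lb K ⊆ Lb (proj₁ g)
      hfit′ {K₀ ∷ Ks} f (here refl) p m with f (there p) m | f (here refl) (here refl)
      ... | here refl | here e = here (sym e)
      hfit : ∀ {g K} → g ∈ hs → K ∈ proj₂ g → Lb K ⊆ Lb (proj₁ g)
      hfit = hfit′ only
      prior : ∀ {K} → InGroup (hs ++ (gs ++ groups S)) K → Mem (groups S) (pend S) K
      prior (g , p , m) with ∈-++⁻ hs p
      ... | inj₁ q = inj₂ (from (inj₂ (hfrom (g , q , m))))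
      ... | inj₂ q with ∈-++⁻ gs q
      ...   | inj₁ r = inj₂ (from (inj₁ (g , r , m)))
      ...   | inj₂ r = inj₁ (g , r , m)
      new : ∀ {K} → Mem (groups S) (pend S) K → InGroup (hs ++ (gs ++ groups S)) K
      new (inj₁ (g , p , m)) = g , ∈-++⁺ʳ hs (∈-++⁺ʳ gs p) , m
      new (inj₂ p) with to p
      ... | inj₁ (g , q , m) = g , ∈-++⁺ʳ hs (∈-++⁺ˡ q) , m
      ... | inj₂ q = let g , r , m = hto q in g , ∈-++⁺ˡ r , m
      cnt : ∀ q → gtotal q (hs ++ (gs ++ groups S)) ≡ gtotal q (groups S) + total q (pend S) + 0
      cnt q = begin
        gtotal q (hs ++ (gs ++ groups S)) ≡⟨ trans (gtotal-++ q hs _) (cong₂ _+_ (htotal q rest) (gtotal-++ q gs _)) ⟩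
        total q rest + (gtotal q gs + gtotal q (groups S))
          ≡⟨ solve 3 (λ a b e → a :+ (b :+ e) := e :+ (b :+ a) :+ con 0) refl (total q rest) (gtotal q gs) (gtotal q (groups S)) ⟩
        gtotal q (groups S) + (gtotal q gs + total q rest) + 0 ≡⟨ cong (λ s → gtotal q (groups S) + s + 0) (sums q) ⟩
        gtotal q (groups S) + total q (pend S) + 0 ∎
        where
        open ≡-Reasoning
        open +-*-Solver
      tr : ∀ {x y t} → Covered (stop (base-adj P)) (groups S) (pend S) x y t →
           AllU x y t ⊎ (∃ λ K → InGroup (hs ++ (gs ++ groups S)) K × TriIn K x y t)
      tr (inj₁ p) = inj₁ p
      tr (inj₂ (inj₁ ()))
      tr (inj₂ (inj₂ (K , m , σ))) = inj₂ (K , new m , σ)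

-- Lists as subsets.

∣∪∣-≤ : ∀ {n} (p q : Subset n) → ∣ p ∪ q ∣ ≤ ∣ p ∣ + ∣ q ∣
∣∪∣-≤ [] [] = z≤n
∣∪∣-≤ (false ∷ p) (false ∷ q) = ∣∪∣-≤ p q
∣∪∣-≤ (true ∷ p) (false ∷ q)  = s≤s (∣∪∣-≤ p q)
∣∪∣-≤ (false ∷ p) (true ∷ q)  = ≤-trans (s≤s (∣∪∣-≤ p q)) (≤-reflexive (sym (+-suc _ _)))
∣∪∣-≤ (true ∷ p) (true ∷ q)   = s≤s (≤-trans (∣∪∣-≤ p q) (+-monoʳ-≤ ∣ p ∣ (n≤1+n _)))

toSubset : ∀ {n} → List (Fin n) → Subset n
toSubset []       = ∅
toSubset (x ∷ xs) = ⁅ x ⁆ ∪ toSubset xs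

∣toSubset∣ : ∀ {n} (xs : List (Fin n)) → ∣ toSubset xs ∣ ≤ length xs
∣toSubset∣ {n} [] = ≤-reflexive (∣⊥∣≡0 n)
∣toSubset∣ (x ∷ xs) = ≤-trans (∣∪∣-≤ ⁅ x ⁆ (toSubset xs)) (+-mono-≤ (≤-reflexive (∣⁅x⁆∣≡1 x)) (∣toSubset∣ xs))

∈-toSubset⁺ : ∀ {n} {x : Fin n} {xs} → x ∈ xs → x ∈ˢ toSubset xs
∈-toSubset⁺ {x = x} (here refl) = x∈p∪q⁺ (inj₁ (x∈⁅x⁆ x))
∈-toSubset⁺ (there p) = x∈p∪q⁺ (inj₂ (∈-toSubset⁺ p))

∈-toSubset⁻ : ∀ {n} {x : Fin n} xs → x ∈ˢ toSubset xs → x ∈ xs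
∈-toSubset⁻ [] p = contradiction p ∉⊥
∈-toSubset⁻ (y ∷ xs) p with x∈p∪q⁻ ⁅ y ⁆ (toSubset xs) p
... | inj₁ q = here (x∈⁅y⁆⇒x≡y y q)
... | inj₂ q = there (∈-toSubset⁻ xs q)

lookup-injective : ∀ {A : Set} {xs : List A} → Unique xs → ∀ i j → lookup xs i ≡ lookup xs j → i ≡ j
lookup-injective (_ ∷ _) zero zero _ = refl
lookup-injective (x ∷ _) zero (suc j) e = contradiction e (All.lookup x (∈-lookup j))
lookup-injective (x ∷ _) (suc i) zero e = contradiction (sym e) (All.lookup x (∈-lookup i))
lookup-injective (_ ∷ u) (suc i) (suc j) e = cong suc (lookup-injective u i j e)

-- The first paths, and the children of the root bag.

module Assembly {N : ℕ} {Adj : Fin N → Fin N → Set} (T : BFSTree N Adj)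
                (Adj-sym : ∀ {u w} → Adj u w → Adj w u) where
  open BFSTree T
  open Ancestry T
  open Cutting T Adj-sym
  open Peeling T Adj-sym
  open RootBag T Adj-sym
  open Decomposition V
  open State

  private variable
    u w : V
    m : ℕ

  add-all : ∀ st zs → ∃ λ st′ → Ext st st′ × (∀ {z} → z ∈ zs → U st′ z) ×
            length (Z st′) ≤ length zs + length (Z st) ×
            (∀ {u w} (P : Poly u w) → (∀ q → count q P ≤ 2) → treeCh (c st′) P ≤ treeCh (c st) P + 2 * length zs)
  add-all st [] = st , ext-refl , (λ ()) , ≤-refl , λ P _ → m≤m+n _ _
  add-all st (z ∷ zs) with add st z
  ... | st₁ , a with add-all st₁ zs
  ...   | st₂ , e , zU , len , tc = st₂ , ext-trans (add-ext a) e ,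
            (λ { (here refl) → Ext.U-mono e (add-U a) ; (there p) → zU p }) ,
            ≤-trans len (≤-trans (+-monoʳ-≤ (length zs) (add-length a)) (≤-reflexive (+-suc _ _))) ,
            λ P k → ≤-trans (tc P k) (≤-trans (+-monoˡ-≤ _ (one a P k)) (≤-reflexive
              (trans (+-assoc (treeCh (c st) P) 2 _) (cong (treeCh (c st) P +_) (sym (*-suc 2 (length zs)))))))
    where
    one : ∀ {st₁} → Add st z st₁ → ∀ {u w} (P : Poly u w) → (∀ q → count q P ≤ 2) → treeCh (c st₁) P ≤ treeCh (c st) P + 2
    one (old _) P k = m≤m+n _ _
    one (fresh q f) P k = ≤-trans (Below.tree-changes q (Fresh.inX f) (Fresh.outX f) P) (+-monoʳ-≤ _ (k q))

  ch-split : ∀ κ (P : Poly u w) → ch κ P ≤ treeCh κ P + stopCount P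
  ch-split κ (up _ _) = ≤-reflexive (sym (+-identityʳ _))
  ch-split κ (down _ _) = ≤-reflexive (sym (+-identityʳ _))
  ch-split κ (stop _) = δ≤1 _ _
  ch-split κ (node _ L M) = ≤-trans (+-mono-≤ (ch-split κ L) (ch-split κ M)) (≤-reflexive
    (solve 4 (λ a b e f → (a :+ b) :+ (e :+ f) := (a :+ e) :+ (b :+ f)) refl (treeCh κ L) (stopCount L) _ _))
    where open +-*-Solver

  treeCh-const : ∀ a (P : Poly u w) → treeCh (λ _ → a) P ≡ 0
  treeCh-const a (up _ _) = δ-refl a
  treeCh-const a (down _ _) = δ-refl a
  treeCh-const a (stop _) = refl
  treeCh-const a (node _ L M) = cong₂ _+_ (treeCh-const a L) (treeCh-const a M)

  module _ (st : State) where
    open Cells T Adj-sym st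

    record Plan (rs : List (Region × ℕ)) : Set where
      field
        gs     : List Group
        cells  : ∀ {K} → InGroup gs K → Cell K × chR K ≤ 5
        fit    : ∀ {g K} → g ∈ gs → K ∈ proj₂ g → Lb K ⊆ Lb (proj₁ g)
        counts : ∀ q → gtotal q gs ≤ total q (regs rs)
        few    : length gs ≤ budget rs
        tri    : ∀ {r x y t} → r ∈ rs → TriIn (proj₁ r) x y t → AllU x y t ⊎ (∃ λ K → InGroup gs K × TriIn K x y t)

    private
      -- At `s = 0` truncated subtraction makes the left side 2 rather than 0. For this reason the
      -- bounds of the pieces are kept at least one.
      group-bound : ∀ s n → s ≤ n → 1 ≤ n → 2 * s ∸ 2 + 2 ≤ 2 * n
      group-bound zero (suc n) _ _ = ≤-trans (m≤m+n 2 (2 * n)) (≤-reflexive (sym (*-suc 2 n)))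
      group-bound (suc s) n p _ = ≤-trans (≤-reflexive (m∸n+n≡m (≤-trans (m≤m+n 2 (2 * s)) (≤-reflexive (sym (*-suc 2 s)))))) (*-monoʳ-≤ 2 p)

    plan : ∀ rs → (∀ {r} → r ∈ rs → Bounded st r) → Plan rs
    plan [] _ = record { gs = [] ; cells = λ { (_ , () , _) } ; fit = λ () ; counts = λ _ → z≤n ; few = z≤n ; tri = λ () }
    plan (((u , w , P) , s) ∷ rs) b = record
      { gs = G.groups ++ R.gs
      ; cells = λ (g , p , m) → [ (λ q → G.cells (g , q , m) , ≤-trans (G.low (g , q , m)) (≤-trans (Bounded.ch≤ b₀) (Bounded.high b₀)))
                                , (λ q → R.cells (g , q , m)) ]′ (∈-++⁻ G.groups p)
      ; fit = λ p → [ G.fit , R.fit ]′ (∈-++⁻ G.groups p)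
      ; counts = λ q → ≤-trans (≤-reflexive (gtotal-++ q G.groups R.gs)) (+-mono-≤ (G.counts q) (R.counts q))
      ; few = ≤-trans (≤-reflexive (length-++ G.groups))
                (+-mono-≤ (≤-trans G.few (group-bound _ s (Bounded.ch≤ b₀) (Bounded.low b₀))) R.few)
      ; tri = λ { (here refl) τ → [ inj₁ , (λ (K , (g , p , m) , σ) → inj₂ (K , (g , ∈-++⁺ˡ p , m) , σ)) ]′ (G.tri τ)
                ; (there r) τ → [ inj₁ , (λ (K , (g , p , m) , σ) → inj₂ (K , (g , ∈-++⁺ʳ G.groups p , m) , σ)) ]′ (R.tri r τ) } }
      where
      b₀ = b (here refl)
      module G = Grouped (grouped P (Bounded.anch b₀))
      module R = Plan (plan rs (b ∘ there))

    record Kids (gs : List Group) : Set where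
      field
        {nodes}  : ℕ
        d        : TDec nodes
        items    : List (Item nodes)
        proc     : Proc st d items
        rootbag  : bag d (rt d) ≡ Z st
        items≡   : ∀ q → total q (regions items) ≡ gtotal q gs
        child    : ∀ {c} → Child d c → ∃ λ g → g ∈ gs × bag d c ≡ Lb (proj₁ g) × (proj₁ g , c) ∈ items
        kids     : List (Fin nodes)
        kids-len : length kids ≡ length gs
        kids-all : ∀ {c} → Child d c → c ∈ kids
        placed   : ∀ {K} → InGroup gs K → ∃ λ j → (K , j) ∈ items

    kids-of : ∀ gs → (∀ {K} → InGroup gs K → Cell K × chR K ≤ 5) →
              (∀ {g K} → g ∈ gs → K ∈ proj₂ g → Lb K ⊆ Lb (proj₁ g)) → (∀ q → gtotal q gs ≤ 2) → Kids gs
    kids-of [] _ _ _ = record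
      { d = single (Z st) ; items = []
      ; proc = record { bags⊆Z = λ _ p → p ; small = λ { zero n → contradiction refl n } ; planar = λ _ → z≤n ; good = λ () }
      ; rootbag = refl ; items≡ = λ _ → refl ; child = λ { {zero} (n , _) → contradiction refl n }
      ; kids = [] ; kids-len = refl ; kids-all = λ { {zero} (n , _) → contradiction refl n } ; placed = λ { (_ , () , _) } }
    kids-of (g@(r@(ru , rw , R) , fs) ∷ gs) cs ft tot = record
      { d = d′ ; items = items′
      ; proc = record
          { bags⊆Z = λ { zero p → labels⊆Z p ; (suc t) p → Proc.bags⊆Z KS.proc t p }
          ; small = λ { zero _ → ≤-trans (≤-reflexive (labels-length (c st) R)) (≤-trans (s≤s (proj₂ (cs (g , here refl , here refl)))) (m≤m+n 6 2))
                      ; (suc t) n → Proc.small KS.proc t (n ∘ cong suc) }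
          ; planar = λ q → ≤-trans (≤-reflexive (eqs q)) (tot q)
          ; good = gd }
      ; rootbag = KS.rootbag
      ; items≡ = eqs
      ; child = ch′
      ; kids = zero ∷ map suc KS.kids
      ; kids-len = cong suc (trans (length-map suc KS.kids) KS.kids-len)
      ; kids-all = λ { {zero} _ → here refl ; {suc c} (n , e) → there (∈-map⁺ suc (KS.kids-all (n ∘ cong suc , Finₚ.suc-injective e))) }
      ; placed = λ { (_ , here refl , m) → zero , ∈-++⁺ˡ (∈-map⁺ (_, zero) m)
                   ; (g′ , there p , m) → let j , q = KS.placed (g′ , p , m) in suc j , ∈-++⁺ʳ (map (_, zero) (r ∷ fs)) (∈-map⁺ lift q) } }
      where
      module KS = Kids (kids-of gs (λ (g′ , p , m) → cs (g′ , there p , m)) (ft ∘ there) (λ q → ≤-trans (m≤n+m _ (total q (r ∷ fs))) (tot q)))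
      labels⊆Z : ∀ {x} → x ∈ Lb r → x ∈ Z st
      labels⊆Z p = let v , _ , e = labels-corner (c st) R p in subst (_∈ Z st) (sym e) (c∈Z st v)
      d′ : TDec (suc KS.nodes)
      d′ = grow KS.d (rt KS.d) (Lb r) λ x p → inj₁ (subst (x ∈_) (sym KS.rootbag) (labels⊆Z p))
      items′ : List (Item (suc KS.nodes))
      items′ = map (_, zero) (r ∷ fs) ++ map lift KS.items
      eqs : ∀ q → total q (regions items′) ≡ gtotal q (g ∷ gs)
      eqs q = trans (cong (total q) (regions-++ (r ∷ fs) KS.items))
                (trans (total-++ q (r ∷ fs) (regions KS.items)) (cong (total q (r ∷ fs) +_) (KS.items≡ q)))
      sub : ∀ {K} → K ∈ r ∷ fs → Lb K ⊆ Lb r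
      sub (here refl) p = p
      sub (there q) = ft (here refl) q
      gd : ∀ {u w} {P : Poly u w} {i} → ((u , w , P) , i) ∈ items′ → Good st d′ P i
      gd {P = P} p with ∈-++⁻ (map (_, zero) (r ∷ fs)) p
      ... | inj₁ q with ∈-map⁻ (_, zero) q
      ...   | _ , s , refl = let cl , le = cs (g , here refl , s) in record
                { anch = Cell.anch cl ; fine = short le ; onbag = λ v cv → sub s (labels-all (c st) P cv) ; nonrt = λ () }
      gd p | inj₂ q with ∈-map⁻ lift q
      ... | _ , s , refl = let G = Proc.good KS.proc s in record
                { anch = Good.anch G ; fine = Good.fine G ; onbag = Good.onbag G ; nonrt = λ e → Good.nonrt G (Finₚ.suc-injective e) }
      ch′ : ∀ {c} → Child d′ c → ∃ λ g′ → g′ ∈ g ∷ gs × bag d′ c ≡ Lb (proj₁ g′) × (proj₁ g′ , c) ∈ items′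
      ch′ {zero} _ = g , here refl , refl , here refl
      ch′ {suc c} (n , e) = let g′ , p , b , q = KS.child (n ∘ cong suc , Finₚ.suc-injective e) in
        g′ , there p , b , ∈-++⁺ʳ (map (_, zero) (r ∷ fs)) (∈-map⁺ lift q)

  Touches : V → V → V → V → Set
  Touches v x y t = v ≡ x ⊎ v ≡ y ⊎ v ≡ t

  -- The parameter will be `2g − 1`. The base takes one of the at most `2g` sides outside the tree,
  -- and one of their at most `2g` ends is singled out as `z₁` to start the first path. `degree`
  -- puts every vertex on an edge and thus, in the end, on a path.
  record Polygon (k : ℕ) : Set where
    field
      {ul ur} : V
      P₀      : Poly ul ur
      z₁      : V
      zs      : List V
      left∈   : ul ∈ z₁ ∷ zs
      right∈  : ur ∈ z₁ ∷ zs
      stops∈  : Stops (_∈ z₁ ∷ zs) P₀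
      twice   : ∀ q → count q P₀ ≤ 2
      stops≤  : stopCount P₀ ≤ k
      zs≤     : length zs ≤ k
      edges   : ∀ {v v′} → Adj v v′ → ∃ λ x → ∃₂ λ y t → Tri P₀ x y t × Touches v x y t × Touches v′ x y t
      degree  : ∀ v → ∃ λ v′ → Adj v v′

-- Reading off the partition, the decomposition and its properties.

module Conclusion {N g : ℕ} (Δ : Triangulation N g) (T : BFSTree N (Triangulation.Adj Δ))
                  (Adj-sym : ∀ {u w} → Triangulation.Adj Δ u w → Triangulation.Adj Δ w u)
                  {k : ℕ} (I : Assembly.Polygon T Adj-sym k) (st : Ancestry.State T) where
  open Triangulation Δ using (Adj)
  open BFSTree T
  open Ancestry T
  open Cutting T Adj-sym
  open Peeling T Adj-sym
  open RootBag T Adj-sym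
  open Assembly T Adj-sym
  open Decomposition V
  open State
  open Polygon I
  open Cells T Adj-sym st

  module Finish {gs : List Group}
                (cells : ∀ {K} → InGroup gs K → Cell K × chR K ≤ 5)
                (cover : ∀ {x y t} → Tri P₀ x y t → AllU x y t ⊎ (∃ λ K → InGroup gs K × TriIn K x y t))
                (kids : Kids st gs) (end : Final st (Kids.d kids) (Kids.items kids))
                (root≤ : length (Z st) ≤ 6 ⊔ (32 * g ∸ 27))
                (kids≤ : length gs ≤ 6 * (1 ⊔ (18 * g ∸ 21))) where

    module Ki = Kids kids

    open Final end using (m′; st′; d′; proc)
    module Ev = Evolves (Final.evolves end)

    root-bag : bag d′ (rt d′) ≡ Z st
    root-bag = trans (cong (bag d′) (sym (emb-rt Ev.into))) (trans (emb-bag Ev.into (rt Ki.d)) Ki.rootbag)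

    done : ∀ {K j x y t} → (K , j) ∈ Ki.items → TriIn K x y t → Done st′ d′ (emb Ev.into j) x y t
    done p τ with Ev.cov (inj₂ (_ , _ , _ , _ , p , (0 , refl) , τ))
    ... | inj₁ q = q
    ... | inj₂ (_ , _ , _ , _ , () , _)

    tri-done : ∀ {x y t} → Tri P₀ x y t → ∃ λ s → Lab st′ d′ s x × Lab st′ d′ s y × Lab st′ d′ s t
    tri-done τ with cover τ
    ... | inj₁ (a , b , e) = rt d′ , lab a , lab b , lab e
      where
      lab : ∀ {x} → U st x → Lab st′ d′ (rt d′) x
      lab {x} u = Ext.U-mono Ev.ext u , subst (_ ∈_) (sym root-bag) (subst (_∈ Z st) (sym (Ext.c-stay Ev.ext u)) (c∈Z st x))
    ... | inj₂ (K , m , σ) = let j , q = Ki.placed m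
                                 s , _ , r = done q σ in s , r

    pick-lab : ∀ {s v x y t} → Touches v x y t → Lab st′ d′ s x × Lab st′ d′ s y × Lab st′ d′ s t → Lab st′ d′ s v
    pick-lab (inj₁ refl) (p , _) = p
    pick-lab (inj₂ (inj₁ refl)) (_ , p , _) = p
    pick-lab (inj₂ (inj₂ refl)) (_ , _ , p) = p

    edge-lab : ∀ {v v′} → Adj v v′ → ∃ λ s → Lab st′ d′ s v × Lab st′ d′ s v′
    edge-lab e = let _ , _ , _ , τ , i , j = edges e
                     s , q = tri-done τ in s , pick-lab i q , pick-lab j q

    all-U : ∀ v → U st′ v
    all-U v = proj₁ (proj₁ (proj₂ (edge-lab (proj₂ (degree v)))))

    path : V → Fin (length (Z st′))
    path v = index (c∈Z st′ v)

    path-c : ∀ v → c st′ v ≡ lookup (Z st′) (path v)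
    path-c v = lookup-index (c∈Z st′ v)

    path-≡ : ∀ {v i} → c st′ v ≡ lookup (Z st′) i → path v ≡ i
    path-≡ {v} {i} e = lookup-injective (unique st′) _ i (trans (sym (path-c v)) e)

    path-inj : ∀ {v v′} → path v ≡ path v′ → c st′ v ≡ c st′ v′
    path-inj {v} {v′} e = trans (path-c v) (trans (cong (lookup (Z st′)) e) (sym (path-c v′)))

    path-cong : ∀ {v v′} → c st′ v ≡ c st′ v′ → path v ≡ path v′
    path-cong {v} {v′} e = path-≡ (trans e (path-c v′))

    partition : VerticalPartition T
    partition = record
      { p = length (Z st′)
      ; path = path
      ; vertical = λ i → let k , le , f = class st′ (∈-lookup {xs = Z st′} i) in
          lookup (Z st′) i , k , le , λ v →
            (λ e → proj₁ (f v) (all-U v , trans (path-c v) (cong (lookup (Z st′)) e))) ,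
            (λ e → path-≡ (proj₂ (proj₂ (f v) e))) }

    bagₛ : Fin m′ → Subset (length (Z st′))
    bagₛ t = toSubset (map path (bag d′ t))

    in-bag : ∀ {v t} → c st′ v ∈ bag d′ t → path v ∈ˢ bagₛ t
    in-bag {v} {t} p = ∈-toSubset⁺ (subst (_∈ map path (bag d′ t))
      (path-cong (c-bottom st′ (c∈Z st′ v))) (∈-map⁺ path p))

    of-bag : ∀ {i t} → i ∈ˢ bagₛ t → ∃ λ z → z ∈ bag d′ t × c st′ z ≡ z × i ≡ path z
    of-bag {i} {t} p = let z , q , e = ∈-map⁻ path (∈-toSubset⁻ _ p) in z , q , c-bottom st′ (Proc.bags⊆Z proc t q) , e

    of-bag′ : ∀ {v t} → path v ∈ˢ bagₛ t → c st′ v ∈ bag d′ t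
    of-bag′ {t = t} p = let z , q , e , r = of-bag p in subst (_∈ bag d′ t) (sym (trans (path-inj r) e)) q

    bag-size : ∀ t → ∣ bagₛ t ∣ ≤ length (bag d′ t)
    bag-size t = ≤-trans (∣toSubset∣ (map path (bag d′ t))) (≤-reflexive (length-map path (bag d′ t)))

    decomposition : RootedTreeDecomposition (length (Z st′)) (QAdj partition)
    decomposition = record
      { m = m′
      ; troot = rt d′
      ; tparent = par d′
      ; tdepth = dep d′
      ; troot-parent = par-rt d′
      ; tparent-depth = par-dep d′
      ; bag = bagₛ
      ; covers = covering
      ; subtree-connected = conn
      ; edge-covered = λ { x y (_ , u , w , refl , refl , e) → let s , p , q = edge-lab e in
                             s , in-bag (proj₂ p) , in-bag (proj₂ q) } }
      where
      covering : ∀ x → ∃ λ t → x ∈ˢ bagₛ t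
      covering x = let z = lookup (Z st′) x
                       s , p , _ = edge-lab (proj₂ (degree z))
                   in s , subst (_∈ˢ bagₛ s) (path-≡ (c-bottom st′ (∈-lookup x))) (in-bag (proj₂ p))
      conn : ∀ x s t → x ∈ˢ bagₛ s → x ∈ˢ bagₛ t → WalkIn (TreeAdj (rt d′) (par d′)) (λ u → x ∈ˢ bagₛ u) s t
      conn x s t p q with of-bag p | of-bag q
      ... | z , z∈ , cz , refl | z′ , z′∈ , cz′ , e =
        walk-map (λ t → t) (λ r → r) (λ r → in-bag (subst (_∈ bag d′ _) (sym cz) r))
          (bag-walk d′ z s t z∈ (subst (_∈ bag d′ t) (trans (sym cz′) (trans (sym (path-inj e)) cz)) z′∈))

    child-cell : ∀ {c₁} → Child d′ c₁ → ∃ λ K → Cell K × chR K ≤ 5 × bag d′ c₁ ≡ Lb K ×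
                   (∀ {x y t} → TriIn K x y t → Done st′ d′ c₁ x y t)
    child-cell ch with children Ev.into ch
    ... | c₀ , ch₀ , refl with Ki.child ch₀
    ...   | g , g∈ , e , it = proj₁ g , proj₁ cl , proj₂ cl , trans (emb-bag Ev.into c₀) e , done it
      where
      cl : Cell (proj₁ g) × chR (proj₁ g) ≤ 5
      cl = cells (g , g∈ , here refl)

    properties : Theorem13Properties Δ T partition decomposition
    properties = record
      { root-bag-size = ≤-trans (bag-size (rt d′)) (≤-trans (≤-reflexive (cong length root-bag)) root≤)
      ; root-children = map (emb Ev.into) Ki.kids , ≤-trans (≤-reflexive (trans (length-map _ Ki.kids) Ki.kids-len)) kids≤ ,
          λ x ch → let c₀ , ch₀ , e = children Ev.into ch in subst (_∈ map (emb Ev.into) Ki.kids) e (∈-map⁺ (emb Ev.into) (Ki.kids-all ch₀))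
      ; other-bags = λ t ne → ≤-trans (bag-size t) (Proc.small proc t ne)
      ; shared-with-root = shared
      ; component = comp }
      where
      shared : ∀ c₁ → Child d′ c₁ → AtMost 6 (λ x → x ∈ˢ bagₛ (rt d′) × ∃ λ t → Desc d′ c₁ t × x ∈ˢ bagₛ t)
      shared c₁ ch with child-cell ch
      ... | K , _ , le , e , _ = map path (bag d′ c₁) ,
            ≤-trans (≤-reflexive (trans (length-map path (bag d′ c₁)) (trans (cong length e) (labels-length (c st) (proj₂ (proj₂ K)))))) (s≤s le) ,
            λ { x (p , t , D , q) → both x t p D q }
        where
        both : ∀ x t → x ∈ˢ bagₛ (rt d′) → Desc d′ c₁ t → x ∈ˢ bagₛ t → x ∈ map path (bag d′ c₁)
        both x t p D q with of-bag {t = rt d′} p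
        ... | z , z∈ , cz , refl = ∈-map⁺ path (shared-in-child d′ (proj₁ ch) z∈ D (subst (_∈ bag d′ t) cz (of-bag′ q)))
      comp : ∀ c₁ → Child d′ c₁ →
             let InQ : V → Set
                 InQ v = path v ∉ˢ bagₛ (rt d′) × ∃ λ t → Desc d′ c₁ t × path v ∈ˢ bagₛ t
             in ∃ λ u₀ → InQ u₀ × (∀ y → y ∈ˢ bagₛ (rt d′) → (∃ λ t → Desc d′ c₁ t × y ∈ˢ bagₛ t) →
                  ∃₂ λ u w → WalkIn Adj InQ u₀ u × path w ≡ y × Adj u w)
      comp c₁ ch with child-cell ch
      ... | K@(_ , _ , P) , cl , _ , e , dn = Cell.centre cl , inQ (Cell.inner cl) , reach
        where
        InQ : V → Set
        InQ v = path v ∉ˢ bagₛ (rt d′) × ∃ λ t → Desc d′ c₁ t × path v ∈ˢ bagₛ t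
        -- If the path of `v` were in the root bag, `U-back` would make `v` labelled already in
        -- `st`.
        inQ : ∀ {v} → Inner P v → InQ v
        inQ {v} (cv , nu) with Cell.inTri cl cv
        ... | _ , _ , _ , τ , i with dn τ
        ...   | s , D , labs = (λ p → nu (Ext.U-back Ev.ext (all-U v) (subst (_ ∈_) root-bag (of-bag′ {t = rt d′} p)))) ,
                  s , D , in-bag (proj₂ (pick-lab i labs))
        reach : ∀ y → y ∈ˢ bagₛ (rt d′) → (∃ λ t → Desc d′ c₁ t × y ∈ˢ bagₛ t) →
                ∃₂ λ u w → WalkIn Adj InQ (Cell.centre cl) u × path w ≡ y × Adj u w
        reach y p (t , D , q) with of-bag {t = rt d′} p
        ... | z , z∈ , cz , refl
          -- By `shared-in-child` the path is in the bag of the child, hence a label of the head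
          -- cell, and a cell touches all its labels.
          with Cell.touch cl (subst (z ∈_) e (shared-in-child d′ (proj₁ ch) z∈ D (subst (_∈ bag d′ t) cz (of-bag′ q))))
        ...   | u , w , iu , uw , cw , a = u , w , walk-map (λ v → v) (λ r → r) inQ (Cell.linked cl iu) ,
                  path-cong (trans (Ext.c-stay Ev.ext uw) (trans cw (sym cz))) , a

-- From the polygon to the theorem.

module Construction {N g : ℕ} (Δ : Triangulation N g) (T : BFSTree N (Triangulation.Adj Δ))
                    (Adj-sym : ∀ {u w} → Triangulation.Adj Δ u w → Triangulation.Adj Δ w u)
                    {k : ℕ} (1≤k : 1 ≤ k) (I : Assembly.Polygon T Adj-sym k) where
  open BFSTree T
  open Ancestry T
  open Cutting T Adj-sym
  open Peeling T Adj-sym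
  open RootBag T Adj-sym
  open Assembly T Adj-sym
  open Decomposition V
  open State
  open Polygon I

  Result : Set
  Result = ∃ λ (P : VerticalPartition T) → ∃ λ (D : RootedTreeDecomposition (VerticalPartition.p P) (QAdj P)) →
           Theorem13Properties Δ T P D

  -- The number of rounds of `split`: the bound starts at `3k`, falls in every round and has to
  -- reach five.
  n : ℕ
  n = 3 * k ∸ 5

  initial : ∃ λ st → Ext (start z₁) st × (∀ {z} → z ∈ zs → U st z) × length (Z st) ≤ length zs + 1 ×
            (∀ {u w} (P : Poly u w) → (∀ q → count q P ≤ 2) → treeCh (c st) P ≤ treeCh (c (start z₁)) P + 2 * length zs)
  initial = add-all (start z₁) zs

  s₀ : State
  s₀ = proj₁ initial

  s₀-U : ∀ {z} → z ∈ z₁ ∷ zs → U s₀ z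
  s₀-U (here refl) = Ext.U-mono (proj₁ (proj₂ initial)) self
  s₀-U (there p)   = proj₁ (proj₂ (proj₂ initial)) p

  -- With the first path alone there is one label. Each of the at most `k` further paths adds two
  -- changes on tree sides, and each of the at most `k` stop sides has one change.
  ch₀ : ch (c s₀) P₀ ≤ 3 * k
  ch₀ = begin
    ch (c s₀) P₀                                          ≤⟨ ch-split (c s₀) P₀ ⟩
    treeCh (c s₀) P₀ + stopCount P₀                       ≤⟨ +-mono-≤ (proj₂ (proj₂ (proj₂ (proj₂ initial))) P₀ twice) stops≤ ⟩
    treeCh (c (start z₁)) P₀ + 2 * length zs + k          ≡⟨ cong (λ s → s + 2 * length zs + k) (treeCh-const z₁ P₀) ⟩
    2 * length zs + k                                     ≤⟨ +-monoˡ-≤ k (*-monoʳ-≤ 2 zs≤) ⟩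
    2 * k + k                                             ≡⟨ +-comm (2 * k) k ⟩
    3 * k                                                 ∎
    where open ≤-Reasoning hiding (start)

  splitting : Split s₀ P₀ [] n (3 * k)
  splitting = split n s₀ P₀ [] (3 * k) (anchored (s₀-U left∈) (s₀-U right∈) (stops-map P₀ s₀-U stops∈)) (λ ())
                (λ q → ≤-trans (≤-reflexive (+-identityʳ _)) (twice q)) ch₀
                (≤-trans 1≤k (m≤m+n k _)) (m≤n+m∸n (3 * k) 5)

  finish : (S : Split s₀ P₀ [] n (3 * k)) → length (Z (Split.st′ S)) ≤ 6 ⊔ (32 * g ∸ 27) →
           budget (Split.pieces S) ≤ 6 * (1 ⊔ (18 * g ∸ 21)) → Plan (Split.st′ S) (Split.pieces S) → Result
  finish S root≤ kids≤ Pl = conclude (kids-of st gs cells fit (λ q → ≤-trans (counts q) (Split.planar S q)))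
    where
    open Plan Pl
    st : State
    st = Split.st′ S
    open Cells T Adj-sym st
    cover : ∀ {x y t} → Tri P₀ x y t → AllU x y t ⊎ (∃ λ K → InGroup gs K × TriIn K x y t)
    cover τ with Split.tri S τ
    ... | inj₁ p = inj₁ p
    ... | inj₂ (r , p , σ) = tri p σ
    conclude : Kids st gs → Result
    conclude kids = result (run _ (Kids.items kids) (Kids.proc kids) ≤-refl)
      where
      result : Final st (Kids.d kids) (Kids.items kids) → Result
      result end = F.partition , F.decomposition , F.properties
        where module F = Conclusion.Finish Δ T Adj-sym I st cells cover kids end root≤ (≤-trans few kids≤)

  constructed : suc k + 3 * (3 * k ∸ 5) ≤ 6 ⊔ (32 * g ∸ 27) →
                2 * (3 * k) + 14 * (3 * k ∸ 5) ≤ 6 * (1 ⊔ (18 * g ∸ 21)) → Result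
  constructed bag-bound child-bound = finish splitting
    (≤-trans (Split.paths splitting) (≤-trans (+-monoˡ-≤ (3 * n)
      (≤-trans (proj₁ (proj₂ (proj₂ (proj₂ initial)))) (≤-trans (+-monoˡ-≤ 1 zs≤) (≤-reflexive (+-comm k 1))))) bag-bound))
    (≤-trans (Split.budget≤ splitting) child-bound)
    (plan (Split.st′ splitting) (Split.pieces splitting) (Split.good splitting))


-- Counting: indicators, sums and occurrences in lists.

ind : ∀ {A : Set} → Dec A → ℕ
ind (yes _) = 1
ind (no _)  = 0

ind≤1 : ∀ {A : Set} (d : Dec A) → ind d ≤ 1
ind≤1 (yes _) = ≤-refl
ind≤1 (no _)  = z≤n

ind-true : ∀ {A : Set} (d : Dec A) → A → 1 ≤ ind d
ind-true (yes _) _ = ≤-refl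
ind-true (no ¬a) a = contradiction a ¬a

ind-pos : ∀ {A : Set} (d : Dec A) → 1 ≤ ind d → A
ind-pos (yes a) _ = a

ind-zero : ∀ {A : Set} (d : Dec A) → ¬ A → ind d ≡ 0
ind-zero (yes a) ¬a = contradiction a ¬a
ind-zero (no _)  _  = refl

ind-⇔ : ∀ {A B : Set} (d : Dec A) (e : Dec B) → (A → B) → (B → A) → ind d ≡ ind e
ind-⇔ (yes _) (yes _) f g = refl
ind-⇔ (no _)  (no _)  f g = refl
ind-⇔ (yes a) (no ¬b) f g = contradiction (f a) ¬b
ind-⇔ (no ¬a) (yes b) f g = contradiction (g b) ¬a

sum-zero : ∀ {n} (f : Fin n → ℕ) → (∀ i → f i ≡ 0) → sum f ≡ 0
sum-zero {zero}  f p = refl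
sum-zero {suc n} f p = cong₂ _+_ (p zero) (sum-zero (f ∘ suc) (p ∘ suc))

sum-one : ∀ {n} → sum {n} (λ _ → 1) ≡ n
sum-one {zero}  = refl
sum-one {suc n} = cong suc (sum-one {n})

sum-single : ∀ {n} (x : Fin n) → sum (λ y → ind (y ≟ x)) ≡ 1
sum-single {suc n} zero = cong suc (sum-zero {n} (λ y → ind (suc y ≟ zero)) λ y → ind-zero (suc y ≟ zero) λ ())
sum-single {suc n} (suc x) = trans (sum-cong-≗ {n} (λ y → ind-⇔ (suc y ≟ suc x) (y ≟ x) Finₚ.suc-injective (cong suc)))
                               (sum-single x)

sum-mono : ∀ {n} (f g : Fin n → ℕ) → (∀ i → f i ≤ g i) → sum f ≤ sum g
sum-mono {zero}  f g p = z≤n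
sum-mono {suc n} f g p = +-mono-≤ (p zero) (sum-mono (f ∘ suc) (g ∘ suc) (p ∘ suc))

≤-sum : ∀ {n} (f : Fin n → ℕ) i → f i ≤ sum f
≤-sum f zero    = m≤m+n _ _
≤-sum f (suc i) = ≤-trans (≤-sum (f ∘ suc) i) (m≤n+m _ (f zero))

-- Pairing y with τ y splits the sum into two equal halves.
involution-even : ∀ {n} (τ : Fin n → Fin n) → (∀ x → τ (τ x) ≡ x) → (∀ x → τ x ≢ x) →
                  (h : Fin n → ℕ) → (∀ x → h (τ x) ≡ h x) → ∃ λ a → sum h ≡ 2 * a
involution-even {n} τ inv fpf h h-τ = sum lo , (begin
  sum h                          ≡⟨ sum-cong-≗ halves ⟩
  sum (λ y → lo y + hi y)        ≡⟨ ∑-distrib-+ lo hi ⟩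
  sum lo + sum hi                ≡⟨ cong (sum lo +_) (sum-permute hi π) ⟩
  sum lo + sum (λ y → hi (τ y))  ≡⟨ cong (sum lo +_) (sum-cong-≗ flip) ⟩
  sum lo + sum lo                ≡⟨ cong (sum lo +_) (sym (+-identityʳ _)) ⟩
  2 * sum lo                     ∎)
  where
  open ≡-Reasoning
  π : Perm.Permutation n n
  π = Perm.permutation τ τ inv inv
  lt? : ∀ y → Dec (toℕ y < toℕ (τ y))
  lt? y = toℕ y <? toℕ (τ y)
  gt? : ∀ y → Dec (toℕ (τ y) < toℕ y)
  gt? y = toℕ (τ y) <? toℕ y
  lo hi : Fin n → ℕ
  lo y = ind (lt? y) * h y
  hi y = ind (gt? y) * h y
  halves : ∀ y → h y ≡ lo y + hi y
  halves y with lt? y | gt? y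
  ... | yes p | yes q = contradiction q (<-asym p)
  ... | yes p | no _  = sym (trans (+-identityʳ _) (+-identityʳ _))
  ... | no _  | yes q = sym (+-identityʳ _)
  ... | no p  | no q  = contradiction (Finₚ.toℕ-injective (≤-antisym (≮⇒≥ p) (≮⇒≥ q))) (fpf y)
  flip : ∀ y → hi (τ y) ≡ lo y
  flip y = cong₂ _*_ (ind-⇔ (gt? (τ y)) (lt? y) (subst (λ x → toℕ x < toℕ (τ y)) (inv y))
                                                (subst (λ x → toℕ x < toℕ (τ y)) (sym (inv y)))) (h-τ y)

unique-length : ∀ {n} {xs : List (Fin n)} → Unique xs → length xs ≤ n
unique-length {xs = xs} u = Finₚ.injective⇒≤ {f = lookup xs} (λ {i} {j} → lookup-injective u i j)

covering-length : ∀ {n} {xs : List (Fin n)} → (∀ x → x ∈ xs) → n ≤ length xs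
covering-length {xs = xs} p = Finₚ.injective⇒≤ {f = λ x → index (p x)}
  λ {x} {y} e → trans (lookup-index (p x)) (trans (cong (lookup xs) e) (sym (lookup-index (p y))))

occ : ∀ {n} → Fin n → List (Fin n) → ℕ
occ e []       = 0
occ e (x ∷ xs) = ind (e ≟ x) + occ e xs

occ-++ : ∀ {n} (e : Fin n) xs ys → occ e (xs ++ ys) ≡ occ e xs + occ e ys
occ-++ e [] ys = refl
occ-++ e (x ∷ xs) ys = trans (cong (ind (e ≟ x) +_) (occ-++ e xs ys)) (sym (+-assoc (ind (e ≟ x)) _ _))

occ-pos : ∀ {n} {e : Fin n} xs → 1 ≤ occ e xs → e ∈ xs
occ-pos {e = e} (x ∷ xs) p with e ≟ x
... | yes q = here q
... | no _  = there (occ-pos xs p)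

occ-∈ : ∀ {n} {e : Fin n} {xs} → e ∈ xs → 1 ≤ occ e xs
occ-∈ {e = e} {x ∷ xs} (here q) = ≤-trans (ind-true (e ≟ x) q) (m≤m+n _ _)
occ-∈ {e = e} {x ∷ xs} (there p) = ≤-trans (occ-∈ p) (m≤n+m _ (ind (e ≟ x)))

occ-unique : ∀ {n} {e : Fin n} {xs} → Unique xs → occ e xs ≤ 1
occ-unique [] = z≤n
occ-unique {e = e} {x ∷ xs} (p ∷ u) with e ≟ x
... | no _ = occ-unique u
... | yes refl with occ e xs in eq
...   | zero  = ≤-refl
...   | suc _ = contradiction refl (All.lookup p (occ-pos xs (subst (1 ≤_) (sym eq) (s≤s z≤n))))

sum-occ : ∀ {n} (xs : List (Fin n)) → sum (λ e → occ e xs) ≡ length xs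
sum-occ {n} [] = sum-zero {n} (λ _ → 0) (λ _ → refl)
sum-occ (x ∷ xs) = trans (∑-distrib-+ (λ e → ind (e ≟ x)) (λ e → occ e xs)) (cong₂ _+_ (sum-single x) (sum-occ xs))

excl : ∀ {a b} → a ≤ 1 → b ≤ 1 → (1 ≤ a → 1 ≤ b → ⊥) → a + b ≤ 1
excl {zero} p q f = q
excl {suc a} {zero} p q f = ≤-trans (≤-reflexive (+-identityʳ _)) p
excl {suc a} {suc b} p q f = ⊥-elim (f (s≤s z≤n) (s≤s z≤n))

pos-+ : ∀ {a b} → 1 ≤ a + b → 1 ≤ a ⊎ 1 ≤ b
pos-+ {zero} p  = inj₂ p
pos-+ {suc a} p = inj₁ (s≤s z≤n)

-- Triangles, sides of edges, and trees of triangles in terms of flags.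

module Flags {N g : ℕ} (Δ : Triangulation N g) where
  open Triangulation Δ public

  Flag : Set
  Flag = Fin flags

  v-τ₁ : ∀ x → vertex (τ₁ x) ≡ vertex x
  v-τ₁ x = sym (proj₂ (proj₂ vertex-orbits x (τ₁ x)) (gen-step (here refl) gen-refl))

  v-τ₂ : ∀ x → vertex (τ₂ x) ≡ vertex x
  v-τ₂ x = sym (proj₂ (proj₂ vertex-orbits x (τ₂ x)) (gen-step (there (here refl)) gen-refl))

  e-τ₀ : ∀ x → edge (τ₀ x) ≡ edge x
  e-τ₀ x = sym (proj₂ (proj₂ edge-orbits x (τ₀ x)) (gen-step (here refl) gen-refl))

  e-τ₂ : ∀ x → edge (τ₂ x) ≡ edge x
  e-τ₂ x = sym (proj₂ (proj₂ edge-orbits x (τ₂ x)) (gen-step (there (here refl)) gen-refl))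

  f-τ₀ : ∀ x → face (τ₀ x) ≡ face x
  f-τ₀ x = sym (proj₂ (proj₂ face-orbits x (τ₀ x)) (gen-step (here refl) gen-refl))

  f-τ₁ : ∀ x → face (τ₁ x) ≡ face x
  f-τ₁ x = sym (proj₂ (proj₂ face-orbits x (τ₁ x)) (gen-step (there (here refl)) gen-refl))

  v-τ₀τ₂ : ∀ x → vertex (τ₀ (τ₂ x)) ≡ vertex (τ₀ x)
  v-τ₀τ₂ x = trans (cong vertex (comm₀₂ x)) (v-τ₂ (τ₀ x))

  braid : ∀ x → τ₀ (τ₁ (τ₀ x)) ≡ τ₁ (τ₀ (τ₁ x))
  braid x = begin
    τ₀ (τ₁ (τ₀ x))                               ≡⟨ sym (inv₁ _) ⟩
    τ₁ (τ₁ (τ₀ (τ₁ (τ₀ x))))                     ≡⟨ cong τ₁ (sym (inv₀ _)) ⟩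
    τ₁ (τ₀ (τ₀ (τ₁ (τ₀ (τ₁ (τ₀ x))))))           ≡⟨ cong (τ₁ ∘ τ₀) (sym (inv₁ _)) ⟩
    τ₁ (τ₀ (τ₁ (τ₁ (τ₀ (τ₁ (τ₀ (τ₁ (τ₀ x)))))))) ≡⟨ cong (τ₁ ∘ τ₀ ∘ τ₁) (proj₁ (triangular x)) ⟩
    τ₁ (τ₀ (τ₁ x))                               ∎
    where open ≡-Reasoning

  -- With `b` on the base of a triangle and `τ₁ b` on the second side, this is the flag of the
  -- remaining side at the apex.
  third : Flag → Flag
  third b = τ₁ (τ₀ (τ₁ b))

  f-third : ∀ b → face (third b) ≡ face b
  f-third b = trans (f-τ₁ _) (trans (f-τ₀ _) (f-τ₁ b))

  -- A pair of flags exchanged by `τ₀` is an edge seen from one of its faces. An edge has two such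
  -- sides, that of `s` and that of `τ₂ s`, even if one face occupies both.
  Side : Flag → Flag → Set
  Side s t = s ≡ t ⊎ s ≡ τ₀ t

  side? : ∀ s t → Dec (Side s t)
  side? s t = (s ≟ t) ⊎-dec (s ≟ τ₀ t)

  side-τ₀ : ∀ {s t} → Side s t → Side (τ₀ s) t
  side-τ₀ (inj₁ refl) = inj₂ refl
  side-τ₀ (inj₂ refl) = inj₁ (inv₀ _)

  side-sym : ∀ {s t} → Side s t → Side t s
  side-sym (inj₁ refl) = inj₁ refl
  side-sym (inj₂ refl) = inj₂ (sym (inv₀ _))

  side-trans : ∀ {s t r} → Side s t → Side t r → Side s r
  side-trans (inj₁ refl) q = q
  side-trans (inj₂ refl) q = side-τ₀ q

  side-τ₂ : ∀ {s t} → Side s t → Side (τ₂ s) (τ₂ t)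
  side-τ₂ (inj₁ refl) = inj₁ refl
  side-τ₂ (inj₂ refl) = inj₂ (sym (comm₀₂ _))

  side-τ₂τ₂ : ∀ {s t} → Side s (τ₂ t) → Side (τ₂ s) t
  side-τ₂τ₂ {t = t} p = subst (Side _) (inv₂ t) (side-τ₂ p)

  side-face : ∀ {s t} → Side s t → face s ≡ face t
  side-face (inj₁ refl) = refl
  side-face (inj₂ refl) = f-τ₀ _

  face-sides : ∀ {x b} → face x ≡ face b → Side x b ⊎ Side x (τ₁ b) ⊎ Side x (third b)
  face-sides {x} {b} e = go (proj₁ (proj₂ face-orbits b x) (sym e))
    where
    go : ∀ {x} → Gen (τ₀ ∷ τ₁ ∷ []) b x → Side x b ⊎ Side x (τ₁ b) ⊎ Side x (third b)
    go gen-refl = inj₁ (inj₁ refl)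
    go (gen-step (here refl) r) with go r
    ... | inj₁ p = inj₁ (side-τ₀ p)
    ... | inj₂ (inj₁ p) = inj₂ (inj₁ (side-τ₀ p))
    ... | inj₂ (inj₂ p) = inj₂ (inj₂ (side-τ₀ p))
    go (gen-step (there (here refl)) r) with go r
    ... | inj₁ (inj₁ refl) = inj₂ (inj₁ (inj₁ refl))
    ... | inj₁ (inj₂ refl) = inj₂ (inj₂ (inj₂ (trans (sym (inv₀ _)) (cong τ₀ (braid b)))))
    ... | inj₂ (inj₁ (inj₁ refl)) = inj₁ (inj₁ (inv₁ b))
    ... | inj₂ (inj₁ (inj₂ refl)) = inj₂ (inj₂ (inj₁ refl))
    ... | inj₂ (inj₂ (inj₁ refl)) = inj₂ (inj₁ (inj₂ (inv₁ _)))
    ... | inj₂ (inj₂ (inj₂ refl)) = inj₁ (inj₂ (begin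
            τ₁ (τ₀ (τ₁ (τ₀ (τ₁ b)))) ≡⟨ sym (braid _) ⟩
            τ₀ (τ₁ (τ₀ (τ₀ (τ₁ b)))) ≡⟨ cong (τ₀ ∘ τ₁) (inv₀ _) ⟩
            τ₀ (τ₁ (τ₁ b))           ≡⟨ cong τ₀ (inv₁ b) ⟩
            τ₀ b                     ∎))
      where open ≡-Reasoning

  edge-sides : ∀ {x y} → edge x ≡ edge y → Side x y ⊎ Side x (τ₂ y)
  edge-sides {x} {y} e = go (proj₁ (proj₂ edge-orbits y x) (sym e))
    where
    go : ∀ {x} → Gen (τ₀ ∷ τ₂ ∷ []) y x → Side x y ⊎ Side x (τ₂ y)
    go gen-refl = inj₁ (inj₁ refl)
    go (gen-step (here refl) r) with go r
    ... | inj₁ p = inj₁ (side-τ₀ p)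
    ... | inj₂ p = inj₂ (side-τ₀ p)
    go (gen-step (there (here refl)) r) with go r
    ... | inj₁ p = inj₂ (side-τ₂ p)
    ... | inj₂ p = inj₁ (side-τ₂τ₂ p)

  base≁left : ∀ b → ¬ Side b (τ₁ b)
  base≁left b (inj₁ e) = fpf₁ b (sym e)
  base≁left b (inj₂ e) = proj₂ (triangular b) (trans (cong (τ₁ ∘ τ₀) e) (trans (cong τ₁ (inv₀ _)) (inv₁ b)))

  base≁third : ∀ b → ¬ Side b (third b)
  base≁third b (inj₁ e) = fpf₀ (τ₁ b) (trans (sym (inv₁ _)) (cong τ₁ (sym e)))
  base≁third b (inj₂ e) = base≁left b (inj₂ (begin
    b                        ≡⟨ e ⟩
    τ₀ (τ₁ (τ₀ (τ₁ b)))      ≡⟨ braid (τ₁ b) ⟩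
    τ₁ (τ₀ (τ₁ (τ₁ b)))      ≡⟨ cong (τ₁ ∘ τ₀) (inv₁ b) ⟩
    τ₁ (τ₀ b)                ≡⟨ cong (τ₁ ∘ τ₀) e ⟩
    τ₁ (τ₀ (τ₀ (third b)))   ≡⟨ cong τ₁ (inv₀ _) ⟩
    τ₁ (third b)             ≡⟨ inv₁ _ ⟩
    τ₀ (τ₁ b)                ∎))
    where open ≡-Reasoning

  left≁third : ∀ b → ¬ Side (τ₁ b) (third b)
  left≁third b (inj₁ e) = base≁left b (inj₂ (trans (sym (inv₁ b)) (trans (cong τ₁ e) (inv₁ _))))
  left≁third b (inj₂ e) = fpf₀ b (sym (trans (sym (inv₁ b)) (trans (cong τ₁ (trans e
    (trans (cong τ₀ (sym (braid b))) (inv₀ _)))) (inv₁ _))))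

  -- A rooted tree in the dual: `node b` is the triangle of `b`, entered through its base, and its
  -- subtrees start across the two other sides. `leaf b` is an edge not crossed; the tree lies on
  -- the side of `τ₂ b`.
  data Disc : Flag → Set where
    leaf : ∀ b → Disc b
    node : ∀ b → Disc (τ₂ (τ₁ b)) → Disc (τ₂ (third b)) → Disc b

  faces : ∀ {b} → Disc b → List (Fin nF)
  faces (leaf b)     = []
  -- The latest face comes first, so up to association this is the list of seen faces that `search`
  -- builds.
  faces (node b L M) = faces M ++ (faces L ++ (face b ∷ []))

  leaves cross : ∀ {b} → Disc b → List (Fin nE)
  leaves (leaf b)     = edge b ∷ []
  leaves (node b L M) = leaves L ++ leaves M
  cross (leaf b)      = []
  cross (node b L M)  = edge b ∷ (cross L ++ cross M)

  -- `rootUse` counts only sides that belong to faces of the tree; `use` adds the side in the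
  -- preceding face across which the tree is attached.
  use : Flag → ∀ {b} → Disc b → ℕ
  rootUse : Flag → ∀ {b} → Disc b → ℕ
  use s {b} D = ind (side? s (τ₂ b)) + rootUse s D
  rootUse s (leaf b)     = 0
  rootUse s (node b L M) = ind (side? s b) + (use s L + use s M)

  ∈-faces-base : ∀ {b} (L : Disc (τ₂ (τ₁ b))) (M : Disc (τ₂ (third b))) → face b ∈ faces (node b L M)
  ∈-faces-base L M = ∈-++⁺ʳ (faces M) (∈-++⁺ʳ (faces L) (here refl))

  ∈-faces : ∀ {b f} (L : Disc (τ₂ (τ₁ b))) (M : Disc (τ₂ (third b))) → f ∈ faces (node b L M) →
            f ≡ face b ⊎ f ∈ faces L ⊎ f ∈ faces M
  ∈-faces L M p with ∈-++⁻ (faces M) p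
  ... | inj₁ q = inj₂ (inj₂ q)
  ... | inj₂ q with ∈-++⁻ (faces L) q
  ...   | inj₁ r = inj₂ (inj₁ r)
  ...   | inj₂ (here e) = inj₁ e

  unique-++ : ∀ {A : Set} (xs : List A) {ys} → Unique (xs ++ ys) → Unique xs × Unique ys × (∀ {x} → x ∈ xs → x ∉ ys)
  unique-++ [] u = [] , u , λ ()
  unique-++ (x ∷ xs) (p ∷ u) with unique-++ xs u
  ... | a , b , d = All.tabulate (λ q → All.lookup p (∈-++⁺ˡ q)) ∷ a , b ,
        λ { (here refl) q → All.lookup p (∈-++⁺ʳ xs q) refl ; (there q) → d q }

  -- Two sides that are counted belong to different faces, by distinctness of the faces, or are
  -- different sides of one triangle.
  rootUse-≤ : ∀ s {b} (D : Disc b) → Unique (faces D) → rootUse s D ≤ 1 × (1 ≤ rootUse s D → face s ∈ faces D)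
  use-≤ : ∀ s {b} (D : Disc b) → Unique (faces D) → face (τ₂ b) ∉ faces D →
          use s D ≤ 1 × (1 ≤ use s D → Side s (τ₂ b) ⊎ face s ∈ faces D)
  use-≤ s {b} D u n with rootUse-≤ s D u
  ... | le , pos = excl (ind≤1 (side? s (τ₂ b))) le
            (λ p q → n (subst (_∈ faces D) (side-face (ind-pos (side? s (τ₂ b)) p)) (pos q))) ,
          λ p → [ (λ q → inj₁ (ind-pos (side? s (τ₂ b)) q)) , (λ q → inj₂ (pos q)) ]′ (pos-+ p)
  rootUse-≤ s (leaf b) u = z≤n , λ ()
  rootUse-≤ s (node b L M) u with unique-++ (faces M) u
  ... | uM , u′ , dM with unique-++ (faces L) u′
  ...   | uL , _ , dL = excl (ind≤1 (side? s b)) (excl leL leM LM) BLM , pos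
    where
    b∉M : face b ∉ faces M
    b∉M p = dM p (∈-++⁺ʳ (faces L) (here refl))
    b∉L : face b ∉ faces L
    b∉L p = dL p (here refl)
    fl : face (τ₂ (τ₂ (τ₁ b))) ≡ face b
    fl = trans (cong face (inv₂ _)) (f-τ₁ b)
    fm : face (τ₂ (τ₂ (third b))) ≡ face b
    fm = trans (cong face (inv₂ _)) (f-third b)
    UL = use-≤ s L uL (subst (_∉ faces L) (sym fl) b∉L)
    UM = use-≤ s M uM (subst (_∉ faces M) (sym fm) b∉M)
    leL = proj₁ UL
    leM = proj₁ UM
    posL : 1 ≤ use s L → Side s (τ₁ b) ⊎ face s ∈ faces L
    posL p = [ (λ q → inj₁ (subst (Side s) (inv₂ _) q)) , inj₂ ]′ (proj₂ UL p)
    posM : 1 ≤ use s M → Side s (third b) ⊎ face s ∈ faces M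
    posM p = [ (λ q → inj₁ (subst (Side s) (inv₂ _) q)) , inj₂ ]′ (proj₂ UM p)
    LM : 1 ≤ use s L → 1 ≤ use s M → ⊥
    LM p q with posL p | posM q
    ... | inj₁ x | inj₁ y = left≁third b (side-trans (side-sym x) y)
    ... | inj₁ x | inj₂ y = b∉M (subst (_∈ faces M) (trans (side-face x) (f-τ₁ b)) y)
    ... | inj₂ x | inj₁ y = b∉L (subst (_∈ faces L) (trans (side-face y) (f-third b)) x)
    ... | inj₂ x | inj₂ y = dM y (∈-++⁺ˡ x)
    BLM : 1 ≤ ind (side? s b) → 1 ≤ use s L + use s M → ⊥
    BLM p q with ind-pos (side? s b) p | pos-+ {use s L} q
    ... | x | inj₁ y with posL y
    ...   | inj₁ z = base≁left b (side-trans (side-sym x) z)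
    ...   | inj₂ z = b∉L (subst (_∈ faces L) (side-face x) z)
    BLM p q | x | inj₂ y with posM y
    ...   | inj₁ z = base≁third b (side-trans (side-sym x) z)
    ...   | inj₂ z = b∉M (subst (_∈ faces M) (side-face x) z)
    pos : 1 ≤ rootUse s (node b L M) → face s ∈ faces (node b L M)
    pos p with pos-+ {ind (side? s b)} p
    ... | inj₁ q = subst (_∈ faces (node b L M)) (sym (side-face (ind-pos (side? s b) q))) (∈-faces-base L M)
    ... | inj₂ q with pos-+ {use s L} q
    ...   | inj₁ r with posL r
    ...     | inj₁ x = subst (_∈ faces (node b L M)) (sym (trans (side-face x) (f-τ₁ b))) (∈-faces-base L M)
    ...     | inj₂ x = ∈-++⁺ʳ (faces M) (∈-++⁺ˡ x)
    pos p | inj₂ q | inj₂ r with posM r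
    ...     | inj₁ x = subst (_∈ faces (node b L M)) (sym (trans (side-face x) (f-third b))) (∈-faces-base L M)
    ...     | inj₂ x = ∈-++⁺ˡ x

  -- An edge has two sides; a leaf or the base takes up one of them, a crossing takes up both.
  edge-use : ∀ s {b} (D : Disc b) → occ (edge s) (leaves D) + 2 * occ (edge s) (cross D) ≤ use s D + use (τ₂ s) D
  private
    base-side : ∀ s b → ind (edge s ≟ edge b) ≤ ind (side? s b) + ind (side? (τ₂ s) b)
    base-side s b with edge s ≟ edge b
    ... | no _ = z≤n
    ... | yes e with edge-sides e
    ...   | inj₁ p = ≤-trans (ind-true (side? s b) p) (m≤m+n _ _)
    ...   | inj₂ p = ≤-trans (ind-true (side? (τ₂ s) b) (side-τ₂τ₂ p)) (m≤n+m _ (ind (side? s b)))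

    far-side : ∀ s b → ind (edge s ≟ edge b) ≤ ind (side? s (τ₂ b)) + ind (side? (τ₂ s) (τ₂ b))
    far-side s b = ≤-trans (≤-reflexive (ind-⇔ (edge s ≟ edge b) (edge s ≟ edge (τ₂ b))
                     (λ e → trans e (sym (e-τ₂ b))) (λ e → trans e (e-τ₂ b)))) (base-side s (τ₂ b))

    shuffle : ∀ a l m x y → (l + m) + 2 * (a + (x + y)) ≡ (a + a) + ((l + 2 * x) + (m + 2 * y))
    shuffle = solve 5 (λ a l m x y → (l :+ m) :+ con 2 :* (a :+ (x :+ y)) := (a :+ a) :+ ((l :+ con 2 :* x) :+ (m :+ con 2 :* y))) refl
      where open +-*-Solver

    shuffle′ : ∀ p p′ q q′ l l′ m m′ → ((p + p′) + (q + q′)) + ((l + l′) + (m + m′)) ≡ (p + (q + (l + m))) + (p′ + (q′ + (l′ + m′)))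
    shuffle′ = solve 8 (λ p p′ q q′ l l′ m m′ → ((p :+ p′) :+ (q :+ q′)) :+ ((l :+ l′) :+ (m :+ m′)) := (p :+ (q :+ (l :+ m))) :+ (p′ :+ (q′ :+ (l′ :+ m′)))) refl
      where open +-*-Solver

  edge-use s (leaf b) = ≤-trans (≤-reflexive (trans (+-identityʳ _) (+-identityʳ _)))
    (≤-trans (far-side s b) (≤-reflexive (sym (cong₂ _+_ (+-identityʳ (ind (side? s (τ₂ b)))) (+-identityʳ (ind (side? (τ₂ s) (τ₂ b))))))))
  edge-use s (node b L M) = begin
    occ e (leaves L ++ leaves M) + 2 * (ind (e ≟ edge b) + occ e (cross L ++ cross M))
      ≡⟨ cong₂ (λ x y → x + 2 * (ind (e ≟ edge b) + y)) (occ-++ e (leaves L) _) (occ-++ e (cross L) _) ⟩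
    (occ e (leaves L) + occ e (leaves M)) + 2 * (ind (e ≟ edge b) + (occ e (cross L) + occ e (cross M)))
      ≡⟨ shuffle (ind (e ≟ edge b)) (occ e (leaves L)) (occ e (leaves M)) (occ e (cross L)) (occ e (cross M)) ⟩
    (ind (e ≟ edge b) + ind (e ≟ edge b)) + ((occ e (leaves L) + 2 * occ e (cross L)) + (occ e (leaves M) + 2 * occ e (cross M)))
      ≤⟨ +-mono-≤ (+-mono-≤ (far-side s b) (base-side s b)) (+-mono-≤ (edge-use s L) (edge-use s M)) ⟩
    ((ind (side? s (τ₂ b)) + ind (side? (τ₂ s) (τ₂ b))) + (ind (side? s b) + ind (side? (τ₂ s) b))) +
      ((use s L + use (τ₂ s) L) + (use s M + use (τ₂ s) M))
      ≡⟨ shuffle′ (ind (side? s (τ₂ b))) (ind (side? (τ₂ s) (τ₂ b))) (ind (side? s b)) (ind (side? (τ₂ s) b)) (use s L) (use (τ₂ s) L) (use s M) (use (τ₂ s) M) ⟩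
    use s (node b L M) + use (τ₂ s) (node b L M) ∎
    where
    open ≤-Reasoning
    e = edge s

  edge-twice : ∀ e {b} (L : Disc (τ₂ (τ₁ b))) (M : Disc (τ₂ (third b))) → Unique (faces (node b L M)) →
               ind (e ≟ edge b) + (occ e (leaves L ++ leaves M) + 2 * occ e (cross L ++ cross M)) ≤ 2
  edge-twice e {b} L M u with proj₁ edge-orbits e
  ... | s , refl = begin
    ind (edge s ≟ edge b) + (occ (edge s) (leaves L ++ leaves M) + 2 * occ (edge s) (cross L ++ cross M))
      ≡⟨ cong (ind (edge s ≟ edge b) +_) (cong₂ (λ x y → x + 2 * y) (occ-++ (edge s) (leaves L) _) (occ-++ (edge s) (cross L) _)) ⟩
    ind (edge s ≟ edge b) + ((occ (edge s) (leaves L) + occ (edge s) (leaves M)) + 2 * (occ (edge s) (cross L) + occ (edge s) (cross M)))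
      ≡⟨ cong (ind (edge s ≟ edge b) +_) (shuffle 0 (occ (edge s) (leaves L)) (occ (edge s) (leaves M)) (occ (edge s) (cross L)) (occ (edge s) (cross M))) ⟩
    ind (edge s ≟ edge b) + ((occ (edge s) (leaves L) + 2 * occ (edge s) (cross L)) + (occ (edge s) (leaves M) + 2 * occ (edge s) (cross M)))
      ≤⟨ +-mono-≤ (base-side s b) (+-mono-≤ (edge-use s L) (edge-use s M)) ⟩
    (ind (side? s b) + ind (side? (τ₂ s) b)) + ((use s L + use (τ₂ s) L) + (use s M + use (τ₂ s) M))
      ≡⟨ shuffle′ 0 0 (ind (side? s b)) (ind (side? (τ₂ s) b)) (use s L) (use (τ₂ s) L) (use s M) (use (τ₂ s) M) ⟩
    rootUse s (node b L M) + rootUse (τ₂ s) (node b L M)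
      ≤⟨ +-mono-≤ (proj₁ (rootUse-≤ s (node b L M) u)) (proj₁ (rootUse-≤ (τ₂ s) (node b L M) u)) ⟩
    2 ∎
    where open ≤-Reasoning

-- Searching the faces without crossing blocked edges.

module Exploration {N g : ℕ} (Δ : Triangulation N g) where
  open Flags Δ
  open DecMembership (_≟_ {nF}) using (_∈?_)

  module Search (Block : Flag → Set) (block? : ∀ x → Dec (Block x)) where

    -- The search gives up at a leaf for one of two reasons: the edge is blocked, or the face beyond
    -- is known.
    Sealed : (Fin nF → Set) → ∀ {b} → Disc b → Set
    Sealed S (leaf b)     = Block b ⊎ S (face b)
    Sealed S (node b L M) = ¬ Block b × Sealed S L × Sealed S M

    sealed-map : ∀ {S S′ : Fin nF → Set} → (∀ {f} → S f → S′ f) → ∀ {b} (D : Disc b) → Sealed S D → Sealed S′ D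
    sealed-map i (leaf b) (inj₁ p) = inj₁ p
    sealed-map i (leaf b) (inj₂ p) = inj₂ (i p)
    sealed-map i (node b L M) (n , l , m) = n , sealed-map i L l , sealed-map i M m

    record Found (seen : List (Fin nF)) (b : Flag) : Set where
      field
        disc   : Disc b
        distinct : Unique (faces disc ++ seen)
        closed : Sealed (_∈ faces disc ++ seen) disc

    private
      regroup : ∀ (m l : List (Fin nF)) f seen → m ++ (l ++ (f ∷ seen)) ≡ (m ++ (l ++ (f ∷ []))) ++ seen
      regroup m l f seen = trans (cong (m ++_) (sym (++-assoc l (f ∷ []) seen))) (sym (++-assoc m _ seen))

    -- A face is marked before its sides are explored, and the second side is explored knowing the
    -- faces behind the first, so no face is entered twice. The fuel `n` covers the faces not yet
    -- seen.
    search : ∀ n seen → Unique seen → nF ≤ n + length seen → ∀ b → Found seen b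
    search n seen u le b with block? b | face b ∈? seen
    ... | yes p | _ = record { disc = leaf b ; distinct = u ; closed = inj₁ p }
    ... | no _ | yes p = record { disc = leaf b ; distinct = u ; closed = inj₂ p }
    search zero seen u le b | no _ | no f∉ =
      contradiction (≤-trans (s≤s le) (unique-length (All.tabulate (λ { p refl → f∉ p }) ∷ u))) (<-irrefl refl)
    search (suc n) seen u le b | no ¬p | no f∉ = record
      { disc = node b L M
      ; distinct = subst Unique eq (Found.distinct FM)
      ; closed = ¬p , sealed-map (λ q → subst (_ ∈_) eq (∈-++⁺ʳ (faces M) q)) L (Found.closed FL)
                    , sealed-map (λ q → subst (_ ∈_) eq q) M (Found.closed FM) }
      where
      seen₁ = face b ∷ seen
      FL : Found seen₁ (τ₂ (τ₁ b))
      FL = search n seen₁ (All.tabulate (λ { p refl → f∉ p }) ∷ u) (≤-trans le (≤-reflexive (sym (+-suc n _)))) _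
      L = Found.disc FL
      FM : Found (faces L ++ seen₁) (τ₂ (third b))
      FM = search n (faces L ++ seen₁) (Found.distinct FL)
             (≤-trans le (≤-trans (≤-reflexive (sym (+-suc n _))) (+-monoʳ-≤ n
               (≤-trans (m≤n+m _ (length (faces L))) (≤-reflexive (sym (length-++ (faces L)))))))) _
      M = Found.disc FM
      eq = regroup (faces M) (faces L) (face b) seen

    record Explored (b : Flag) : Set where
      field
        L : Disc (τ₂ (τ₁ b))
        M : Disc (τ₂ (third b))
        distinct : Unique (faces (node b L M))
        closedL  : Sealed (_∈ faces (node b L M)) L
        closedM  : Sealed (_∈ faces (node b L M)) M

    -- The base of the first triangle is not tested: the polygon is opened there, and this edge is
    -- meant to be blocked itself.
    explore : ∀ b → Explored b
    explore b = record
      { L = Found.disc FL ; M = Found.disc FM ; distinct = Found.distinct FM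
      ; closedL = sealed-map (∈-++⁺ʳ (faces (Found.disc FM))) (Found.disc FL) (Found.closed FL)
      ; closedM = Found.closed FM }
      where
      FL : Found (face b ∷ []) (τ₂ (τ₁ b))
      FL = search nF (face b ∷ []) ([] ∷ []) (m≤m+n nF 1) _
      FM : Found (faces (Found.disc FL) ++ (face b ∷ [])) (τ₂ (third b))
      FM = search nF _ (Found.distinct FL) (m≤m+n nF _) _

    module _ (block-side : ∀ {x y} → Side x y → Block y → Block x) (block-τ₂ : ∀ {x} → Block x → Block (τ₂ x)) where

      private
        across : ∀ {S : Fin nF → Set} {b} (D : Disc b) → Sealed S D → (∀ {f} → f ∈ faces D → S f) →
                 ∀ {x} → Side x (τ₂ b) → ¬ Block x → S (face (τ₂ x))
        across {S} (leaf b) (inj₁ p) inc sd ¬p = contradiction (block-side sd (block-τ₂ p)) ¬p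
        across {S} (leaf b) (inj₂ p) inc sd ¬p = subst S (sym (side-face (side-τ₂τ₂ sd))) p
        across {S} (node b L M) _ inc sd ¬p = subst S (sym (side-face (side-τ₂τ₂ sd))) (inc (∈-faces-base L M))

        inL : ∀ {b f} {L : Disc (τ₂ (τ₁ b))} {M : Disc (τ₂ (third b))} → f ∈ faces L → f ∈ faces (node b L M)
        inL {M = M} p = ∈-++⁺ʳ (faces M) (∈-++⁺ˡ p)

        below : ∀ {S : Fin nF → Set} {b} (L : Disc (τ₂ (τ₁ b))) (M : Disc (τ₂ (third b))) →
                Sealed S L → Sealed S M → (∀ {f} → f ∈ faces (node b L M) → S f) →
                (∀ {x} → Side x b → ¬ Block x → S (face (τ₂ x))) →
                ∀ {x} → face x ∈ faces (node b L M) → ¬ Block x → S (face (τ₂ x))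
        inside : ∀ {S : Fin nF → Set} {b} (D : Disc b) → Sealed S D → (∀ {f} → f ∈ faces D → S f) →
                 S (face (τ₂ b)) → ∀ {x} → face x ∈ faces D → ¬ Block x → S (face (τ₂ x))
        inside {S} (node b L M) (_ , sL , sM) inc base =
          below L M sL sM inc λ sd _ → subst S (sym (side-face (side-τ₂ sd))) base
        below {S} {b} L M sL sM inc base {x} p ¬p with ∈-faces L M p
        ... | inj₂ (inj₁ q) = inside L sL (inc ∘ inL {L = L} {M}) (inc (subst (_∈ faces (node b L M))
                (sym (trans (cong face (inv₂ _)) (f-τ₁ b))) (∈-faces-base L M))) q ¬p
        ... | inj₂ (inj₂ q) = inside M sM (inc ∘ ∈-++⁺ˡ) (inc (subst (_∈ faces (node b L M))
                (sym (trans (cong face (inv₂ _)) (f-third b))) (∈-faces-base L M))) q ¬p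
        ... | inj₁ e with face-sides e
        ...   | inj₁ sd = base sd ¬p
        ...   | inj₂ (inj₁ sd) = across L sL (inc ∘ inL {L = L} {M}) (subst (Side x) (sym (inv₂ _)) sd) ¬p
        ...   | inj₂ (inj₂ sd) = across M sM (inc ∘ ∈-++⁺ˡ) (subst (Side x) (sym (inv₂ _)) sd) ¬p

      -- An unblocked side of a found face was crossed by the tree or belongs to a leaf that leads
      -- to a found face. The starting edge has to be blocked because nothing was explored beyond
      -- it.
      escape : ∀ {b} (X : Explored b) → Block b → let open Explored X in
               ∀ {x} → face x ∈ faces (node b L M) → ¬ Block x → face (τ₂ x) ∈ faces (node b L M)
      escape X p = below (Explored.L X) (Explored.M X) (Explored.closedL X) (Explored.closedM X) (λ q → q)
                     (λ sd ¬p → contradiction (block-side sd p) ¬p)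

-- The faces remain connected when tree edges must not be crossed.

module Dual {N g : ℕ} (Δ : Triangulation N g) (T : BFSTree N (Triangulation.Adj Δ)) where
  open Flags Δ
  open Exploration Δ
  open BFSTree T
  open Ancestry T using (V)

  -- The tree is given on vertices only. As there are no multiple edges, an edge belongs to it if
  -- its ends are child and parent.
  TE : Flag → Set
  TE x = (vertex x ≢ root × parent (vertex x) ≡ vertex (τ₀ x)) ⊎
         (vertex (τ₀ x) ≢ root × parent (vertex (τ₀ x)) ≡ vertex x)

  TE? : ∀ x → Dec (TE x)
  TE? x = (¬? (vertex x ≟ root) ×-dec (parent (vertex x) ≟ vertex (τ₀ x))) ⊎-dec
          (¬? (vertex (τ₀ x) ≟ root) ×-dec (parent (vertex (τ₀ x)) ≟ vertex x))

  TE-τ₀ : ∀ {x} → TE x → TE (τ₀ x)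
  TE-τ₀ {x} (inj₁ p) = inj₂ (subst (λ y → vertex y ≢ root × parent (vertex y) ≡ vertex (τ₀ x)) (sym (inv₀ x)) p)
  TE-τ₀ {x} (inj₂ p) = inj₁ (subst (λ y → vertex (τ₀ x) ≢ root × parent (vertex (τ₀ x)) ≡ vertex y) (sym (inv₀ x)) p)

  TE-ends : ∀ {x y} → vertex x ≡ vertex y → vertex (τ₀ x) ≡ vertex (τ₀ y) → TE x → TE y
  TE-ends p q t rewrite p | q = t

  TE-τ₂ : ∀ {x} → TE x → TE (τ₂ x)
  TE-τ₂ {x} = TE-ends (sym (v-τ₂ x)) (sym (v-τ₀τ₂ x))

  TE-side : ∀ {x y} → Side x y → TE y → TE x
  TE-side (inj₁ refl) t = t
  TE-side (inj₂ refl) t = TE-τ₀ t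

  TE-edge : ∀ {x y} → edge x ≡ edge y → TE y → TE x
  TE-edge e t with edge-sides e
  ... | inj₁ p = TE-side p t
  ... | inj₂ p = TE-side p (TE-τ₂ t)

  -- Around a deepest vertex v whose parent edge separates S from its complement, no other edge does:
  -- counting the flags of S at v in pairs by τ₁ and by τ₂ gives different parities.
  module Parity (S : Fin nF → Set) (S? : ∀ f → Dec (S f))
                (S-step : ∀ {x} → S (face x) → ¬ TE x → S (face (τ₂ x))) where

    Even : Flag → Set
    Even x = S (face x) → S (face (τ₂ x))

    private
      odd-corner : ∀ v x → vertex x ≡ v → v ≢ root → parent v ≡ vertex (τ₀ x) →
                   (∀ y → vertex (τ₀ y) ≡ v → vertex y ≢ root → parent (vertex y) ≡ v → Even y) →
                   S (face x) → ¬ S (face (τ₂ x)) → ⊥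
      odd-corner v x vx v≢r px IH sx ¬sx =
        even≢odd a b (trans (sym ha) (trans split (cong suc hb)))
        where
        At : Flag → Set
        At y = vertex y ≡ v × S (face y)
        at? : ∀ y → Dec (At y)
        at? y = (vertex y ≟ v) ×-dec S? (face y)
        h h′ : Flag → ℕ
        h y = ind (at? y)
        Off : Flag → Set
        Off y = y ≢ x × At y
        off? : ∀ y → Dec (Off y)
        off? y = ¬? (y ≟ x) ×-dec at? y
        h′ y = ind (off? y)
        h-τ₁ : ∀ y → h (τ₁ y) ≡ h y
        h-τ₁ y = ind-⇔ (at? (τ₁ y)) (at? y)
          (λ (p , q) → trans (sym (v-τ₁ y)) p , subst S (f-τ₁ y) q)
          (λ (p , q) → trans (v-τ₁ y) p , subst S (sym (f-τ₁ y)) q)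
        -- Another edge at `v` is outside the tree, or leads to a child, where the induction
        -- hypothesis applies, or would be the parent edge, which by `no-multi` is the edge of `x`.
        away : ∀ {y} → vertex y ≡ v → y ≢ x → y ≢ τ₂ x → S (face y) → S (face (τ₂ y))
        away {y} vy y≢x y≢τx s with TE? y
        ... | no ¬t = S-step s ¬t
        ... | yes (inj₂ (r , p)) = subst S (trans (cong face (sym (comm₀₂ y))) (f-τ₀ _))
                (IH (τ₀ y) (trans (cong vertex (inv₀ y)) vy) r (trans p vy) (subst S (sym (f-τ₀ y)) s))
        ... | yes (inj₁ (r , p)) with edge-sides (no-multi y x (trans vy (sym vx)) (trans (sym p) (trans (cong parent vy) px)))
        ...   | inj₁ (inj₁ e) = contradiction e y≢x
        ...   | inj₁ (inj₂ refl) = contradiction (trans vy (sym vx)) (no-loops x)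
        ...   | inj₂ (inj₁ e) = contradiction e y≢τx
        ...   | inj₂ (inj₂ refl) = contradiction (trans vy (trans (sym vx) (sym (v-τ₂ x)))) (no-loops (τ₂ x))
        off-τ₂ : ∀ {y} → Off y → Off (τ₂ y)
        off-τ₂ {y} (n , vy , s) with y ≟ τ₂ x
        ... | yes refl = contradiction s ¬sx
        ... | no n′ = (λ e → n′ (trans (sym (inv₂ y)) (cong τ₂ e))) , trans (v-τ₂ y) vy , away vy n n′ s
        h′-τ₂ : ∀ y → h′ (τ₂ y) ≡ h′ y
        h′-τ₂ y = ind-⇔ (off? (τ₂ y)) (off? y) (λ o → subst Off (inv₂ y) (off-τ₂ o)) off-τ₂
        point : ∀ y → h y ≡ ind (y ≟ x) + h′ y
        point y = go (y ≟ x)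
          where
          go : (d : Dec (y ≡ x)) → h y ≡ ind d + h′ y
          go (no n) = ind-⇔ (at? y) (off? y) (λ p → n , p) proj₂
          go (yes refl) = trans (≤-antisym (ind≤1 (at? y)) (ind-true (at? y) (vx , sx)))
                                (cong suc (sym (ind-zero (off? y) λ (n , _) → n refl)))
        split : sum h ≡ suc (sum h′)
        split = trans (sum-cong-≗ point) (trans (∑-distrib-+ (λ y → ind (y ≟ x)) h′) (cong (_+ sum h′) (sum-single x)))
        E₁ = involution-even τ₁ inv₁ fpf₁ h h-τ₁
        E₂ = involution-even τ₂ inv₂ fpf₂ h′ h′-τ₂
        a = proj₁ E₁
        b = proj₁ E₂
        ha = proj₂ E₁
        hb = proj₂ E₂

      -- Induction from the leaves of the tree towards the root: the hypothesis is used at children,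
      -- whose depth is larger by one, and no depth exceeds `sum depth`.
      parent-even : ∀ n v → sum depth ≤ n + depth v → v ≢ root → ∀ x → vertex x ≡ v → parent v ≡ vertex (τ₀ x) → Even x
      parent-even n v le v≢r x vx px s with S? (face (τ₂ x))
      ... | yes p = p
      ... | no ¬p = ⊥-elim (odd-corner v x vx v≢r px (IH n le) s ¬p)
        where
        IH : ∀ n → sum depth ≤ n + depth v → ∀ y → vertex (τ₀ y) ≡ v → vertex y ≢ root → parent (vertex y) ≡ v → Even y
        IH zero le y vy r p = contradiction
          (≤-trans (≤-reflexive (trans (cong (suc ∘ depth) (sym p)) (parent-depth _ r))) (≤-trans (≤-sum depth (vertex y)) le))
          (<-irrefl refl)
        IH (suc n) le y vy r p = parent-even n (vertex y)
          (≤-trans le (≤-reflexive (trans (sym (+-suc n _)) (cong (n +_) (trans (cong (suc ∘ depth) (sym p)) (parent-depth _ r))))))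
          r y refl (trans p (sym vy))

    all-even : ∀ x → Even x
    all-even x s with TE? x
    ... | no ¬t = S-step s ¬t
    ... | yes (inj₁ (r , p)) = parent-even (sum depth) (vertex x) (m≤m+n _ _) r x refl p s
    ... | yes (inj₂ (r , p)) = subst S (trans (cong face (sym (comm₀₂ x))) (f-τ₀ _))
            (parent-even (sum depth) (vertex (τ₀ x)) (m≤m+n _ _) r (τ₀ x) refl (trans p (cong vertex (sym (inv₀ x)))) (subst S (sym (f-τ₀ x)) s))

    everything : ∀ {x} → S (face x) → ∀ f → S f
    everything {x} s f with proj₁ face-orbits f
    ... | y , refl = go (connected x y)
      where
      go : ∀ {y} → Gen (τ₀ ∷ τ₁ ∷ τ₂ ∷ []) x y → S (face y)
      go gen-refl = s
      go (gen-step (here refl) r) = subst S (sym (f-τ₀ _)) (go r)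
      go (gen-step (there (here refl)) r) = subst S (sym (f-τ₁ _)) (go r)
      go (gen-step (there (there (here refl))) r) = all-even _ (go r)

-- Cutting the surface open into a polygon.

module Unfolding {N g : ℕ} (Δ : Triangulation N g) (T : BFSTree N (Triangulation.Adj Δ)) where
  open Flags Δ
  open Exploration Δ
  open Dual Δ T
  open BFSTree T
  open Ancestry T

  Adj-sym : ∀ {u w} → Adj u w → Adj w u
  Adj-sym (x , p , q) = τ₀ x , q , trans (cong vertex (inv₀ x)) p

  open Assembly T Adj-sym using (Polygon; Touches)

  apex : Flag → V
  apex b = vertex (τ₀ (τ₁ b))

  v-τ₀third : ∀ b → vertex (τ₀ (third b)) ≡ vertex (τ₀ b)
  v-τ₀third b = trans (cong (vertex ∘ τ₀) (sym (braid b))) (trans (cong vertex (inv₀ _)) (v-τ₁ _))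

  toPoly : ∀ {b} (D : Disc b) {u w} → vertex b ≡ u → vertex (τ₀ b) ≡ w → Poly u w
  toPoly (leaf b) refl refl with TE? b
  ... | yes (inj₁ (r , e)) = up r e
  ... | yes (inj₂ (r , e)) = down r e
  ... | no _ = stop (b , refl , refl)
  toPoly (node b L M) refl refl = Ancestry.node {z = apex b} (b , refl , refl)
    (toPoly L (trans (v-τ₂ _) (v-τ₁ b)) (v-τ₀τ₂ _))
    (toPoly M (trans (v-τ₂ _) (v-τ₁ _)) (trans (v-τ₀τ₂ _) (v-τ₀third b)))

  stopEdges : ∀ {b} → Disc b → List (Fin nE)
  stopEdges (leaf b) with TE? b
  ... | yes _ = []
  ... | no _  = edge b ∷ []
  stopEdges (node b L M) = stopEdges L ++ stopEdges M

  stopEdges-count : ∀ {b} (D : Disc b) {u w} (p : vertex b ≡ u) (q : vertex (τ₀ b) ≡ w) →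
                    stopCount (toPoly D p q) ≡ length (stopEdges D)
  stopEdges-count (leaf b) refl refl with TE? b
  ... | yes (inj₁ _) = refl
  ... | yes (inj₂ _) = refl
  ... | no _ = refl
  stopEdges-count (node b L M) refl refl =
    trans (cong₂ _+_ (stopEdges-count L _ _) (stopEdges-count M _ _)) (sym (length-++ (stopEdges L)))

  stopEdges-leaves : ∀ e {b} (D : Disc b) → occ e (stopEdges D) ≤ occ e (leaves D)
  stopEdges-leaves e (leaf b) with TE? b
  ... | yes _ = z≤n
  ... | no _  = ≤-refl
  stopEdges-leaves e (node b L M) = ≤-trans (≤-reflexive (occ-++ e (stopEdges L) _))
    (≤-trans (+-mono-≤ (stopEdges-leaves e L) (stopEdges-leaves e M)) (≤-reflexive (sym (occ-++ e (leaves L) _))))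

  stopEdges-¬TE : ∀ {e b} (D : Disc b) → e ∈ stopEdges D → ∃ λ y → e ≡ edge y × ¬ TE y
  stopEdges-¬TE (leaf b) p with TE? b
  stopEdges-¬TE (leaf b) (here e) | no ¬t = b , e , ¬t
  stopEdges-¬TE (node b L M) p with ∈-++⁻ (stopEdges L) p
  ... | inj₁ q = stopEdges-¬TE L q
  ... | inj₂ q = stopEdges-¬TE M q

  toPoly-stops : ∀ {R : V → Set} {b} (D : Disc b) {u w} (p : vertex b ≡ u) (q : vertex (τ₀ b) ≡ w) →
                 (∀ x → edge x ∈ stopEdges D → R (vertex x) × R (vertex (τ₀ x))) → Stops R (toPoly D p q)
  toPoly-stops (leaf b) refl refl f with TE? b
  ... | yes (inj₁ _) = tt
  ... | yes (inj₂ _) = tt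
  ... | no _ = f b (here refl)
  toPoly-stops (node b L M) refl refl f =
    toPoly-stops L _ _ (λ x p → f x (∈-++⁺ˡ p)) , toPoly-stops M _ _ (λ x p → f x (∈-++⁺ʳ (stopEdges L) p))

  count-root : ∀ {u w} (P : Poly u w) → count root P ≡ 0
  count-root (up r _) = Below.ε-≢ root r
  count-root (down r _) = Below.ε-≢ root r
  count-root (stop _) = refl
  count-root (Ancestry.node _ L M) = cong₂ _+_ (count-root L) (count-root M)

  -- As there are no multiple edges, every traversal of the edge above `q` comes from a leaf lying
  -- on the edge of `s`, so the two sides of this edge bound the count.
  toPoly-count : ∀ {q s} → vertex s ≡ q → vertex (τ₀ s) ≡ parent q → ∀ {b} (D : Disc b) {u w}
                 (p : vertex b ≡ u) (p′ : vertex (τ₀ b) ≡ w) → count q (toPoly D p p′) ≤ occ (edge s) (leaves D)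
  toPoly-count {q} {s} vs ps (leaf b) refl refl with TE? b
  ... | no _ = z≤n
  ... | yes (inj₁ (r , e)) with vertex b ≟ q
  ...   | no _ = z≤n
  ...   | yes refl = ≤-trans (ind-true (edge s ≟ edge b) (no-multi s b vs (trans ps e))) (m≤m+n _ _)
  toPoly-count {q} {s} vs ps (leaf b) refl refl | yes (inj₂ (r , e)) with vertex (τ₀ b) ≟ q
  ...   | no _ = z≤n
  ...   | yes refl = ≤-trans (ind-true (edge s ≟ edge b)
            (trans (no-multi s (τ₀ b) vs (trans ps (trans e (cong vertex (sym (inv₀ b)))))) (e-τ₀ b))) (m≤m+n _ _)
  toPoly-count vs ps (node b L M) refl refl = ≤-trans (+-mono-≤ (toPoly-count vs ps L _ _) (toPoly-count vs ps M _ _))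
    (≤-reflexive (sym (occ-++ _ (leaves L) _)))

  face-touches : ∀ {x b} → face x ≡ face b → Touches (vertex x) (vertex b) (apex b) (vertex (τ₀ b))
  face-touches e with face-sides e
  ... | inj₁ (inj₁ refl) = inj₁ refl
  ... | inj₁ (inj₂ refl) = inj₂ (inj₂ refl)
  ... | inj₂ (inj₁ (inj₁ refl)) = inj₁ (v-τ₁ _)
  ... | inj₂ (inj₁ (inj₂ refl)) = inj₂ (inj₁ refl)
  ... | inj₂ (inj₂ (inj₁ refl)) = inj₂ (inj₁ (v-τ₁ _))
  ... | inj₂ (inj₂ (inj₂ refl)) = inj₂ (inj₂ (v-τ₀third _))

  toPoly-edges : ∀ {b} (D : Disc b) {u w} (p : vertex b ≡ u) (q : vertex (τ₀ b) ≡ w) → ∀ {x} → face x ∈ faces D →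
                 ∃ λ a → ∃₂ λ y t → Tri (toPoly D p q) a y t × Touches (vertex x) a y t × Touches (vertex (τ₀ x)) a y t
  toPoly-edges (node b L M) refl refl {x} f∈ with ∈-faces L M f∈
  ... | inj₁ e = _ , _ , _ , top , face-touches e , face-touches (trans (f-τ₀ x) e)
  ... | inj₂ (inj₁ r) = let _ , _ , _ , τ , i , j = toPoly-edges L _ _ r in _ , _ , _ , left τ , i , j
  ... | inj₂ (inj₂ r) = let _ , _ , _ , τ , i , j = toPoly-edges M _ _ r in _ , _ , _ , right τ , i , j

  polygon : ∀ {k b} (L : Disc (τ₂ (τ₁ b))) (M : Disc (τ₂ (third b))) → Unique (faces (node b L M)) →
            (∀ f → f ∈ faces (node b L M)) → ∀ z zs → length zs ≤ k → length (stopEdges (node b L M)) ≤ k →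
            (∀ x → edge x ≡ edge b ⊎ edge x ∈ stopEdges (node b L M) → vertex x ∈ z ∷ zs × vertex (τ₀ x) ∈ z ∷ zs) →
            Polygon k
  polygon {k} {b} L M u all z zs zs≤ stops≤ ends = record
    { P₀ = toPoly D refl refl
    ; z₁ = z
    ; zs = zs
    ; left∈ = proj₁ (ends b (inj₁ refl))
    ; right∈ = proj₂ (ends b (inj₁ refl))
    ; stops∈ = toPoly-stops D refl refl λ x p → ends x (inj₂ p)
    ; twice = tw
    ; stops≤ = ≤-trans (≤-reflexive (stopEdges-count D refl refl)) stops≤
    ; zs≤ = zs≤
    ; edges = λ { (x , refl , refl) → toPoly-edges D refl refl (all (face x)) }
    ; degree = λ v → let x , e = proj₁ vertex-orbits v in vertex (τ₀ x) , x , e , refl }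
    where
    D = node b L M
    tw : ∀ q → count q (toPoly D refl refl) ≤ 2
    tw q with q ≟ root
    ... | yes refl = ≤-trans (≤-reflexive (count-root (toPoly D refl refl))) z≤n
    ... | no r with parent-adj q r
    ...   | s , vs , ps = ≤-trans (toPoly-count vs ps D refl refl) (≤-trans (m≤m+n _ _)
              (≤-trans (m≤n+m _ (ind (edge s ≟ edge b))) (edge-twice (edge s) L M u)))

  tree-flag : ∃ TE
  tree-flag with proj₁ vertex-orbits root
  ... | x , e with parent-adj (vertex (τ₀ x)) (λ p → no-loops x (trans p (sym e)))
  ...   | s , vs , ps = s , inj₁ ((λ p → no-loops x (trans (trans (sym vs) p) (sym e))) , trans (cong parent vs) (sym ps))

  module First = Search TE TE?

  b₁ : Flag
  b₁ = proj₁ tree-flag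

  first : First.Explored b₁
  first = First.explore b₁

  open First.Explored first using () renaming (L to L₁; M to M₁; distinct to distinct₁; closedL to closedL₁; closedM to closedM₁)

  D₁ : Disc b₁
  D₁ = node b₁ L₁ M₁

  -- By `escape` the faces found are closed under crossing edges outside the tree, and the parity
  -- argument extends this to all edges.
  all₁ : ∀ f → f ∈ faces D₁
  all₁ = Parity.everything (_∈ faces D₁) (λ f → f ∈ᶠ? faces D₁)
           (First.escape TE-side TE-τ₂ first (proj₂ tree-flag)) (∈-faces-base L₁ M₁)
    where open DecMembership (_≟_ {nF}) using () renaming (_∈?_ to _∈ᶠ?_)

  treeEdges : (vs : List V) → All (_≢ root) vs → List (Fin nE)
  treeEdges [] [] = []
  treeEdges (v ∷ vs) (r ∷ rs) = edge (proj₁ (parent-adj v r)) ∷ treeEdges vs rs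

  treeEdges-∈ : ∀ {e vs} (rs : All (_≢ root) vs) → e ∈ treeEdges vs rs →
                ∃ λ v → v ∈ vs × ∃ λ s → vertex s ≡ v × vertex (τ₀ s) ≡ parent v × e ≡ edge s × v ≢ root
  treeEdges-∈ {vs = v ∷ vs} (r ∷ rs) (here e) = let s , vs , ps = parent-adj v r in v , here refl , s , vs , ps , e , r
  treeEdges-∈ {vs = v ∷ vs} (r ∷ rs) (there p) = let v , q , rest = treeEdges-∈ rs p in v , there q , rest

  treeEdges-length : ∀ {vs} (rs : All (_≢ root) vs) → length (treeEdges vs rs) ≡ length vs
  treeEdges-length [] = refl
  treeEdges-length (r ∷ rs) = cong suc (treeEdges-length rs)

  no-2-cycle : ∀ {v w} → v ≢ root → w ≢ root → w ≡ parent v → v ≡ parent w → ⊥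
  no-2-cycle {v} {w} rv rw e f = <-irrefl refl (begin-strict
    depth v                  ≡⟨ cong depth f ⟩
    depth (parent w)         <⟨ n<1+n _ ⟩
    suc (depth (parent w))   ≡⟨ parent-depth w rw ⟩
    depth w                  ≡⟨ cong depth e ⟩
    depth (parent v)         <⟨ n<1+n _ ⟩
    suc (depth (parent v))   ≡⟨ parent-depth v rv ⟩
    depth v                  ∎)
    where open ≤-Reasoning

  lower-end : ∀ {s t v w} → vertex s ≡ v → vertex (τ₀ s) ≡ parent v → vertex t ≡ w → vertex (τ₀ t) ≡ parent w →
              v ≢ root → w ≢ root → edge s ≡ edge t → v ≡ w
  lower-end {s} {t} refl ps refl pt rv rw e with edge-sides e
  ... | inj₁ (inj₁ refl) = refl
  ... | inj₂ (inj₁ refl) = v-τ₂ t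
  ... | inj₁ (inj₂ refl) = ⊥-elim (no-2-cycle rw rv pt (trans (cong vertex (sym (inv₀ t))) ps))
  ... | inj₂ (inj₂ refl) = ⊥-elim (no-2-cycle rw rv (trans (v-τ₀τ₂ t) pt)
          (trans (sym (v-τ₂ t)) (trans (cong vertex (sym (inv₀ (τ₂ t)))) ps)))

  treeEdges-unique : ∀ {vs} (rs : All (_≢ root) vs) → Unique vs → Unique (treeEdges vs rs)
  treeEdges-unique [] [] = []
  treeEdges-unique {v ∷ vs} (r ∷ rs) (p ∷ u) = All.tabulate (λ q e →
      let s , sv , sp = parent-adj v r
          w , w∈ , t , tv , tp , e′ , rw = treeEdges-∈ rs q
      in All.lookup p w∈ (lower-end sv sp tv tp r rw (trans e e′))) ∷ treeEdges-unique rs u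

  nonroots : List V
  nonroots = filter (λ v → ¬? (v ≟ root)) (allFin N)

  nonroots-≢ : All (_≢ root) nonroots
  nonroots-≢ = All.tabulate λ p → proj₂ (∈-filter⁻ (λ v → ¬? (v ≟ root)) {xs = allFin N} p)

  TL : List (Fin nE)
  TL = treeEdges nonroots nonroots-≢

  TL-length : N ≤ suc (length TL)
  TL-length = ≤-trans (covering-length {xs = root ∷ nonroots} λ v → cov v (v ≟ root))
                (≤-reflexive (cong suc (sym (treeEdges-length nonroots-≢))))
    where
    cov : ∀ v → Dec (v ≡ root) → v ∈ root ∷ nonroots
    cov v (yes e) = here e
    cov v (no n)  = there (∈-filter⁺ (λ v → ¬? (v ≟ root)) (∈-allFin v) n)

  TL-unique : Unique TL
  TL-unique = treeEdges-unique nonroots-≢ (Uniqueₚ.filter⁺ (λ v → ¬? (v ≟ root)) (Uniqueₚ.allFin⁺ N))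

  TL-TE : ∀ {x} → edge x ∈ TL → TE x
  TL-TE p with treeEdges-∈ nonroots-≢ p
  ... | v , _ , s , refl , ps , e , r = TE-edge e (inj₁ (r , sym ps))

  cross-length : ∀ {b} (D : Disc b) → length (faces D) ≡ length (cross D)
  cross-length (leaf b) = refl
  cross-length (node b L M) = begin
    length (faces M ++ (faces L ++ (face b ∷ [])))         ≡⟨ trans (length-++ (faces M)) (cong (length (faces M) +_) (length-++ (faces L))) ⟩
    length (faces M) + (length (faces L) + 1)              ≡⟨ cong₂ (λ x y → x + (y + 1)) (cross-length M) (cross-length L) ⟩
    length (cross M) + (length (cross L) + 1)              ≡⟨ +-comm (length (cross M)) _ ⟩
    length (cross L) + 1 + length (cross M)                ≡⟨ cong (_+ length (cross M)) (+-comm (length (cross L)) 1) ⟩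
    suc (length (cross L) + length (cross M))              ≡⟨ cong suc (sym (length-++ (cross L))) ⟩
    suc (length (cross L ++ cross M))                      ∎
    where open ≡-Reasoning

  ends : List (Fin nE) → List V
  ends []       = []
  ends (e ∷ es) = vertex (proj₁ (proj₁ edge-orbits e)) ∷ vertex (τ₀ (proj₁ (proj₁ edge-orbits e))) ∷ ends es

  ends-length : ∀ es → length (ends es) ≡ 2 * length es
  ends-length [] = refl
  ends-length (e ∷ es) = trans (cong (2 +_) (ends-length es)) (sym (*-suc 2 (length es)))

  ends-∈ : ∀ {es x} → edge x ∈ es → vertex x ∈ ends es × vertex (τ₀ x) ∈ ends es
  ends-∈ (there p) = let a , b = ends-∈ p in there (there a) , there (there b)
  ends-∈ {e ∷ es} {x} (here p) with proj₁ edge-orbits e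
  ... | s , refl with edge-sides p
  ...   | inj₁ (inj₁ refl) = here refl , there (here refl)
  ...   | inj₁ (inj₂ refl) = there (here refl) , here (cong vertex (inv₀ s))
  ...   | inj₂ (inj₁ refl) = here (v-τ₂ s) , there (here (v-τ₀τ₂ s))
  ...   | inj₂ (inj₂ refl) = there (here (v-τ₀τ₂ s)) , here (trans (cong vertex (inv₀ (τ₂ s))) (v-τ₂ s))

  -- The first search only serves to find an edge y that some spanning tree of the dual avoids;
  -- the second search starts there, so that y becomes the base of the polygon.
  module Second (y : Flag) (¬ty : ¬ TE y) (y∈ : edge y ∈ leaves L₁ ++ leaves M₁) where

    Block : Flag → Set
    Block x = TE x ⊎ edge x ≡ edge y

    block? : ∀ x → Dec (Block x)
    block? x = TE? x ⊎-dec (edge x ≟ edge y)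

    side-edge : ∀ {x z} → Side x z → edge x ≡ edge z
    side-edge (inj₁ refl) = refl
    side-edge (inj₂ refl) = e-τ₀ _

    block-side : ∀ {x z} → Side x z → Block z → Block x
    block-side s (inj₁ t) = inj₁ (TE-side s t)
    block-side s (inj₂ e) = inj₂ (trans (side-edge s) e)

    block-τ₂ : ∀ {x} → Block x → Block (τ₂ x)
    block-τ₂ (inj₁ t) = inj₁ (TE-τ₂ t)
    block-τ₂ (inj₂ e) = inj₂ (trans (e-τ₂ _) e)

    module S₂ = Search Block block?

    second : S₂.Explored y
    second = S₂.explore y

    open S₂.Explored second

    D : Disc y
    D = node y L M

    step₂ : ∀ {x} → face x ∈ faces D → ¬ Block x → face (τ₂ x) ∈ faces D
    step₂ = S₂.escape block-side block-τ₂ second (inj₂ refl)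

    -- As a leaf, this edge takes up one of its two sides, and a crossing would need both.
    y∉cross : edge y ∉ cross L₁ ++ cross M₁
    y∉cross p = contradiction (≤-trans (+-mono-≤ (occ-∈ y∈) (*-monoʳ-≤ 2 (occ-∈ p)))
      (≤-trans (m≤n+m _ (ind (edge y ≟ edge b₁))) (edge-twice (edge y) L₁ M₁ distinct₁))) λ { (s≤s (s≤s ())) }

    -- The dual tree of the first search crosses no blocked edge of the second. Membership in the
    -- second disc can thus be carried along it in both directions, and all faces behave alike.
    spread : ∀ {F : Fin nF → Set} {b} (E : Disc b) → First.Sealed F E → edge y ∉ cross E → ∀ {f} → f ∈ faces E →
             (f ∈ faces D → face (τ₂ b) ∈ faces D) × (face (τ₂ b) ∈ faces D → f ∈ faces D)
    spread-root : ∀ {F : Fin nF → Set} {b} (E₁ : Disc (τ₂ (τ₁ b))) (E₂ : Disc (τ₂ (third b))) → First.Sealed F E₁ → First.Sealed F E₂ →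
             edge y ∉ cross E₁ ++ cross E₂ → ∀ {f} → f ∈ faces (node b E₁ E₂) →
             (f ∈ faces D → face b ∈ faces D) × (face b ∈ faces D → f ∈ faces D)
    spread (node b E₁ E₂) (¬t , s₁ , s₂) n p with spread-root E₁ E₂ s₁ s₂ (n ∘ there) p
    ... | to , from = (λ q → step₂ (to q) ¬b) ,
                      (λ q → from (subst (_∈ faces D) (cong face (inv₂ b)) (step₂ q (λ x → ¬b (subst Block (inv₂ b) (block-τ₂ x))))))
      where
      ¬b : ¬ Block b
      ¬b (inj₁ t) = ¬t t
      ¬b (inj₂ e) = n (here (sym e))
    spread-root {b = b} E₁ E₂ s₁ s₂ n p with ∈-faces E₁ E₂ p
    ... | inj₁ refl = (λ q → q) , (λ q → q)
    ... | inj₂ (inj₁ q) = subst (λ g → (_ ∈ faces D → g ∈ faces D) × (g ∈ faces D → _ ∈ faces D))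
            (trans (cong face (inv₂ _)) (f-τ₁ b)) (spread E₁ s₁ (n ∘ ∈-++⁺ˡ) q)
    ... | inj₂ (inj₂ q) = subst (λ g → (_ ∈ faces D → g ∈ faces D) × (g ∈ faces D → _ ∈ faces D))
            (trans (cong face (inv₂ _)) (f-third b)) (spread E₂ s₂ (n ∘ ∈-++⁺ʳ (cross E₁)) q)

    all₂ : ∀ f → f ∈ faces D
    all₂ f = proj₂ (spread-root L₁ M₁ closedL₁ closedM₁ y∉cross (all₁ f))
               (proj₁ (spread-root L₁ M₁ closedL₁ closedM₁ y∉cross (all₁ (face y))) (∈-faces-base L M))

    CL : List (Fin nE)
    CL = cross L ++ cross M

    CL-length : nF ≤ suc (length CL)
    CL-length = ≤-trans (covering-length all₂) (≤-reflexive (cross-length D))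

    sealed-cross : ∀ {F : Fin nF → Set} {b} (E : Disc b) → S₂.Sealed F E → ∀ {x} → edge x ∈ cross E → ¬ TE x
    sealed-cross (node b E₁ E₂) (n , s₁ , s₂) (here e) t = n (inj₁ (TE-edge (sym e) t))
    sealed-cross (node b E₁ E₂) (n , s₁ , s₂) (there p) with ∈-++⁻ (cross E₁) p
    ... | inj₁ q = sealed-cross E₁ s₁ q
    ... | inj₂ q = sealed-cross E₂ s₂ q

    CL-¬TE : ∀ {x} → edge x ∈ CL → ¬ TE x
    CL-¬TE p with ∈-++⁻ (cross L) p
    ... | inj₁ q = sealed-cross L closedL q
    ... | inj₂ q = sealed-cross M closedM q

    twice : ∀ e → ind (e ≟ edge y) + (occ e (leaves L ++ leaves M) + 2 * occ e CL) ≤ 2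
    twice e = edge-twice e L M distinct

    open DecMembership (_≟_ {nE}) using (_∈?_)

    extra? : ∀ e → Dec (e ∉ TL × e ∉ CL)
    extra? e = ¬? (e ∈? TL) ×-dec ¬? (e ∈? CL)

    EL : List (Fin nE)
    EL = filter extra? (allFin nE)

    EL-unique : Unique EL
    EL-unique = Uniqueₚ.filter⁺ extra? (Uniqueₚ.allFin⁺ nE)

    kinds : ∀ e → occ e TL + occ e CL + occ e EL ≤ 1
    kinds e = excl (excl (occ-unique TL-unique) once tree-cross) (occ-unique EL-unique) extra
      where
      once : occ e CL ≤ 1
      once = *-cancelˡ-≤ 2 (≤-trans (m≤n+m _ (occ e (leaves L ++ leaves M))) (≤-trans (m≤n+m _ (ind (e ≟ edge y))) (twice e)))
      tree-cross : 1 ≤ occ e TL → 1 ≤ occ e CL → ⊥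
      tree-cross p q with proj₁ edge-orbits e
      ... | s , refl = CL-¬TE (occ-pos CL q) (TL-TE (occ-pos TL p))
      extra : 1 ≤ occ e TL + occ e CL → 1 ≤ occ e EL → ⊥
      extra p q with proj₂ (∈-filter⁻ extra? {xs = allFin nE} (occ-pos EL q)) | pos-+ {occ e TL} p
      ... | n , _ | inj₁ r = n (occ-pos TL r)
      ... | _ , n | inj₂ r = n (occ-pos CL r)

    -- There are at least `N − 1` tree edges and `nF − 1` crossed edges. The three kinds are
    -- disjoint, so Euler's formula leaves at most `g`.
    EL-length : length EL ≤ g
    EL-length = +-cancelˡ-≤ (N + nF) _ _ (begin
      N + nF + length EL                                       ≤⟨ +-monoˡ-≤ (length EL) (+-mono-≤ TL-length CL-length) ⟩
      suc (length TL) + suc (length CL) + length EL            ≡⟨ cong (λ s → suc s + length EL) (+-suc (length TL) (length CL)) ⟩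
      2 + (length TL + length CL + length EL)                  ≡⟨ cong (2 +_) (sym lengths) ⟩
      2 + sum (λ e → occ e TL + occ e CL + occ e EL)           ≤⟨ +-monoʳ-≤ 2 (sum-mono _ _ kinds) ⟩
      2 + sum {nE} (λ _ → 1)                                   ≡⟨ cong (2 +_) sum-one ⟩
      2 + nE                                                   ≡⟨ trans (+-comm 2 nE) (sym euler) ⟩
      N + nF + g                                               ∎)
      where
      open ≤-Reasoning
      lengths : sum (λ e → occ e TL + occ e CL + occ e EL) ≡ length TL + length CL + length EL
      lengths = trans (∑-distrib-+ (λ e → occ e TL + occ e CL) (λ e → occ e EL))
        (cong₂ _+_ (trans (∑-distrib-+ (λ e → occ e TL) (λ e → occ e CL)) (cong₂ _+_ (sum-occ TL) (sum-occ CL))) (sum-occ EL))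

    SL : List (Fin nE)
    SL = stopEdges D

    loose : ∀ e → 1 ≤ ind (e ≟ edge y) + occ e SL → e ∈ EL
    loose e p = ∈-filter⁺ extra? (∈-allFin e) (not-tree , not-cross)
      where
      not-tree : e ∉ TL
      not-tree q with pos-+ {ind (e ≟ edge y)} p
      ... | inj₁ r with ind-pos (e ≟ edge y) r
      ...   | refl = ¬ty (TL-TE q)
      not-tree q | inj₂ r with stopEdges-¬TE D (occ-pos SL r)
      ...   | s , refl , ¬t = ¬t (TL-TE q)
      not-cross : e ∉ CL
      not-cross q = contradiction (begin
        3                                                              ≤⟨ +-mono-≤ p (*-monoʳ-≤ 2 (occ-∈ q)) ⟩
        ind (e ≟ edge y) + occ e SL + 2 * occ e CL                     ≡⟨ +-assoc (ind (e ≟ edge y)) _ _ ⟩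
        ind (e ≟ edge y) + (occ e SL + 2 * occ e CL)                   ≤⟨ +-monoʳ-≤ (ind (e ≟ edge y)) (+-monoˡ-≤ (2 * occ e CL) (stopEdges-leaves e D)) ⟩
        ind (e ≟ edge y) + (occ e (leaves L ++ leaves M) + 2 * occ e CL) ≤⟨ twice e ⟩
        2                                                              ∎) λ { (s≤s (s≤s ())) }
        where open ≤-Reasoning

    sides : ∀ e → ind (e ≟ edge y) + occ e SL ≤ occ e EL + occ e EL
    sides e with 1 ≤? ind (e ≟ edge y) + occ e SL
    ... | no n = ≤-trans (≤-pred (≰⇒> n)) z≤n
    ... | yes p = ≤-trans (≤-trans (+-monoʳ-≤ (ind (e ≟ edge y)) (≤-trans (stopEdges-leaves e D) (m≤m+n _ _))) (twice e))
                    (+-mono-≤ (occ-∈ (loose e p)) (occ-∈ (loose e p)))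

    -- The successor stands for the base, which is itself a side of an extra edge.
    SL-length : suc (length SL) ≤ 2 * g
    SL-length = begin
      suc (length SL)                                          ≡⟨ cong₂ _+_ (sym (sum-single (edge y))) (sym (sum-occ SL)) ⟩
      sum (λ e → ind (e ≟ edge y)) + sum (λ e → occ e SL)      ≡⟨ sym (∑-distrib-+ (λ e → ind (e ≟ edge y)) (λ e → occ e SL)) ⟩
      sum (λ e → ind (e ≟ edge y) + occ e SL)                  ≤⟨ sum-mono _ _ sides ⟩
      sum (λ e → occ e EL + occ e EL)                          ≡⟨ ∑-distrib-+ (λ e → occ e EL) (λ e → occ e EL) ⟩
      sum (λ e → occ e EL) + sum (λ e → occ e EL)              ≡⟨ cong₂ _+_ (sum-occ EL) (sum-occ EL) ⟩
      length EL + length EL                                    ≤⟨ +-mono-≤ EL-length EL-length ⟩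
      g + g                                                    ≡⟨ cong (g +_) (sym (+-identityʳ g)) ⟩
      2 * g                                                    ∎
      where open ≤-Reasoning

    ends∈ : ∀ x → edge x ≡ edge y ⊎ edge x ∈ SL → vertex x ∈ ends EL × vertex (τ₀ x) ∈ ends EL
    ends∈ x (inj₁ e) = ends-∈ (loose (edge x) (≤-trans (ind-true (edge x ≟ edge y) e) (m≤m+n _ _)))
    ends∈ x (inj₂ p) = ends-∈ (loose (edge x) (≤-trans (occ-∈ p) (m≤n+m _ (ind (edge x ≟ edge y)))))

    result : Polygon (2 * g ∸ 1)
    result = go (ends EL) (≤-trans (≤-reflexive (ends-length EL)) (*-monoʳ-≤ 2 EL-length)) ends∈
      where
      go : ∀ zs → length zs ≤ 2 * g → (∀ x → edge x ≡ edge y ⊎ edge x ∈ SL → vertex x ∈ zs × vertex (τ₀ x) ∈ zs) → Polygon (2 * g ∸ 1)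
      go [] le f = contradiction (proj₁ (f y (inj₁ refl))) λ ()
      go (z ∷ zs) le f = polygon L M distinct all₂ z zs (∸-monoˡ-≤ 1 le) (∸-monoˡ-≤ 1 SL-length) f

  -- Without stop sides the tree edge `b₁` can stay the base: its two ends suffice, as `2g − 1` is
  -- at least one. Otherwise keeping it would require labelled vertices besides the ends of the
  -- extra edges and allow up to `2g` stops, so the surface is opened at an extra edge instead.
  unfolded : 0 < g → Polygon (2 * g ∸ 1)
  unfolded 0<g = go (stopEdges D₁) refl
    where
    1≤ : 1 ≤ 2 * g ∸ 1
    1≤ = ∸-monoˡ-≤ 1 (*-monoʳ-≤ 2 0<g)
    go : ∀ es → stopEdges D₁ ≡ es → Polygon (2 * g ∸ 1)
    go [] eq = polygon L₁ M₁ distinct₁ all₁ (vertex b₁) (vertex (τ₀ b₁) ∷ []) 1≤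
                 (≤-trans (≤-reflexive (cong length eq)) z≤n)
                 λ { x (inj₁ e) → base e (edge-sides e)
                   ; x (inj₂ p) → contradiction (subst (edge x ∈_) eq p) λ () }
      where
      base : ∀ {x} → edge x ≡ edge b₁ → Side x b₁ ⊎ Side x (τ₂ b₁) →
             vertex x ∈ vertex b₁ ∷ vertex (τ₀ b₁) ∷ [] × vertex (τ₀ x) ∈ vertex b₁ ∷ vertex (τ₀ b₁) ∷ []
      base _ (inj₁ (inj₁ refl)) = here refl , there (here refl)
      base _ (inj₁ (inj₂ refl)) = there (here refl) , here (cong vertex (inv₀ b₁))
      base _ (inj₂ (inj₁ refl)) = here (v-τ₂ b₁) , there (here (v-τ₀τ₂ b₁))
      base _ (inj₂ (inj₂ refl)) = there (here (v-τ₀τ₂ b₁)) , here (trans (cong vertex (inv₀ (τ₂ b₁))) (v-τ₂ b₁))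
    go (e ∷ es) eq with stopEdges-¬TE D₁ (subst (e ∈_) (sym eq) (here refl))
    ... | y , refl , ¬t = Second.result y ¬t (occ-pos _ (≤-trans (occ-∈ (subst (edge y ∈_) (sym eq) (here refl))) (stopEdges-leaves (edge y) D₁)))

-- Comparison with the stated bounds.

bag-arith : ∀ g → 0 < g → suc (2 * g ∸ 1) + 3 * (3 * (2 * g ∸ 1) ∸ 5) ≤ 6 ⊔ (32 * g ∸ 27)
-- For genus one no round takes place and two paths suffice. From genus two on the count is
-- `20g − 24`.
bag-arith (suc zero) _ = s≤s (s≤s z≤n)
bag-arith (suc (suc h)) _ = ≤-trans (≤-trans (≤-reflexive lhs) (≤-trans (m≤m+n _ (12 * h + 21)) (≤-reflexive rhs))) (m≤n⊔m 6 (32 * (2 + h) ∸ 27))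
  where
  open +-*-Solver
  k≡ : 2 * (2 + h) ∸ 1 ≡ 3 + 2 * h
  k≡ = cong (_∸ 1) (solve 1 (λ h → con 2 :* (con 2 :+ h) := con 4 :+ con 2 :* h) refl h)
  n≡ : 3 * (2 * (2 + h) ∸ 1) ∸ 5 ≡ 4 + 6 * h
  n≡ = cong (_∸ 5) (trans (cong (3 *_) k≡) (solve 1 (λ h → con 3 :* (con 3 :+ con 2 :* h) := con 9 :+ con 6 :* h) refl h))
  lhs : suc (2 * (2 + h) ∸ 1) + 3 * (3 * (2 * (2 + h) ∸ 1) ∸ 5) ≡ 16 + 20 * h
  lhs = trans (cong₂ (λ k n → suc k + 3 * n) k≡ n≡)
          (solve 1 (λ h → con 4 :+ con 2 :* h :+ con 3 :* (con 4 :+ con 6 :* h) := con 16 :+ con 20 :* h) refl h)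
  rhs : 16 + 20 * h + (12 * h + 21) ≡ 32 * (2 + h) ∸ 27
  rhs = trans (solve 1 (λ h → con 16 :+ con 20 :* h :+ (con 12 :* h :+ con 21) := con 37 :+ con 32 :* h) refl h)
          (cong (_∸ 27) (solve 1 (λ h → con 64 :+ con 32 :* h := con 32 :* (con 2 :+ h)) refl h))

-- For genus one the bound 6 is met with equality. From genus two on the left side is `96g − 118`.
child-arith : ∀ g → 0 < g → 2 * (3 * (2 * g ∸ 1)) + 14 * (3 * (2 * g ∸ 1) ∸ 5) ≤ 6 * (1 ⊔ (18 * g ∸ 21))
child-arith (suc zero) _ = ≤-refl
child-arith (suc (suc h)) _ = ≤-trans (≤-trans (≤-reflexive lhs) (≤-trans (m≤m+n _ (16 + 12 * h)) (≤-reflexive rhs)))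
                                (*-monoʳ-≤ 6 (m≤n⊔m 1 (18 * (2 + h) ∸ 21)))
  where
  open +-*-Solver
  k≡ : 2 * (2 + h) ∸ 1 ≡ 3 + 2 * h
  k≡ = cong (_∸ 1) (solve 1 (λ h → con 2 :* (con 2 :+ h) := con 4 :+ con 2 :* h) refl h)
  n≡ : 3 * (2 * (2 + h) ∸ 1) ∸ 5 ≡ 4 + 6 * h
  n≡ = cong (_∸ 5) (trans (cong (3 *_) k≡) (solve 1 (λ h → con 3 :* (con 3 :+ con 2 :* h) := con 9 :+ con 6 :* h) refl h))
  lhs : 2 * (3 * (2 * (2 + h) ∸ 1)) + 14 * (3 * (2 * (2 + h) ∸ 1) ∸ 5) ≡ 74 + 96 * h
  lhs = trans (cong₂ (λ k n → 2 * (3 * k) + 14 * n) k≡ n≡)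
          (solve 1 (λ h → con 2 :* (con 3 :* (con 3 :+ con 2 :* h)) :+ con 14 :* (con 4 :+ con 6 :* h) := con 74 :+ con 96 :* h) refl h)
  rhs : 74 + 96 * h + (16 + 12 * h) ≡ 6 * (18 * (2 + h) ∸ 21)
  rhs = trans (solve 1 (λ h → con 74 :+ con 96 :* h :+ (con 16 :+ con 12 :* h) := con 6 :* (con 15 :+ con 18 :* h)) refl h)
          (cong (λ s → 6 * (s ∸ 21)) (solve 1 (λ h → con 36 :+ con 18 :* h := con 18 :* (con 2 :+ h)) refl h))

theorem13 : ∀ (N g : ℕ) → 0 < g → (Δ : Triangulation N g) →
    (T : BFSTree N (Triangulation.Adj Δ)) →
    ∃ λ (P : VerticalPartition T) →
    ∃ λ (D : RootedTreeDecomposition (VerticalPartition.p P) (QAdj P)) →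
    Theorem13Properties Δ T P D
theorem13 N g 0<g Δ T = Construction.constructed Δ T (Unfolding.Adj-sym Δ T) (∸-monoˡ-≤ 1 (*-monoʳ-≤ 2 0<g))
  (Unfolding.unfolded Δ T 0<g) (bag-arith g 0<g) (child-arith g 0<g)
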